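{- Let $G$ be a $k$-contraction-critical graph. Then: (1) if $k\ge 17$, then $G$ is $8$-connected; (2) if $k\ge 29$, then $G$ is $9$-connected; (3) if $k\ge 41$, then $G$ is $10$-connected. It follows that $h(k)\ge 8$ for $k\ge 17$, $h(k)\ge 9$ for $k\ge 29$, and $h(k)\ge 10$ for $k\ge 41$.
   Context: Graphs are finite and simple. A graph $H$ is a minor of a graph $G$ if $H$ can be obtained from a subgraph of $G$ by contracting edges; it is a proper minor if it is a minor other than $G$ itself. A graph $G$ is $k$-contraction-critical if $G$ is $k$-chromatic (its chromatic number is exactly $k$) but every proper minor of $G$ is $(k-1)$-colorable. A graph is $m$-connected if it has more than $m$ vertices and deleting any set of fewer than $m$ vertices leaves a connected graph. The quantity $h(k)$ is the largest integer such that every noncomplete $k$-contraction-critical graph is $h(k)$-connected; the inequality $h(k)\ge m$ is read as: every noncomplete $k$-contraction-critical graph is $m$-connected. -}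

module Defs where

open import Data.Fin using (Fin)
open import Data.Fin.Subset using (Subset; _∈_; ∁; ∣_∣)
open import Data.Nat using (ℕ; _∸_; _≤_; _<_)
open import Data.Product using (Σ-syntax; ∃; _×_; proj₁)
open import Data.Sum using (_⊎_)
open import Function.Base using (_on_)
open import Function.Bundles using (_⇔_; _↔_; Inverse)
open import Function.Definitions using (Injective; StrictlySurjective)
open import Level using (0ℓ)
open import Relation.Binary.Construct.Closure.ReflexiveTransitive using (Star)
open import Relation.Binary.Core using (Rel)
open import Relation.Binary.Definitions using (Decidable; Symmetric)
open import Relation.Binary.PropositionalEquality using (_≡_; _≢_)
open import Relation.Nullary using (¬_)

record Graph : Set₁ where
  field
    order  : ℕ
    Adj    : Rel (Fin order) 0ℓ
    adj?   : Decidable Adj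
    sym    : Symmetric Adj
    irrefl : ∀ {x} → ¬ Adj x x

  Vertex : Set
  Vertex = Fin order

open Graph using (order; Adj; Vertex)

infix 4 _≅_ _⊑_ _↘_ _-Connected_ h[_]≥_

Complete : Graph → Set
Complete G = ∀ {x y} → x ≢ y → Adj G x y

_≅_ : Graph → Graph → Set
G ≅ H = Σ[ φ ∈ Vertex G ↔ Vertex H ]
  (∀ x y → Adj G x y ⇔ Adj H (Inverse.to φ x) (Inverse.to φ y))

-- H is, up to isomorphism, a (not necessarily induced) subgraph of G.
_⊑_ : Graph → Graph → Set
H ⊑ G = Σ[ f ∈ (Vertex H → Vertex G) ]
  Injective _≡_ _≡_ f × (∀ {x y} → Adj H x y → Adj G (f x) (f y))

-- H is, up to isomorphism, obtained from G by contracting the single edge uv: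
-- `merge` is the quotient map identifying u with v and nothing else, and the
-- loops and parallel edges that arise are discarded.
record _↘_ (G H : Graph) : Set where
  field
    {u v}      : Vertex G
    edge       : Adj G u v
    merge      : Vertex G → Vertex H
    surjective : StrictlySurjective _≡_ merge
    identifies : ∀ x y → merge x ≡ merge y ⇔
                   (x ≡ y ⊎ (x ≡ u × y ≡ v) ⊎ (x ≡ v × y ≡ u))
    adjacency  : ∀ a b → Adj H a b ⇔
                   (a ≢ b × (Σ[ x ∈ Vertex G ] Σ[ y ∈ Vertex G ]
                     (merge x ≡ a × merge y ≡ b × Adj G x y)))

Minor : Graph → Graph → Set₁
Minor H G = Σ[ S ∈ Graph ] (S ⊑ G × Star _↘_ S H)

-- Graphs are considered up to isomorphism here, so "other than G itself"
-- means "not isomorphic to G".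
ProperMinor : Graph → Graph → Set₁
ProperMinor H G = Minor H G × ¬ (H ≅ G)

Colorable : ℕ → Graph → Set
Colorable k G = Σ[ c ∈ (Vertex G → Fin k) ] (∀ {x y} → Adj G x y → c x ≢ c y)

Chromatic : ℕ → Graph → Set
Chromatic k G = Colorable k G × (∀ j → Colorable j G → k ≤ j)

ContractionCritical : ℕ → Graph → Set₁
ContractionCritical k G =
  Chromatic k G × (∀ H → ProperMinor H G → Colorable (k ∸ 1) H)

-- Stated for an adjacency relation on any vertex type, so that it applies to
-- vertex-deleted graphs.  A graph without vertices counts as connected; this
-- never matters below, where at least two vertices remain.
Connected : {V : Set} → Rel V 0ℓ → Set
Connected _~_ = ∀ x y → Star _~_ x y

-- The adjacency relation of G − S.
deleteAdj : (G : Graph) (S : Subset (order G)) → Rel (∃ (_∈ ∁ S)) 0ℓ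
deleteAdj G S = Adj G on proj₁

_-Connected_ : ℕ → Graph → Set
m -Connected G =
  m < order G × (∀ (S : Subset (order G)) → ∣ S ∣ < m → Connected (deleteAdj G S))

-- h(k) is the largest m such that every noncomplete k-contraction-critical
-- graph is m-connected; `h[ k ]≥ m` is the assertion h(k) ≥ m.
h[_]≥_ : ℕ → ℕ → Set₁
h[ k ]≥ m = ∀ G → ContractionCritical k G → ¬ Complete G → m -Connected G

{-# OPTIONS --safe #-}
module Submission where

open import Defs
open import Data.Empty using (⊥; ⊥-elim)
open import Data.Fin using (Fin; zero; suc; toℕ; fromℕ; fromℕ<; inject≤; punchIn; punchOut) renaming (_<_ to _<ᶠ_; _≤_ to _≤ᶠ_; _<?_ to _<ᶠ?_)
open import Data.Fin.Patterns using (0F; 1F; 2F; 3F; 4F; 5F)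
open import Data.Fin.Permutation using (↔⇒≡)
open import Data.Fin.Permutation.Components using (transpose; transpose-inverse)
open import Data.Fin.Properties using (_≟_; any?; <-cmp; toℕ<n; toℕ-fromℕ<; toℕ-inject≤; toℕ-injective; inject≤-injective; injective⇒≤; suc-injective; punchIn-injective; punchInᵢ≢i; punchIn-punchOut; punchOut-punchIn; punchOut-cong; punchOut-injective) renaming (_≤?_ to _≤ᶠ?_)
open import Data.Fin.Subset using (Subset; ∣_∣; ∁; _-_) renaming (_∈_ to _∈ˢ_; _∉_ to _∉ˢ_)
open import Data.Fin.Subset.Properties using (x∈p∧x≢y⇒x∈p-y; x∈p⇒∣p-x∣<∣p∣; x∉p⇒x∈∁p; x∈∁p⇒x∉p; p─q⊆p) renaming (_∈?_ to _∈ˢ?_)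
open import Data.Bool using (true; false)
open import Data.List using (List; []; _∷_; _++_; length; filter; lookup; map; allFin; cartesianProduct)
open import Data.List.Membership.Propositional using (_∈_; _∉_; find; lose)
open import Data.List.Membership.Propositional.Properties using (∈-allFin; ∈-filter⁺; ∈-filter⁻; ∈-cartesianProduct⁺; ∈-++⁺ˡ; ∈-++⁺ʳ; ∈-map⁺; ∈-map⁻)
open import Data.List.Properties using (length-++; length-map; length-tabulate; filter-notAll)
open import Data.List.Relation.Unary.Any as Any using (Any; here; there; index)
open import Data.List.Relation.Unary.Any.Properties using (lookup-index)
open import Data.Maybe as Maybe using (Maybe; just; nothing)
open import Data.Maybe.Properties using (just-injective) renaming (≡-dec to ≡-decᴹ)
open import Data.Nat using (ℕ; zero; suc; _+_; _≤_; _<_; _≥_; _<?_; z≤n; s≤s; s≤s⁻¹)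
open import Data.Nat.Induction using (<-wellFounded)
open import Data.Nat.Properties using (≤-refl; ≤-reflexive; ≤-trans; <⇒≤; <⇒≱; <-irrefl; <-asym; n≤1+n; m≤n⇒m≤1+n; m≤n⇒m<n∨m≡n; m≤m+n; +-mono-≤; +-monoʳ-≤; +-cancelˡ-≤)
open import Data.Product using (∃; ∃₂; _×_; _,_; proj₁; proj₂; Σ-syntax; ∃-syntax)
open import Data.Product.Properties using (≡-dec)
open import Data.Sum using (_⊎_; inj₁; inj₂; [_,_]′)
open import Data.Vec using ([]; _∷_)
open import Data.Vec.Base using (here; there)
open import Data.Vec.Properties.WithK using ([]=-irrelevant)
open import Function using (_∘_; id; case_of_)
open import Function.Bundles using (Equivalence; mk⇔)
open import Induction.WellFounded using (Acc; acc)
open import Level using (0ℓ)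
open import Relation.Binary.Construct.Closure.ReflexiveTransitive using (Star; ε; _◅_; _◅◅_; reverse; gmap)
open import Relation.Binary.Core using (Rel)
open import Relation.Binary.Definitions using (Decidable; DecidableEquality; Symmetric; tri<; tri≈; tri>)
open import Relation.Binary.PropositionalEquality using (_≡_; _≢_; refl; sym; trans; cong; cong₂; subst; subst₂)
open import Relation.Nullary using (¬_; Dec; yes; no; contradiction)
open import Relation.Nullary.Decidable using (_×-dec_; _⊎-dec_; ¬?; map′)
open import Relation.Unary as U using (Pred)

open Graph using (order; Vertex)

-- Let S be a minimal cut, with s = |S| ≤ 9, of a (q + 1)-contraction-critical graph, with
-- sides A and B.  A q-colouring of G[A ∪ S] and one of G[B ∪ S] never induce the same
-- partition of S, as they would combine to a q-colouring of G.  By criticality, contracting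
-- disjoint connected bags of one side that cover S yields a q-colouring of the other side
-- which is constant on S ∩ bag and distinguishes adjacent bags.
--
-- Let c be a q-colouring of one side, the colours being distributed among the parts of
-- its partition of S, and let c′ be a colouring of the other side obtained from bags.
-- Kempe changes within the groups of colours turn the partition of c into that of c′, unless
-- Kempe chains link the parts to be merged; adding these chains to the bags makes further
-- bags adjacent.  If every part has a colour of its own for every part not adjacent to it,
-- repeating this leads to a contradiction.  If one colour per part is shared for receiving,
-- the outcome is that c′ has a colour class meeting three parts.
--
-- Now take partitions of S as fine as possible.  By the first fact they have at least s − 1
-- parts, and they cannot both have s, so on one side a single pair a, b is identified.  The
-- second fact gives a finest colouring of the other side, identifying a and b, with at most
-- s − 3 parts.  Either its class of a and b is linked in its colours or a Kempe change
-- divides it, and the first fact applies again.  Counting the colours gives 16, 28 and 40;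
-- for s ≥ 7 some are saved on adjacent parts, which exist because two vertices of S never
-- meet all its edges.

-- Reachability, lists and transpositions

-- The partition of the other side is unknown when the bags are chosen, while the Kempe changes that
-- imitate it must avoid the colours already absorbed by bags. Hence colours are indexed by ordered
-- pairs of parts: a part that spends a colour on a chain gains an adjacent bag, and the colour
-- reserved for that neighbour replaces the one spent. For N parts this costs N (N - 1) colours,
-- affordable for N = s - 2 but not for N = s - 1, where s = 8 would ask for 42. There a part keeps
-- one colour for each smaller part and a common one for all larger parts. This costs s (s - 1) / 2
-- but only supports merging in twos, so a class meeting three parts has to be accepted. Such a
-- class together with the pair a, b leaves at most s - 3 parts. Dividing the class of a and b then
-- gives s - 2 parts at most, and the same colour count covers both outcomes.

module _ {n : ℕ} {R : Rel (Fin n) 0ℓ} (R? : Decidable R) where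

  private
    -- Floyd–Warshall: paths whose inner vertices lie in the given list.
    Via : List (Fin n) → Rel (Fin n) 0ℓ
    Via []       x y = x ≡ y ⊎ R x y
    Via (v ∷ vs) x y = Via vs x y ⊎ (Via vs x v × Via vs v y)

    via? : ∀ vs → Decidable (Via vs)
    via? []       x y = (x ≟ y) ⊎-dec R? x y
    via? (v ∷ vs) x y = via? vs x y ⊎-dec (via? vs x v ×-dec via? vs v y)

    via⇒star : ∀ vs {x y} → Via vs x y → Star R x y
    via⇒star []       (inj₁ refl)    = ε
    via⇒star []       (inj₂ r)       = r ◅ ε
    via⇒star (v ∷ vs) (inj₁ p)       = via⇒star vs p
    via⇒star (v ∷ vs) (inj₂ (p , q)) = via⇒star vs p ◅◅ via⇒star vs q

    lift : ∀ vs {x y} → Via [] x y → Via vs x y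
    lift []       p = p
    lift (v ∷ vs) p = inj₁ (lift vs p)

    from-head : ∀ {v} vs {y} → Via (v ∷ vs) v y → Via vs v y
    from-head vs (inj₁ p)       = p
    from-head vs (inj₂ (_ , p)) = p

    to-head : ∀ {v} vs {x} → Via (v ∷ vs) x v → Via vs x v
    to-head vs (inj₁ p)       = p
    to-head vs (inj₂ (p , _)) = p

    via-trans : ∀ {vs m x y} → m ∈ vs → Via vs x m → Via vs m y → Via vs x y
    via-trans {v ∷ vs} (here refl) p q = inj₂ (to-head vs p , from-head vs q)
    via-trans {v ∷ vs} (there m∈) (inj₁ p) (inj₁ q) = inj₁ (via-trans m∈ p q)
    via-trans {v ∷ vs} (there m∈) (inj₁ p) (inj₂ (q , r)) = inj₂ (via-trans m∈ p q , r)
    via-trans {v ∷ vs} (there m∈) (inj₂ (p , q)) (inj₁ r) = inj₂ (p , via-trans m∈ q r)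
    -- Both halves pass through `v`; the closed walk from `v` through `m` back to `v` is cut out.
    via-trans {v ∷ vs} (there m∈) (inj₂ (p , _)) (inj₂ (_ , r)) = inj₂ (p , r)

    star⇒via : ∀ {x y} → Star R x y → Via (allFin n) x y
    star⇒via ε       = lift (allFin n) (inj₁ refl)
    star⇒via (_◅_ {j = m} r rs) = via-trans (∈-allFin m) (lift (allFin n) (inj₂ r)) (star⇒via rs)

  opaque
    star? : Decidable (Star R)
    star? x y = map′ (via⇒star (allFin n)) star⇒via (via? (allFin n) x y)

-- Every edge has both ends in `P`, but the empty walk constrains nothing; this is why `star-end`
-- and `star-last` ask for `P` at the start.
Within : ∀ {n} → Rel (Fin n) 0ℓ → Pred (Fin n) 0ℓ → Rel (Fin n) 0ℓ
Within E P x y = P x × P y × E x y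

within? : ∀ {n} {E : Rel (Fin n) 0ℓ} {P : Pred (Fin n) 0ℓ} → Decidable E → U.Decidable P → Decidable (Within E P)
within? E? P? x y = P? x ×-dec P? y ×-dec E? x y

module _ {n : ℕ} {E : Rel (Fin n) 0ℓ} {P : Pred (Fin n) 0ℓ} where

  within-sym : Symmetric E → Symmetric (Within E P)
  within-sym E-sym (px , py , e) = py , px , E-sym e

  star-sym : Symmetric E → Symmetric (Star (Within E P))
  star-sym E-sym = reverse (within-sym E-sym)

  star-end : ∀ {x y} → Star (Within E P) x y → P x → P y
  star-end ε                   px = px
  star-end ((_ , py , _) ◅ rs) _  = star-end rs py

  star-mono : ∀ {Q : Pred (Fin n) 0ℓ} → (∀ {x} → P x → Q x) → ∀ {x y} → Star (Within E P) x y → Star (Within E Q) x y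
  star-mono f = gmap (λ x → x) (λ (px , py , e) → f px , f py , e)

  star-last : ∀ {x y z} → Star (Within E P) x y → P x → P z → E y z → Star (Within E P) x z
  star-last rs px pz e = rs ◅◅ ((star-end rs px , pz , e) ◅ ε)

  -- With `Q` a component or its complement, a walk becomes one that stays inside it, so that a
  -- recolouring described only there can be followed along the walk.
  star-upgrade : ∀ {Q : Pred (Fin n) 0ℓ} → (∀ {x y} → Q x → Within E P x y → Q y) →
                 ∀ {x y} → Q x → Star (Within E P) x y → Star (Within E (λ z → P z × Q z)) x y
  star-upgrade closed qx ε = ε
  star-upgrade closed qx (r@(px , py , e) ◅ rs) =
    ((px , qx) , (py , closed qx r) , e) ◅ star-upgrade closed (closed qx r) rs

remove : ∀ {A : Set} → DecidableEquality A → A → List A → List A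
remove _≟ᴬ_ x = filter (λ y → ¬? (y ≟ᴬ x))

module _ {A : Set} (_≟ᴬ_ : DecidableEquality A) where

  ∈-remove : ∀ {x y xs} → y ∈ xs → y ≢ x → y ∈ remove _≟ᴬ_ x xs
  ∈-remove = ∈-filter⁺ (λ y → ¬? (y ≟ᴬ _))

  length-remove : ∀ {x} xs → x ∈ xs → length (remove _≟ᴬ_ x xs) < length xs
  length-remove {x} xs x∈ = filter-notAll (λ y → ¬? (y ≟ᴬ x)) xs (Any.map (λ eq ne → ne (sym eq)) x∈)

module _ {A : Set} {P Q : Pred A 0ℓ} (P? : U.Decidable P) (Q? : U.Decidable Q) (P⊆Q : ∀ {x} → P x → Q x) where

  length-filter-≤ : ∀ xs → length (filter P? xs) ≤ length (filter Q? xs)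
  length-filter-≤ [] = z≤n
  length-filter-≤ (x ∷ xs) with P? x | Q? x
  ... | yes p | yes q = s≤s (length-filter-≤ xs)
  ... | yes p | no ¬q = contradiction (P⊆Q p) ¬q
  ... | no ¬p | yes q = m≤n⇒m≤1+n (length-filter-≤ xs)
  ... | no ¬p | no ¬q = length-filter-≤ xs

  length-filter-< : ∀ {x xs} → x ∈ xs → ¬ P x → Q x → length (filter P? xs) < length (filter Q? xs)
  length-filter-< {x} {_ ∷ xs} (here refl) ¬p q with P? x | Q? x
  ... | yes p | _     = contradiction p ¬p
  ... | no _  | no ¬q = contradiction q ¬q
  ... | no _  | yes _ = s≤s (length-filter-≤ xs)
  length-filter-< {xs = y ∷ xs} (there x∈) ¬p q with P? y | Q? y
  ... | yes p | yes _ = s≤s (length-filter-< x∈ ¬p q)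
  ... | yes p | no ¬q = contradiction (P⊆Q p) ¬q
  ... | no _  | yes _ = m≤n⇒m≤1+n (length-filter-< x∈ ¬p q)
  ... | no _  | no _  = length-filter-< x∈ ¬p q

module _ {n : ℕ} where

  infix 4 _∈?_

  _∈?_ : (x : Fin n) (xs : List (Fin n)) → Dec (x ∈ xs)
  x ∈? xs = Any.any? (x ≟_) xs

  opaque

    -- Pigeonhole: if every element occurred in `xs`, its position would be an injection into
    -- `Fin (length xs)`.
    avoid : ∀ (xs : List (Fin n)) → length xs < n → ∃[ v ] v ∉ xs
    avoid xs len with any? (λ v → ¬? (v ∈? xs))
    ... | yes p = p
    ... | no ¬p = contradiction (injective⇒≤ {f = λ v → index (mem v)} inj) (<⇒≱ len)
      where
      mem : ∀ v → v ∈ xs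
      mem v with v ∈? xs
      ... | yes v∈ = v∈
      ... | no v∉  = ⊥-elim (¬p (v , v∉))
      inj : ∀ {v w} → index (mem v) ≡ index (mem w) → v ≡ w
      inj {v} {w} eq = trans (lookup-index (mem v)) (trans (cong (lookup xs) eq) (sym (lookup-index (mem w))))

-- List entries serve as colours through their positions, so counting colours means measuring a
-- list. Colours beyond the list stay unassigned.
module Coding {A : Set} (xs : List A) {q : ℕ} (xs≤q : length xs ≤ q) where

  code : ∀ {P : Pred A 0ℓ} → Any P xs → Fin q
  code p = inject≤ (index p) xs≤q

  decode : Fin q → Maybe A
  decode α with toℕ α <? length xs
  ... | yes lt = just (lookup xs (fromℕ< lt))
  ... | no _   = nothing

  decode-code : ∀ {P : Pred A 0ℓ} (p : Any P xs) → decode (code p) ≡ just (Any.lookup p)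
  decode-code p with toℕ (code p) <? length xs
  ... | yes lt = cong (just ∘ lookup xs) (toℕ-injective (trans (toℕ-fromℕ< lt) (toℕ-inject≤ (index p) xs≤q)))
  ... | no nlt = contradiction (subst (_< length xs) (sym (toℕ-inject≤ (index p) xs≤q)) (toℕ<n (index p))) nlt

  decode-∈ : ∀ {x} (p : x ∈ xs) → decode (code p) ≡ just x
  decode-∈ p = trans (decode-code p) (cong just (sym (lookup-index p)))

module _ {n : ℕ} (i j : Fin n) where

  transpose-injective : ∀ {x y} → transpose i j x ≡ transpose i j y → x ≡ y
  transpose-injective {x} {y} eq =
    trans (sym (transpose-inverse j i)) (trans (cong (transpose j i) eq) (transpose-inverse j i))

  transpose-fst : transpose i j i ≡ j
  transpose-fst with i ≟ i
  ... | yes _ = refl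
  ... | no ne = contradiction refl ne

  transpose-snd : transpose i j j ≡ i
  transpose-snd with j ≟ i
  ... | yes eq = eq
  ... | no _ with j ≟ j
  ...   | yes _ = refl
  ...   | no ne = contradiction refl ne

  transpose-else : ∀ {x} → x ≢ i → x ≢ j → transpose i j x ≡ x
  transpose-else {x} ≢i ≢j with x ≟ i
  ... | yes eq = contradiction eq ≢i
  ... | no _ with x ≟ j
  ...   | yes eq = contradiction eq ≢j
  ...   | no _   = refl

  transpose-closed : ∀ {P : Pred (Fin n) 0ℓ} → P i → P j → ∀ {x} → P x → P (transpose i j x)
  transpose-closed Pi Pj {x} Px with x ≟ i
  ... | yes _ = Pj
  ... | no _ with x ≟ j
  ...   | yes _ = Pi
  ...   | no _  = Px

-- Built from transpositions: the new one moves `π (h i)` to `t i`, and it disturbs a value placed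
-- before only if that value belongs to the class of `i`. Colourings with the same partition can
-- thus be made equal on it by renaming colours.
align : ∀ {I : Set} {k : ℕ} (h t : I → Fin k) (is : List I) →
        (∀ {i j} → i ∈ is → j ∈ is → h i ≡ h j → t i ≡ t j) →
        (∀ {i j} → i ∈ is → j ∈ is → t i ≡ t j → h i ≡ h j) →
        Σ[ π ∈ (Fin k → Fin k) ] (∀ {x y} → π x ≡ π y → x ≡ y) × (∀ {i} → i ∈ is → π (h i) ≡ t i)
align h t [] _ _ = (λ x → x) , (λ eq → eq) , (λ ())
align h t (i ∷ is) h⇒t t⇒h
  with π , π-inj , π-ok ← align h t is (λ a b → h⇒t (there a) (there b)) (λ a b → t⇒h (there a) (there b))
  = τ ∘ π , (λ eq → π-inj (transpose-injective _ _ eq)) , ok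
  where
  τ = transpose (π (h i)) (t i)
  ok : ∀ {j} → j ∈ i ∷ is → τ (π (h j)) ≡ t j
  ok (here refl) = transpose-fst (π (h i)) (t i)
  ok {j} (there j∈) with h j ≟ h i
  ... | yes eq = trans (cong (τ ∘ π) eq) (trans (transpose-fst (π (h i)) (t i)) (sym (h⇒t (there j∈) (here refl) eq)))
  ... | no ne  = trans (transpose-else _ _ (λ eq → ne (π-inj eq))
                         (λ eq → ne (t⇒h (there j∈) (here refl) (trans (sym (π-ok j∈)) eq))))
                       (π-ok j∈)

-- Recolouring along Kempe components

Proper : ∀ {n q} → Rel (Fin n) 0ℓ → (Fin n → Fin q) → Set
Proper E c = ∀ {x y} → E x y → c x ≢ c y

SameKernel : ∀ {I A B : Set} → (I → A) → (I → B) → Set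
SameKernel f g = ∀ i j → (f i ≡ f j → g i ≡ g j) × (g i ≡ g j → f i ≡ f j)

-- `own` distributes the colours among the parts, `nothing` marking a spare one. By `conn` a part
-- lies in a single Kempe component of its group, so the whole part changes colour at once.
module Palette
  {n s q N : ℕ} {E : Rel (Fin n) 0ℓ} (E? : Decidable E) (E-sym : Symmetric E)
  (σ : Fin s → Fin n) (lab : Fin s → Fin N) (own : Fin q → Maybe (Fin N))
  {c : Fin n → Fin q} (c-proper : Proper E c)
  (γ : Fin N → Fin q) (own-γ : ∀ u → own (γ u) ≡ just u) (c-σ : ∀ i → c (σ i) ≡ γ (lab i))
  (conn : ∀ i j → lab i ≡ lab j → Star (Within E (λ x → own (c x) ≡ just (lab i))) (σ i) (σ j))
  where

  Grp : Fin N → Fin n → Set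
  Grp u x = own (c x) ≡ just u

  Grp? : ∀ u → U.Decidable (Grp u)
  Grp? u x = ≡-decᴹ _≟_ (own (c x)) (just u)

  Grp-σ : ∀ i → Grp (lab i) (σ i)
  Grp-σ i = trans (cong own (c-σ i)) (own-γ (lab i))

  Grp-unique : ∀ {u w x} → Grp u x → Grp w x → u ≡ w
  Grp-unique p p′ = just-injective (trans (sym p) p′)

  K : Fin N → Fin n → Set
  K u x = Σ[ i ∈ Fin s ] lab i ≡ u × Star (Within E (Grp u)) (σ i) x

  K? : ∀ u → U.Decidable (K u)
  K? u x = any? λ i → (lab i ≟ u) ×-dec star? (within? E? (Grp? u)) (σ i) x

  K-grp : ∀ {u x} → K u x → Grp u x
  K-grp (i , refl , p) = star-end p (Grp-σ i)

  K-step : ∀ {u x z} → K u x → E x z → Grp u z → K u z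
  K-step k@(i , eq , p) e gz = i , eq , p ◅◅ ((K-grp k , gz , e) ◅ ε)

  K-unique : ∀ {u w x} → K u x → K w x → u ≡ w
  K-unique k k′ = Grp-unique (K-grp k) (K-grp k′)

  K-σ : ∀ i → K (lab i) (σ i)
  K-σ i = i , refl , ε

  K-path : ∀ {u x} i → lab i ≡ u → K u x → Star (Within E (K u)) (σ i) x
  K-path {u} {x} i refl (j , eq , p) = star-mono (λ (_ , k) → k)
    (star-upgrade (λ k (_ , gz , e) → K-step k e gz) (K-σ i) (conn i j (sym eq) ◅◅ p))

  Recolourable : (Fin N → Fin q) → Set
  Recolourable y = ∀ u → own (y u) ≡ just u

  InK : Fin n → Set
  InK x = ∃[ u ] K u x

  inK? : U.Decidable InK
  inK? x = any? λ u → K? u x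

  module Recolour (y : Fin N → Fin q) (own-y : Recolourable y) where

    opaque

      ỹ : Fin n → Fin q
      ỹ x with inK? x
      ... | yes (u , _) = transpose (γ u) (y u) (c x)
      ... | no _        = c x

      ỹ-in : ∀ {u x} → K u x → ỹ x ≡ transpose (γ u) (y u) (c x)
      ỹ-in {u} {x} k with inK? x
      ... | yes (w , k′) rewrite K-unique k′ k = refl
      ... | no ∉K        = contradiction (u , k) ∉K

      ỹ-out : ∀ {x} → ¬ InK x → ỹ x ≡ c x
      ỹ-out {x} ∉K with inK? x
      ... | yes ∈K = contradiction ∈K ∉K
      ... | no _   = refl

      -- `K u` is closed under steps in the colours of group `u`, and the exchange stays within
      -- these colours. So no conflict arises at its border or between different groups.
      ỹ-proper : Proper E ỹ
      ỹ-proper {x} {z} e with inK? x | inK? z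
      ... | no ∉x | no ∉z = c-proper e
      ... | yes (u , k) | no ∉z = λ eq → ∉z (u , K-step k e
              (subst (λ α → own α ≡ just u) eq
                (transpose-closed (γ u) (y u) {λ α → own α ≡ just u} (own-γ u) (own-y u) (K-grp k))))
      ... | no ∉x | yes (u , k) = λ eq → ∉x (u , K-step k (E-sym e)
              (subst (λ α → own α ≡ just u) (sym eq)
                (transpose-closed (γ u) (y u) {λ α → own α ≡ just u} (own-γ u) (own-y u) (K-grp k))))
      ... | yes (u , k) | yes (w , k′) with u ≟ w
      ...   | yes refl = λ eq → c-proper e (transpose-injective (γ u) (y u) eq)
      ...   | no u≢w = λ eq → u≢w (just-injective (trans (sym (closed u k)) (trans (cong own eq) (closed w k′))))
        where
        closed : ∀ u {x} → K u x → own (transpose (γ u) (y u) (c x)) ≡ just u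
        closed u k = transpose-closed (γ u) (y u) {λ α → own α ≡ just u} (own-γ u) (own-y u) (K-grp k)

    ỹ-grp : ∀ {u x} → K u x → own (ỹ x) ≡ just u
    ỹ-grp {u} {x} k = subst (λ α → own α ≡ just u) (sym (ỹ-in k))
      (transpose-closed (γ u) (y u) {λ α → own α ≡ just u} (own-γ u) (own-y u) (K-grp k))

    ỹ-σ : ∀ i → ỹ (σ i) ≡ y (lab i)
    ỹ-σ i = trans (ỹ-in (K-σ i)) (trans (cong (transpose (γ (lab i)) (y (lab i))) (c-σ i)) (transpose-fst (γ (lab i)) (y (lab i))))

    y-injective : ∀ {u w} → y u ≡ y w → u ≡ w
    y-injective {u} {w} eq = just-injective (trans (sym (own-y u)) (trans (cong own eq) (own-y w)))

    InY : List (Fin N) → Fin q → Set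
    InY D α = Any (λ u → α ≡ y u) D

    InY? : ∀ D → U.Decidable (InY D)
    InY? D α = Any.any? (λ u → α ≟ y u) D

    inY : ∀ {D u} → u ∈ D → InY D (y u)
    inY u∈ = Any.map (cong y) u∈

    -- `g` is constrained only where `ỹ` uses the colours of `D`, and it stays within them there;
    -- merges of disjoint sets of parts can therefore be carried out together.
    record Mergeable (D : List (Fin N)) : Set where
      field
        g        : Fin n → Fin q
        β        : Fin q
        g-closed : ∀ {x} → InY D (ỹ x) → InY D (g x)
        g-proper : ∀ {x z} → E x z → InY D (ỹ x) → InY D (ỹ z) → g x ≢ g z
        g-mono   : ∀ {i} → lab i ∈ D → g (σ i) ≡ β

    Linked : List (Fin N) → Fin N → Fin N → Set
    Linked D u w = Σ[ i ∈ Fin s ] Σ[ j ∈ Fin s ] lab i ≡ u × lab j ≡ w × Star (Within E (InY D ∘ ỹ)) (σ i) (σ j)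

    linked? : ∀ D u w → Dec (Linked D u w)
    linked? D u w = any? λ i → any? λ j → (lab i ≟ u) ×-dec (lab j ≟ w) ×-dec star? (within? E? (InY? D ∘ ỹ)) (σ i) (σ j)

    HasLink : List (Fin N) → Fin N → Set
    HasLink D u = Σ[ w ∈ Fin N ] w ∈ D × w ≢ u × Linked D u w

    hasLink? : ∀ D u → Dec (HasLink D u)
    hasLink? D u = any? λ w → (w ∈? D) ×-dec ¬? (w ≟ u) ×-dec linked? D u w

    Blocked : List (Fin N) → Set
    Blocked D = ∃ (_∈ D) × (∀ {u} → u ∈ D → HasLink D u)

    -- The components `C` of part `u` contain no other part of `D`, so exchanging `y u` with the
    -- common colour of the rest on `C` brings `u` into the merge. Off `C` the old merge never
    -- produces `y u`, which may stay where it is.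
    module Extend {D : List (Fin N)} {u : Fin N} (u∈ : u ∈ D) (alone : ¬ HasLink D u)
      (M₀ : Mergeable (remove _≟_ u D)) where

      open Mergeable M₀ renaming (g to g₀; β to β₀; g-closed to g₀-closed; g-proper to g₀-proper; g-mono to g₀-mono)

      D₀ = remove _≟_ u D

      D₀⊆D : ∀ {w} → w ∈ D₀ → w ∈ D
      D₀⊆D w∈ = proj₁ (∈-filter⁻ _ {xs = D} w∈)

      up : ∀ {α} → InY D₀ α → InY D α
      up p with w , w∈ , refl ← find p = inY (D₀⊆D w∈)

      down : ∀ {α} → InY D α → α ≢ y u → InY D₀ α
      down p ne with w , w∈ , refl ← find p = inY (∈-remove _≟_ w∈ (λ eq → ne (cong y eq)))

      yu∉ : ¬ InY D₀ (y u)
      yu∉ p with w , w∈ , eq ← find p = proj₂ (∈-filter⁻ (λ y → ¬? (y ≟ u)) {xs = D} w∈) (sym (y-injective eq))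

      C : Fin n → Set
      C x = Σ[ i ∈ Fin s ] lab i ≡ u × Star (Within E (InY D ∘ ỹ)) (σ i) x

      C? : U.Decidable C
      C? x = any? λ i → (lab i ≟ u) ×-dec star? (within? E? (InY? D ∘ ỹ)) (σ i) x

      C-inY : ∀ {x} → C x → InY D (ỹ x)
      C-inY (i , refl , p) = star-end p (subst (InY D) (sym (ỹ-σ i)) (inY u∈))

      C-step : ∀ {x z} → C x → E x z → InY D (ỹ z) → C z
      C-step k@(i , eq , p) e z∈ = i , eq , p ◅◅ ((C-inY k , z∈ , e) ◅ ε)

      target : Σ[ β ∈ Fin q ] InY D β × (∀ {i} → lab i ∈ D₀ → g₀ (σ i) ≡ β)
      target with any? (λ i → lab i ∈? D₀)
      ... | yes (i , i∈) = β₀ , subst (InY D) (g₀-mono i∈) (up (g₀-closed (subst (InY D₀) (sym (ỹ-σ i)) (inY i∈)))) , g₀-mono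
      -- No separator vertex lies in the other parts, so the common colour is arbitrary; with `y u`
      -- the exchange on `C` is the identity.
      ... | no none      = y u , inY u∈ , λ {i} i∈ → ⊥-elim (none (i , i∈))

      β = proj₁ target

      g : Fin n → Fin q
      g x with C? x
      ... | yes _ = transpose (y u) β (ỹ x)
      ... | no _ with ỹ x ≟ y u
      ...   | yes _ = y u
      ...   | no _  = g₀ x

      g-closed : ∀ {x} → InY D (ỹ x) → InY D (g x)
      g-closed {x} p with C? x
      ... | yes _ = transpose-closed (y u) β {InY D} (inY u∈) (proj₁ (proj₂ target)) p
      ... | no _ with ỹ x ≟ y u
      ...   | yes _ = inY u∈
      ...   | no ne = up (g₀-closed (down p ne))

      g-proper : ∀ {x z} → E x z → InY D (ỹ x) → InY D (ỹ z) → g x ≢ g z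
      g-proper {x} {z} e px pz with C? x | C? z
      ... | yes _  | yes _  = λ eq → ỹ-proper e (transpose-injective (y u) β eq)
      ... | yes cx | no ¬cz = contradiction (C-step cx e pz) ¬cz
      ... | no ¬cx | yes cz = contradiction (C-step cz (E-sym e) px) ¬cx
      ... | no _   | no _ with ỹ x ≟ y u | ỹ z ≟ y u
      ...   | yes ex | yes ez = λ _ → ỹ-proper e (trans ex (sym ez))
      ...   | yes _  | no ne  = λ eq → yu∉ (subst (InY D₀) (sym eq) (g₀-closed (down pz ne)))
      ...   | no ne  | yes _  = λ eq → yu∉ (subst (InY D₀) eq (g₀-closed (down px ne)))
      ...   | no nx  | no nz  = g₀-proper e (down px nx) (down pz nz)

      g-mono : ∀ {i} → lab i ∈ D → g (σ i) ≡ β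
      g-mono {i} i∈ with C? (σ i)
      ... | yes (j , eq , p) with lab i ≟ u
      ...   | yes refl = trans (cong (transpose (y u) β) (ỹ-σ i)) (transpose-fst (y u) β)
      ...   | no ne    = contradiction (lab i , i∈ , ne , j , i , eq , refl , p) alone
      g-mono {i} i∈ | no ¬c with ỹ (σ i) ≟ y u
      ...   | yes eq = contradiction (i , y-injective (trans (sym (ỹ-σ i)) eq) , ε) ¬c
      ...   | no ne  = proj₂ (proj₂ target) (∈-remove _≟_ i∈ (λ eq → ne (trans (ỹ-σ i) (cong y eq))))

      merged : Mergeable D
      merged = record { g = g ; β = β ; g-closed = g-closed ; g-proper = g-proper ; g-mono = g-mono }

    -- Parts without a link are set aside one by one and merged back in reverse order by `Extend`;
    -- if none can be set aside, what remains is blocked. Links are tested anew each time, since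
    -- their chains may use only the remaining colours.
    mergeable-or-blocked : Fin q → ∀ D → Mergeable D ⊎ (Σ[ D′ ∈ List (Fin N) ] (∀ {u} → u ∈ D′ → u ∈ D) × Blocked D′)
    mergeable-or-blocked β₀ D = go D (<-wellFounded (length D))
      where
      go : ∀ D → Acc _<_ (length D) → Mergeable D ⊎ (Σ[ D′ ∈ List (Fin N) ] (∀ {u} → u ∈ D′ → u ∈ D) × Blocked D′)
      go [] _ = inj₁ (record { g = ỹ ; β = β₀ ; g-closed = λ p → p ; g-proper = λ e _ _ → ỹ-proper e ; g-mono = λ () })
      go D@(d ∷ _) (acc rec) with Any.any? (λ u → ¬? (hasLink? D u)) D
      ... | no all = inj₂ (D , (λ u∈ → u∈) , (d , here refl) , linked)
        where
        linked : ∀ {u} → u ∈ D → HasLink D u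
        linked {u} u∈ with hasLink? D u
        ... | yes l = l
        ... | no ¬l = contradiction (lose u∈ ¬l) all
      ... | yes some with u , u∈ , alone ← find some
        with go (remove _≟_ u D) (rec (length-remove _≟_ D u∈))
      ...   | inj₁ m = inj₁ (Extend.merged u∈ alone m)
      ...   | inj₂ (D′ , D′⊆ , b) = inj₂ (D′ , (λ w∈ → proj₁ (∈-filter⁻ (λ y → ¬? (y ≟ u)) {xs = D} (D′⊆ w∈))) , b)

    module Combine (h : Fin s → Fin q) (h-lab : ∀ {i j} → lab i ≡ lab j → h i ≡ h j) where

      cls : Fin q → List (Fin N)
      cls α = filter (λ u → any? λ i → (lab i ≟ u) ×-dec (h i ≟ α)) (allFin N)

      cls-lab : ∀ {α i} → lab i ∈ cls α → h i ≡ α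
      cls-lab {α} p with j , eq , refl ← proj₂ (∈-filter⁻ (λ u → any? λ i → (lab i ≟ u) ×-dec (h i ≟ α)) {xs = allFin N} p) = h-lab (sym eq)

      ∈-cls : ∀ i → lab i ∈ cls (h i)
      ∈-cls i = ∈-filter⁺ _ (∈-allFin (lab i)) (i , refl , refl)

      cls-part : ∀ {α u} → u ∈ cls α → Σ[ i ∈ Fin s ] lab i ≡ u × h i ≡ α
      cls-part {α} p = proj₂ (∈-filter⁻ (λ u → any? λ i → (lab i ≟ u) ×-dec (h i ≟ α)) {xs = allFin N} p)

      module _ (merge : ∀ α → Mergeable (cls α)) where

        private
          open module M α = Mergeable (merge α)

        part? : ∀ x → Dec (Σ[ i ∈ Fin s ] ỹ x ≡ y (lab i))
        part? x = any? λ i → ỹ x ≟ y (lab i)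

        col : Fin n → Fin q
        col x with part? x
        ... | yes (i , _) = g (h i) x
        ... | no _        = ỹ x

        inY-cls : ∀ {x} i → ỹ x ≡ y (lab i) → InY (cls (h i)) (ỹ x)
        inY-cls i eq = subst (InY (cls (h i))) (sym eq) (inY (∈-cls i))

        InY-disjoint : ∀ {α β ξ} → InY (cls α) ξ → InY (cls β) ξ → α ≡ β
        InY-disjoint p p′ with u , u∈ , refl ← find p | w , w∈ , eq ← find p′
          with refl ← y-injective eq
          with i , refl , refl ← cls-part u∈ = cls-lab w∈

        col-proper : Proper E col
        col-proper {x} {z} e with part? x | part? z
        ... | no _ | no _ = ỹ-proper e
        ... | yes (i , p) | no ¬z = λ eq → outside (subst (InY _) eq (g-closed (h i) (inY-cls i p)))
          where
          outside : ¬ InY (cls (h i)) (ỹ z)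
          outside r with u , u∈ , eq ← find r with j , refl , _ ← cls-part u∈ = ¬z (j , eq)
        ... | no ¬x | yes (j , p) = λ eq → outside (subst (InY _) (sym eq) (g-closed (h j) (inY-cls j p)))
          where
          outside : ¬ InY (cls (h j)) (ỹ x)
          outside r with u , u∈ , eq ← find r with i , refl , _ ← cls-part u∈ = ¬x (i , eq)
        ... | yes (i , p) | yes (j , p′) with h i ≟ h j
        ...   | yes eq rewrite eq = g-proper (h j) e (subst (λ α → InY (cls α) (ỹ x)) eq (inY-cls i p)) (inY-cls j p′)
        ...   | no ne = λ eq → ne (InY-disjoint (g-closed (h i) (inY-cls i p))
                                   (subst (InY _) (sym eq) (g-closed (h j) (inY-cls j p′))))

        col-σ : ∀ i → col (σ i) ≡ β (h i)
        col-σ i with part? (σ i)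
        ... | no ¬p = contradiction (i , ỹ-σ i) ¬p
        ... | yes (j , p) = trans (g-mono (h j) (subst (_∈ cls (h j)) (sym lab≡) (∈-cls j))) (cong β (sym (h-lab lab≡)))
          where
          lab≡ : lab i ≡ lab j
          lab≡ = y-injective (trans (sym (ỹ-σ i)) p)

        β-inY : ∀ i → InY (cls (h i)) (β (h i))
        β-inY i = subst (InY _) (g-mono (h i) (∈-cls i)) (g-closed (h i) (inY-cls i (ỹ-σ i)))

        -- The common colour of a class is taken from the colours of its own parts, hence different
        -- classes end with different colours.
        col-kernel : SameKernel (col ∘ σ) h
        col-kernel i j =
          (λ eq → InY-disjoint (β-inY i) (subst (InY _) (trans (sym (col-σ j)) (trans (sym eq) (col-σ i))) (β-inY j))) ,
          (λ eq → trans (col-σ i) (trans (cong β eq) (sym (col-σ j))))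

-- Bags found from blocked merges

-- The effect of contracting disjoint connected bags on one side of the separator:
-- f x ≡ just u means that x lies in bag u, and lab i names the bag of σ i.
Transfer : ∀ {n s} (q : ℕ) → (E E′ : Rel (Fin n) 0ℓ) → (Fin s → Fin n) → Set
Transfer {n} {s} q E E′ σ =
  ∀ {N} (lab : Fin s → Fin N) (f : Fin n → Maybe (Fin N)) →
  (∀ i → f (σ i) ≡ just (lab i)) →
  (∀ {x u} → f x ≡ just u → Σ[ i ∈ Fin s ] lab i ≡ u × Star (Within E (λ z → f z ≡ just u)) (σ i) x) →
  (∀ i j → lab i ≡ lab j → Star (Within E (λ z → f z ≡ just (lab i))) (σ i) (σ j)) →
  (∀ i j → lab i ≡ lab j → ¬ E (σ i) (σ j)) →
  Σ[ c ∈ (Fin n → Fin q) ] Proper E′ c ×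
    (∀ {i j} → lab i ≡ lab j → c (σ i) ≡ c (σ j)) ×
    (∀ {x z i j} → E x z → f x ≡ just (lab i) → f z ≡ just (lab j) → lab i ≢ lab j → c (σ i) ≢ c (σ j))

Separated : ∀ {n s} (q : ℕ) → (E E′ : Rel (Fin n) 0ℓ) → (Fin s → Fin n) → Set
Separated {n} q E E′ σ = ∀ (c c′ : Fin n → Fin q) → Proper E c → Proper E′ c′ → ¬ SameKernel (c ∘ σ) (c′ ∘ σ)

Hit : ∀ {s N} → (Fin s → Fin N) → Fin N → Set
Hit {s} lab u = Σ[ i ∈ Fin s ] lab i ≡ u

AdjParts : ∀ {n s N} → Rel (Fin n) 0ℓ → (Fin s → Fin n) → (Fin s → Fin N) → Rel (Fin N) 0ℓ
AdjParts {s = s} E σ lab u v = Σ[ i ∈ Fin s ] Σ[ j ∈ Fin s ] lab i ≡ u × lab j ≡ v × E (σ i) (σ j)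

-- Only these pairs can be merged by a colouring obtained from bags: an edge between two parts makes
-- their bags adjacent from the outset.
Needed : ∀ {n s N} → Rel (Fin n) 0ℓ → (Fin s → Fin n) → (Fin s → Fin N) → Rel (Fin N) 0ℓ
Needed E σ lab u v = u ≢ v × Hit lab u × Hit lab v × ¬ AdjParts E σ lab u v

hit? : ∀ {s N} (lab : Fin s → Fin N) → U.Decidable (Hit lab)
hit? lab u = any? λ i → lab i ≟ u

module Full
  {n s q N : ℕ} {E E′ : Rel (Fin n) 0ℓ} (E? : Decidable E) (E-sym : Symmetric E)
  (σ : Fin s → Fin n) (transfer : Transfer q E E′ σ) (separated : Separated q E E′ σ)
  (lab : Fin s → Fin N) (own : Fin q → Maybe (Fin N))
  {c : Fin n → Fin q} (c-proper : Proper E c)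
  (γ : Fin N → Fin q) (own-γ : ∀ u → own (γ u) ≡ just u) (c-σ : ∀ i → c (σ i) ≡ γ (lab i))
  (conn : ∀ i j → lab i ≡ lab j → Star (Within E (λ x → own (c x) ≡ just (lab i))) (σ i) (σ j))
  where

  open Palette E? E-sym σ lab own c-proper γ own-γ c-σ conn

  Adj : (Fin n → Maybe (Fin N)) → Rel (Fin N) 0ℓ
  Adj f u v = ∃[ x ] ∃[ z ] E x z × f x ≡ just u × f z ≡ just v

  Free : (Fin n → Maybe (Fin N)) → Rel (Fin N) 0ℓ
  Free f u v = u ≢ v × Hit lab u × Hit lab v × ¬ Adj f u v

  free? : ∀ f → Decidable (Free f)
  free? f u v = ¬? (u ≟ v) ×-dec hit? lab u ×-dec hit? lab v ×-dec
    ¬? (any? λ x → any? λ z → E? x z ×-dec ≡-decᴹ _≟_ (f x) (just u) ×-dec ≡-decᴹ _≟_ (f z) (just v))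

  -- col u v is reserved for merging part u with part v while their bags are not adjacent.
  record State : Set where
    field
      f       : Fin n → Maybe (Fin N)
      f-K     : ∀ {u x} → K u x → f x ≡ just u
      f-conn  : ∀ {x u} → f x ≡ just u → Σ[ i ∈ Fin s ] lab i ≡ u × Star (Within E (λ z → f z ≡ just u)) (σ i) x
      col     : Fin N → Fin N → Fin q
      col-own : ∀ {u v} → Free f u v → own (col u v) ≡ just u
      col-inj : ∀ {u v v′} → Free f u v → Free f u v′ → col u v ≡ col u v′ → v ≡ v′
      -- Colours absorbed by a bag outside the components `K` are spent: no pair that is still free
      -- relies on them there.
      col-new : ∀ {x b u v} → f x ≡ just b → ¬ InK x → Free f u v → c x ≢ col u v

  measure : (Fin n → Maybe (Fin N)) → ℕ
  measure f = length (filter (λ (u , v) → free? f u v) (cartesianProduct (allFin N) (allFin N)))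

  module Step (st : State) where

    open State st

    opaque

      y : Fin N → Fin q
      y u with any? (free? f u)
      ... | yes (v , _) = col u v
      ... | no _        = γ u

      own-y : ∀ u → own (y u) ≡ just u
      own-y u with any? (free? f u)
      ... | yes (v , fr) = col-own fr
      ... | no _         = own-γ u

      y-free : ∀ {u w} → Free f u w → Σ[ v ∈ Fin N ] Free f u v × y u ≡ col u v
      y-free {u} {w} fr with any? (free? f u)
      ... | yes (v , fr′) = v , fr′ , refl
      ... | no none       = contradiction (w , fr) none

    open Recolour y own-y public

    module Progress (D : List (Fin N)) (blocked : Blocked D)
      (indep : ∀ {u w} → u ∈ D → w ∈ D → u ≢ w → Free f u w) where

      -- The portion of the blocking chains outside the components `K`. By `col-new` no bag contains
      -- any of it yet, so its components can be handed to bags as a whole.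
      Rg : Fin n → Set
      Rg x = ¬ InK x × InY D (ỹ x)

      rg? : U.Decidable Rg
      rg? x = ¬? (inK? x) ×-dec InY? D (ỹ x)

      Rg-colour : ∀ {x} → Rg x → Σ[ u ∈ Fin N ] u ∈ D × c x ≡ y u
      Rg-colour (∉K , p) with u , u∈ , eq ← find p = u , u∈ , trans (sym (ỹ-out ∉K)) eq

      y-some : ∀ {u} → u ∈ D → Σ[ v ∈ Fin N ] Free f u v × y u ≡ col u v
      y-some u∈ with w , w∈ , ne , _ ← proj₂ blocked u∈ = y-free (indep u∈ w∈ (ne ∘ sym))

      Rg-nothing : ∀ {x} → Rg x → f x ≡ nothing
      Rg-nothing {x} rg with f x in eq
      ... | nothing = refl
      ... | just b with u , u∈ , cx ← Rg-colour rg with v , fr , yu ← y-some u∈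
        = contradiction (trans cx yu) (col-new eq (proj₁ rg) fr)

      Near : Fin N → Fin n → Set
      Near u x = ∃[ x′ ] ∃[ z ] Star (Within E Rg) x x′ × E x′ z × K u z

      near? : ∀ u → U.Decidable (Near u)
      near? u x = any? λ x′ → any? λ z → star? (within? E? rg?) x x′ ×-dec E? x′ z ×-dec K? u z

      near-walk : ∀ {u x x′} → Star (Within E Rg) x x′ → Near u x′ → Near u x
      near-walk p (a , z , p′ , r) = a , z , p ◅◅ p′ , r

      -- A component of `Rg` may touch several parts of `D`; giving it to the first of them keeps
      -- the bags disjoint.
      first : List (Fin N) → Fin n → Maybe (Fin N)
      first []       x = nothing
      first (u ∷ us) x with near? u x
      ... | yes _ = just u
      ... | no _  = first us x

      first-cong : ∀ us {x x′} → Star (Within E Rg) x x′ → first us x ≡ first us x′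
      first-cong []       p = refl
      first-cong (u ∷ us) {x} {x′} p with near? u x | near? u x′
      ... | yes _ | yes _ = refl
      ... | yes a | no ¬b = contradiction (near-walk (star-sym E-sym p) a) ¬b
      ... | no ¬a | yes b = contradiction (near-walk p b) ¬a
      ... | no _  | no _  = first-cong us p

      first-near : ∀ us {x o} → first us x ≡ just o → o ∈ us × Near o x
      first-near (u ∷ us) {x} eq with near? u x
      first-near (u ∷ us) refl | yes a = here refl , a
      ... | no _ with o∈ , a ← first-near us eq = there o∈ , a

      first-exists : ∀ us {x u} → u ∈ us → Near u x → Σ[ o ∈ Fin N ] first us x ≡ just o
      first-exists (w ∷ us) {x} u∈ a with near? w x
      ... | yes _ = w , refl
      first-exists (w ∷ us) (here refl) a | no ¬a = contradiction a ¬a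
      first-exists (w ∷ us) (there u∈)  a | no _  = first-exists us u∈ a

      f′ : Fin n → Maybe (Fin N)
      f′ x with rg? x
      ... | yes _ = first D x
      ... | no _  = f x

      f′-rg : ∀ {x} → Rg x → f′ x ≡ first D x
      f′-rg {x} rg with rg? x
      ... | yes _  = refl
      ... | no ¬rg = contradiction rg ¬rg

      f⊑f′ : ∀ {x u} → f x ≡ just u → f′ x ≡ just u
      f⊑f′ {x} eq with rg? x
      ... | yes rg = contradiction (trans (sym eq) (Rg-nothing rg)) λ ()
      ... | no _   = eq

      f′-cases : ∀ {x u} → f′ x ≡ just u → f x ≡ just u ⊎ (Rg x × first D x ≡ just u)
      f′-cases {x} eq with rg? x
      ... | yes rg = inj₂ (rg , eq)
      ... | no _   = inj₁ eq

      f′-K : ∀ {u x} → K u x → f′ x ≡ just u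
      f′-K k = f⊑f′ (f-K k)

      f′-conn : ∀ {x u} → f′ x ≡ just u → Σ[ i ∈ Fin s ] lab i ≡ u × Star (Within E (λ z → f′ z ≡ just u)) (σ i) x
      f′-conn eq with f′-cases eq
      ... | inj₁ eq₀ with i , l , p ← f-conn eq₀ = i , l , star-mono f⊑f′ p
      ... | inj₂ (rg , fst≡) with o∈ , x′ , z , p , e , k@(i , l , _) ← first-near D fst≡
        = i , l , star-mono f′-K (K-path i l k) ◅◅
                  ((f′-K k , owned p , E-sym e) ◅ star-sym E-sym (star-mono (λ (_ , q) → owned q) walk))
        where
        owned : ∀ {a} → Star (Within E Rg) _ a → f′ a ≡ just _
        owned q = trans (f′-rg (star-end q rg)) (trans (sym (first-cong D q)) fst≡)
        walk = star-upgrade {Q = Star (Within E Rg) _} (λ q r → q ◅◅ (r ◅ ε)) ε p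

      K-in-D : ∀ {u x} → K u x → InY D (ỹ x) → u ∈ D
      K-in-D k p with w , w∈ , eq ← find p
        with refl ← just-injective (trans (sym (ỹ-grp k)) (trans (cong own eq) (own-y w))) = w∈

      NewNbr : Fin N → Set
      NewNbr u = Σ[ w ∈ Fin N ] w ∈ D × w ≢ u × Adj f′ u w

      Side : Fin N → Fin n → Set
      Side u x = K u x ⊎ (Rg x × Near u x)

      -- A link of `u` ends in another part, so on leaving `K u` and the components of `Rg` touching
      -- it, it enters some `K g`. If the component left behind was given to another part `o`, then
      -- it touches `K u` as well, and `o` is the new neighbour.
      walk : ∀ {u j x} → u ∈ D → lab j ≢ u → Side u x → Star (Within E (InY D ∘ ỹ)) x (σ j) → NewNbr u
      walk u∈ ne (inj₁ k) ε = contradiction (K-unique (K-σ _) k) ne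
      walk u∈ ne (inj₂ ((∉K , _) , _)) ε = contradiction (_ , K-σ _) ∉K
      walk {u} u∈ ne side (_◅_ {i = x} {j = z} (px , pz , e) rs) with inK? z
      walk {u} u∈ ne (inj₁ k) (_◅_ {i = x} {j = z} (px , pz , e) rs) | yes (g , kz) with g ≟ u
      ... | yes refl = walk u∈ ne (inj₁ kz) rs
      ... | no g≢u   = g , K-in-D kz pz , g≢u , x , z , e , f′-K k , f′-K kz
      walk {u} u∈ ne (inj₁ k) (_◅_ {i = x} {j = z} (px , pz , e) rs) | no ∉K
        = walk u∈ ne (inj₂ ((∉K , pz) , z , x , ε , E-sym e , k)) rs
      walk {u} u∈ ne (inj₂ (rg , near)) (_◅_ {i = x} {j = z} (px , pz , e) rs) | no ∉K
        = walk u∈ ne (inj₂ ((∉K , pz) , near-walk (((∉K , pz) , rg , E-sym e) ◅ ε) near)) rs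
      walk {u} u∈ ne (inj₂ (rg , near)) (_◅_ {i = x} {j = z} (px , pz , e) rs) | yes (g , kz) with g ≟ u
      ... | yes refl = walk u∈ ne (inj₁ kz) rs
      ... | no g≢u with o , fst≡ ← first-exists D u∈ near with o ≟ u
      ...   | yes refl = g , K-in-D kz pz , g≢u , x , z , e , trans (f′-rg rg) fst≡ , f′-K kz
      ...   | no o≢u with x′ , z′ , p , e′ , k ← near
        = o , proj₁ (first-near D fst≡) , o≢u , z′ , x′ , E-sym e′ , f′-K k ,
          trans (f′-rg (star-end p rg)) (trans (sym (first-cong D p)) fst≡)

      new : ∀ {u} → u ∈ D → NewNbr u
      new u∈ with w , w∈ , w≢u , i , j , refl , refl , p ← proj₂ blocked u∈ = walk u∈ w≢u (inj₁ (K-σ i)) p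

      free′⇒free : ∀ {u v} → Free f′ u v → Free f u v
      free′⇒free (ne , hu , hv , ¬adj) = ne , hu , hv , λ (x , z , e , fx , fz) → ¬adj (x , z , e , f⊑f′ fx , f⊑f′ fz)

      -- The chains have absorbed `y u`, the colour reserved for one free partner of `u`. That
      -- partner takes over the colour reserved for the new neighbour, whose pair with `u` is no
      -- longer free.
      col′ : Fin N → Fin N → Fin q
      col′ u v with u ∈? D
      ... | no _ = col u v
      ... | yes u∈ with v ≟ proj₁ (y-some u∈)
      ...   | yes _ = col u (proj₁ (new u∈))
      ...   | no _  = col u v

      new-free : ∀ {u} (u∈ : u ∈ D) → Free f u (proj₁ (new u∈))
      new-free u∈ with w , w∈ , w≢u , _ ← new u∈ = indep u∈ w∈ (w≢u ∘ sym)

      new-≢ : ∀ {u v} (u∈ : u ∈ D) → Free f′ u v → v ≢ proj₁ (new u∈)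
      new-≢ u∈ (_ , _ , _ , ¬adj) refl = ¬adj (proj₂ (proj₂ (proj₂ (new u∈))))

      col′-own : ∀ {u v} → Free f′ u v → own (col′ u v) ≡ just u
      col′-own {u} {v} fr with u ∈? D
      ... | no _ = col-own (free′⇒free fr)
      ... | yes u∈ with v ≟ proj₁ (y-some u∈)
      ...   | yes _ = col-own (new-free u∈)
      ...   | no _  = col-own (free′⇒free fr)

      col′-inj : ∀ {u v v′} → Free f′ u v → Free f′ u v′ → col′ u v ≡ col′ u v′ → v ≡ v′
      col′-inj {u} {v} {v′} fr fr′ eq with u ∈? D
      ... | no _ = col-inj (free′⇒free fr) (free′⇒free fr′) eq
      ... | yes u∈ with v ≟ proj₁ (y-some u∈) | v′ ≟ proj₁ (y-some u∈)
      ...   | yes p | yes p′ = trans p (sym p′)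
      ...   | yes p | no _   = contradiction (sym (col-inj (new-free u∈) (free′⇒free fr′) eq)) (new-≢ u∈ fr′)
      ...   | no _  | yes p′ = contradiction (col-inj (free′⇒free fr) (new-free u∈) eq) (new-≢ u∈ fr)
      ...   | no _  | no _   = col-inj (free′⇒free fr) (free′⇒free fr′) eq

      chosen-unique : ∀ {x u v w} (u∈ : u ∈ D) → c x ≡ y w → c x ≡ col u v → Free f u v → proj₁ (y-some u∈) ≡ v
      chosen-unique {w = w} u∈ cx ceq fr₀ with v₀ , fr₁ , yu ← y-some u∈
        with refl ← just-injective (trans (sym (own-y w)) (trans (cong own (trans (sym cx) ceq)) (col-own fr₀)))
        = col-inj fr₁ fr₀ (trans (sym yu) (trans (sym cx) ceq))

      col′-new : ∀ {x b u v} → f′ x ≡ just b → ¬ InK x → Free f′ u v → c x ≢ col′ u v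
      col′-new {x} {b} {u} {v} eq ∉K fr with f′-cases eq
      col′-new {x} {b} {u} {v} eq ∉K fr | inj₁ old with u ∈? D
      ... | no _ = col-new old ∉K (free′⇒free fr)
      ... | yes u∈ with v ≟ proj₁ (y-some u∈)
      ...   | yes _ = col-new old ∉K (new-free u∈)
      ...   | no _  = col-new old ∉K (free′⇒free fr)
      col′-new {x} {b} {u} {v} eq ∉K fr | inj₂ (rg , _) with w , w∈ , cx ← Rg-colour rg with u ∈? D
      ... | no u∉ = λ ceq → u∉ (subst (_∈ D) (just-injective (trans (sym (own-y w)) (trans (cong own (trans (sym cx) ceq)) (col-own (free′⇒free fr))))) w∈)
      ... | yes u∈ with v ≟ proj₁ (y-some u∈)
      ...   | yes p = λ ceq → new-≢ u∈ fr (trans p (chosen-unique u∈ cx ceq (new-free u∈)))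
      ...   | no ¬p = λ ceq → ¬p (sym (chosen-unique u∈ cx ceq (free′⇒free fr)))

      next : State
      next = record
        { f = f′ ; f-K = f′-K ; f-conn = f′-conn ; col = col′
        ; col-own = col′-own ; col-inj = col′-inj ; col-new = col′-new }

      smaller : measure f′ < measure f
      smaller with u , u∈ ← proj₁ blocked =
        length-filter-< (λ (u , v) → free? f′ u v) (λ (u , v) → free? f u v) free′⇒free
          (∈-cartesianProduct⁺ (∈-allFin u) (∈-allFin (proj₁ (new u∈))))
          (λ fr → new-≢ u∈ fr refl) (new-free u∈)

  same-part : ∀ i j → lab i ≡ lab j → ¬ E (σ i) (σ j)
  same-part i j eq e = c-proper e (trans (c-σ i) (trans (cong γ eq) (sym (c-σ j))))

  -- A colour class of c′ that cannot be merged provides a blocked set, and its chains make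
  -- further bags adjacent.
  loop : (st : State) → Acc _<_ (measure (State.f st)) → ⊥
  loop st (acc rec)
    with c′ , c′-proper , c′-lab , c′-adj ← transfer lab (State.f st)
           (λ i → State.f-K st (K-σ i)) (State.f-conn st)
           (λ i j eq → star-mono (State.f-K st) (K-path i refl (subst (λ u → K u (σ j)) (sym eq) (K-σ j)))) same-part
    = separated (col merge) c′ (col-proper merge) c′-proper (col-kernel merge)
    where
    open State st using (f)
    open Step st
    open Combine (c′ ∘ σ) c′-lab
    merge : ∀ α → Mergeable (cls α)
    merge α with mergeable-or-blocked α (cls α)
    ... | inj₁ m = m
    ... | inj₂ (D , D⊆ , b) = ⊥-elim (loop (Progress.next D b indep) (rec (Progress.smaller D b indep)))
      where
      -- Parts of one class of `c′` have pairwise nonadjacent bags, because `c′` distinguishes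
      -- adjacent ones.
      indep : ∀ {u w} → u ∈ D → w ∈ D → u ≢ w → Free f u w
      indep u∈ w∈ ne with i , refl , hi ← cls-part (D⊆ u∈) | j , refl , hj ← cls-part (D⊆ w∈)
        = ne , (i , refl) , (j , refl) , λ (x , z , e , fx , fz) → c′-adj e fx fz ne (trans hi (sym hj))

  -- The initial bags are the components `K u`, which contain the parts. Adjacent parts thus have
  -- adjacent bags already at the start, and colours are reserved for needed pairs only.
  resolved : (col : Fin N → Fin N → Fin q) →
             (∀ {u v} → Needed E σ lab u v → own (col u v) ≡ just u) →
             (∀ {u v v′} → Needed E σ lab u v → Needed E σ lab u v′ → col u v ≡ col u v′ → v ≡ v′) → ⊥
  resolved col col-own col-inj = loop start (<-wellFounded _)
    where
    f₀ : Fin n → Maybe (Fin N)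
    f₀ x with inK? x
    ... | yes (u , _) = just u
    ... | no _        = nothing

    f₀-K : ∀ {u x} → K u x → f₀ x ≡ just u
    f₀-K {u} {x} k with inK? x
    ... | yes (w , k′) = cong just (K-unique k′ k)
    ... | no ∉K        = contradiction (u , k) ∉K

    K-f₀ : ∀ {u x} → f₀ x ≡ just u → K u x
    K-f₀ {u} {x} eq with inK? x
    K-f₀ refl | yes (u , k) = k

    need : ∀ {u v} → Free f₀ u v → Needed E σ lab u v
    need (ne , hu , hv , ¬adj) = ne , hu , hv , λ where
      (i , j , refl , refl , e) → ¬adj (σ i , σ j , e , f₀-K (K-σ i) , f₀-K (K-σ j))

    start : State
    start = record
      { f = f₀ ; f-K = f₀-K
      ; f-conn = λ { eq → let k@(i , l , _) = K-f₀ eq in i , l , star-mono f₀-K (K-path i l k) }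
      ; col = col ; col-own = λ fr → col-own (need fr) ; col-inj = λ fr fr′ → col-inj (need fr) (need fr′)
      ; col-new = λ eq ∉K _ → contradiction (_ , K-f₀ eq) ∉K }

-- Bags with one receiving colour per part

module Stars
  {n s q N : ℕ} {E E′ : Rel (Fin n) 0ℓ} (E? : Decidable E) (E-sym : Symmetric E)
  (σ : Fin s → Fin n) (transfer : Transfer q E E′ σ) (separated : Separated q E E′ σ)
  (lab : Fin s → Fin N) (own : Fin q → Maybe (Fin N))
  {c : Fin n → Fin q} (c-proper : Proper E c)
  (γ : Fin N → Fin q) (own-γ : ∀ u → own (γ u) ≡ just u) (c-σ : ∀ i → c (σ i) ≡ γ (lab i))
  (conn : ∀ i j → lab i ≡ lab j → Star (Within E (λ x → own (c x) ≡ just (lab i))) (σ i) (σ j))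
  where

  open Palette E? E-sym σ lab own c-proper γ own-γ c-σ conn

  Pair : Rel (Fin N) 0ℓ
  Pair u v = v <ᶠ u × Needed E σ lab u v

  pair? : Decidable Pair
  pair? u v = (v <ᶠ? u) ×-dec ¬? (u ≟ v) ×-dec hit? lab u ×-dec hit? lab v ×-dec
    ¬? (any? λ i → any? λ j → (lab i ≟ u) ×-dec (lab j ≟ v) ×-dec E? (σ i) (σ j))

  module _
    -- For v < u, part u is merged with part v by using d u v for u and x v for v.
    (d : Fin N → Fin N → Fin q) (x : Fin N → Fin q)
    (d-own : ∀ {u v} → Pair u v → own (d u v) ≡ just u)
    (x-own : ∀ {u v} → Pair u v → own (x v) ≡ just v)
    (d-inj : ∀ {u v v′} → Pair u v → Pair u v′ → d u v ≡ d u v′ → v ≡ v′)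
    (d≢x : ∀ {u v w} → Pair u v → Pair w u → d u v ≢ x u)
    where

    -- The smaller part `v` takes both colours of a pair, even `d u v`, which belongs to the group
    -- of `u`. A chain from `v` to `u` in these two colours then stays in the bag of `v` until it
    -- enters `K u`.
    Z : Fin N → Fin n → Set
    Z v z = K v z ⊎ (¬ InK z × (Σ[ u ∈ Fin N ] Pair u v × (c z ≡ x v ⊎ c z ≡ d u v)))

    z? : ∀ v → U.Decidable (Z v)
    z? v z = K? v z ⊎-dec (¬? (inK? z) ×-dec any? λ u → pair? u v ×-dec ((c z ≟ x v) ⊎-dec (c z ≟ d u v)))

    Z-unique : ∀ {v w z} → Z v z → Z w z → v ≡ w
    Z-unique (inj₁ k) (inj₁ k′) = K-unique k k′
    Z-unique (inj₁ k) (inj₂ (∉K , _)) = contradiction (_ , k) ∉K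
    Z-unique (inj₂ (∉K , _)) (inj₁ k) = contradiction (_ , k) ∉K
    Z-unique (inj₂ (_ , u , p , inj₁ e)) (inj₂ (_ , u′ , p′ , inj₁ e′)) =
      just-injective (trans (sym (x-own p)) (trans (cong own (trans (sym e) e′)) (x-own p′)))
    Z-unique (inj₂ (_ , u , p , inj₁ e)) (inj₂ (_ , u′ , p′ , inj₂ e′))
      with refl ← just-injective (trans (sym (x-own p)) (trans (cong own (trans (sym e) e′)) (d-own p′)))
      = contradiction (trans (sym e′) e) (d≢x p′ p)
    Z-unique (inj₂ (_ , u , p , inj₂ e)) (inj₂ (_ , u′ , p′ , inj₁ e′))
      with refl ← just-injective (trans (sym (x-own p′)) (trans (cong own (trans (sym e′) e)) (d-own p)))
      = contradiction (trans (sym e) e′) (d≢x p p′)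
    Z-unique (inj₂ (_ , u , p , inj₂ e)) (inj₂ (_ , u′ , p′ , inj₂ e′))
      with refl ← just-injective (trans (sym (d-own p)) (trans (cong own (trans (sym e) e′)) (d-own p′)))
      = d-inj p p′ (trans (sym e) e′)

    Bag : Fin N → Fin n → Set
    Bag v z = Σ[ i ∈ Fin s ] lab i ≡ v × Star (Within E (Z v)) (σ i) z

    bag? : ∀ v → U.Decidable (Bag v)
    bag? v z = any? λ i → (lab i ≟ v) ×-dec star? (within? E? (z? v)) (σ i) z

    Bag-Z : ∀ {v z} → Bag v z → Z v z
    Bag-Z (i , refl , p) = star-end p (inj₁ (K-σ i))

    Bag-step : ∀ {v z z′} → Bag v z → E z z′ → Z v z′ → Bag v z′
    Bag-step b@(i , l , p) e zz = i , l , p ◅◅ ((Bag-Z b , zz , e) ◅ ε)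

    K⇒Bag : ∀ {v z} → K v z → Bag v z
    K⇒Bag k@(i , l , _) = i , l , star-mono inj₁ (K-path i l k)

    opaque

      f : Fin n → Maybe (Fin N)
      f z with any? (λ v → bag? v z)
      ... | yes (v , _) = just v
      ... | no _        = nothing

      Bag⇒f : ∀ {v z} → Bag v z → f z ≡ just v
      Bag⇒f {v} {z} b with any? (λ v → bag? v z)
      ... | yes (w , b′) = cong just (Z-unique (Bag-Z b′) (Bag-Z b))
      ... | no none      = contradiction (v , b) none

      f⇒Bag : ∀ {v z} → f z ≡ just v → Bag v z
      f⇒Bag {v} {z} eq with any? (λ v → bag? v z)
      f⇒Bag refl | yes (w , b) = b

    Respects : (Fin n → Fin q) → Set
    Respects c′ = Proper E′ c′ × (∀ {i j} → lab i ≡ lab j → c′ (σ i) ≡ c′ (σ j)) ×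
      (∀ {z z′ i j} → E z z′ → f z ≡ just (lab i) → f z′ ≡ just (lab j) → lab i ≢ lab j → c′ (σ i) ≢ c′ (σ j))

    respecting : Σ[ c′ ∈ (Fin n → Fin q) ] Respects c′
    respecting = transfer lab f (λ i → Bag⇒f (K⇒Bag (K-σ i)))
      (λ eq → let (i , l , p) = f⇒Bag eq in
        i , l , star-mono (λ (_ , b) → Bag⇒f b) (star-upgrade (λ b (_ , zz , e) → Bag-step b e zz) (i , l , ε) p))
      (λ i j eq → star-mono (λ k → Bag⇒f (K⇒Bag k)) (K-path i refl (subst (λ u → K u (σ j)) (sym eq) (K-σ j))))
      (λ i j eq e → c-proper e (trans (c-σ i) (trans (cong γ eq) (sym (c-σ j)))))

    Triple : (Fin n → Fin q) → Set
    Triple c′ = Σ[ i ∈ Fin s ] Σ[ j ∈ Fin s ] Σ[ k ∈ Fin s ] lab i ≢ lab j × lab i ≢ lab k × lab j ≢ lab k ×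
      c′ (σ i) ≡ c′ (σ j) × c′ (σ i) ≡ c′ (σ k)

    module _ (c′ : Fin n → Fin q) (respects : Respects c′) (no-triple : ¬ Triple c′) where

      private
        c′-proper = proj₁ respects
        c′-lab = proj₁ (proj₂ respects)
        c′-adj = proj₂ (proj₂ respects)

        h : Fin s → Fin q
        h i = c′ (σ i)

      Partner : Rel (Fin N) 0ℓ
      Partner u w = u ≢ w × (Σ[ i ∈ Fin s ] Σ[ j ∈ Fin s ] lab i ≡ u × lab j ≡ w × h i ≡ h j)

      opaque
        partner? : Decidable Partner
        partner? u w = ¬? (u ≟ w) ×-dec any? λ i → any? λ j → (lab i ≟ u) ×-dec (lab j ≟ w) ×-dec (h i ≟ h j)

      partner-sym : ∀ {u w} → Partner u w → Partner w u
      partner-sym (ne , i , j , l , l′ , eq) = ne ∘ sym , j , i , l′ , l , sym eq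

      -- Without a triple a class of `c′` meets at most two parts; this makes the choice of `y`
      -- below unambiguous.
      partner-unique : ∀ {u w w′} → Partner u w → Partner u w′ → w ≡ w′
      partner-unique {u} {w} {w′} (ne , i , j , refl , refl , eq) (ne′ , i′ , j′ , l , refl , eq′) with w ≟ w′
      ... | yes p = p
      ... | no p  = contradiction (i , j , j′ , ne , ne′ , p , eq , trans (c′-lab (sym l)) eq′) no-triple

      partner-needed : ∀ {u w} → Partner u w → Needed E σ lab u w
      partner-needed (ne , i , j , refl , refl , eq) = ne , (i , refl) , (j , refl) , λ where
        (i′ , j′ , l , l′ , e) → c′-adj e (Bag⇒f (K⇒Bag (K-σ i′))) (Bag⇒f (K⇒Bag (K-σ j′)))
          (λ eq′ → ne (trans (sym l) (trans eq′ l′))) (trans (c′-lab l) (trans eq (c′-lab (sym l′))))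

      opaque

        y : Fin N → Fin q
        y u with any? (partner? u)
        ... | no _ = γ u
        ... | yes (w , _) with w <ᶠ? u
        ...   | yes _ = d u w
        ...   | no _  = x u

        own-y : ∀ u → own (y u) ≡ just u
        own-y u with any? (partner? u)
        ... | no _ = own-γ u
        ... | yes (w , p) with w <ᶠ? u
        ...   | yes lt = d-own (lt , partner-needed p)
        ...   | no ¬lt with <-cmp u w
        ...     | tri< lt _ _ = x-own {w} (lt , partner-needed (partner-sym p))
        ...     | tri≈ _ eq _ = contradiction eq (proj₁ p)
        ...     | tri> _ _ gt = contradiction gt ¬lt

        y-above : ∀ {u w} → Partner u w → w <ᶠ u → y u ≡ d u w
        y-above {u} {w} p lt with any? (partner? u)
        ... | no none = contradiction (w , p) none
        ... | yes (w′ , p′) with refl ← partner-unique p p′ with w <ᶠ? u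
        ...   | yes _  = refl
        ...   | no ¬lt = contradiction lt ¬lt

        y-below : ∀ {u w} → Partner u w → u <ᶠ w → y u ≡ x u
        y-below {u} {w} p lt with any? (partner? u)
        ... | no none = contradiction (w , p) none
        ... | yes (w′ , p′) with refl ← partner-unique p p′ with w <ᶠ? u
        ...   | yes gt = contradiction lt (<-asym gt)
        ...   | no _   = refl

      open Recolour y own-y
      open Combine h c′-lab

      module _ {D : List (Fin N)} {u v : Fin N} (D⊆ : ∀ {g} → g ∈ D → g ≡ u ⊎ g ≡ v)
        (pair : Pair u v) (yu : y u ≡ d u v) (yv : y v ≡ x v) where

        walk : ∀ {i z} → lab i ≡ u → Bag v z → Star (Within E (InY D ∘ ỹ)) z (σ i) →
               ∃[ a ] ∃[ b ] E a b × f a ≡ just v × f b ≡ just u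
        walk l bag ε = contradiction (trans (sym l) (Z-unique (inj₁ (K-σ _)) (Bag-Z bag))) (proj₁ (proj₂ pair))
        walk {z = a} l bag (_◅_ {j = b} (_ , pb , e) rs) = step (find pb) (inK? b)
          where
          step : ∃[ g ] g ∈ D × ỹ b ≡ y g → Dec (InK b) → ∃[ a ] ∃[ b ] E a b × f a ≡ just v × f b ≡ just u
          step (g , g∈ , eq) (no ∉K) = walk l (Bag-step bag e (inj₂ (∉K , u , pair , colour (D⊆ g∈)))) rs
            where
            colour : g ≡ u ⊎ g ≡ v → c b ≡ x v ⊎ c b ≡ d u v
            colour (inj₁ refl) = inj₂ (trans (sym (ỹ-out ∉K)) (trans eq yu))
            colour (inj₂ refl) = inj₁ (trans (sym (ỹ-out ∉K)) (trans eq yv))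
          step (g , g∈ , eq) (yes (g′ , k)) = inside (D⊆ g∈)
            where
            g′≡g : g′ ≡ g
            g′≡g = just-injective (trans (sym (ỹ-grp k)) (trans (cong own eq) (own-y g)))
            inside : g ≡ u ⊎ g ≡ v → ∃[ a ] ∃[ b ] E a b × f a ≡ just v × f b ≡ just u
            inside (inj₁ g≡u) = a , b , e , Bag⇒f bag , Bag⇒f (K⇒Bag (subst (λ w → K w b) (trans g′≡g g≡u) k))
            inside (inj₂ g≡v) = walk l (K⇒Bag (subst (λ w → K w b) (trans g′≡g g≡v) k)) rs

      -- A link would lead from the bag of `v` directly into `K u`, so two parts with the same
      -- colour in `c′` would have adjacent bags.
      not-linked : ∀ {α D u v} → (∀ {g} → g ∈ D → g ∈ cls α) → u ∈ D → v ∈ D → u ≢ v → v <ᶠ u →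
                   ∀ {i j} → lab i ≡ u → lab j ≡ v → ¬ Star (Within E (InY D ∘ ỹ)) (σ j) (σ i)
      not-linked {α} {D} {u} {v} D⊆ u∈ v∈ ne lt refl refl p =
        let a , b , e , fa , fb = walk in-pair (lt , partner-needed (part u∈ v∈ ne))
              (y-above (part u∈ v∈ ne) lt) (y-below (part v∈ u∈ (ne ∘ sym)) lt) refl (K⇒Bag (K-σ _)) p
        in c′-adj e fa fb (ne ∘ sym) (trans (cls-lab (D⊆ v∈)) (sym (cls-lab (D⊆ u∈))))
        where
        part : ∀ {u v} → u ∈ D → v ∈ D → u ≢ v → Partner u v
        part u∈ v∈ ne with i , l , hi ← cls-part (D⊆ u∈) | j , l′ , hj ← cls-part (D⊆ v∈)
          = ne , i , j , l , l′ , trans hi (sym hj)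
        in-pair : ∀ {g} → g ∈ D → g ≡ u ⊎ g ≡ v
        in-pair {g} g∈ with g ≟ u
        ... | yes eq = inj₁ eq
        ... | no g≢u = inj₂ (partner-unique (part u∈ g∈ (g≢u ∘ sym)) (part u∈ v∈ ne))

      merge : ∀ α → Mergeable (cls α)
      merge α with mergeable-or-blocked α (cls α)
      ... | inj₁ m = m
      ... | inj₂ (D , D⊆ , (u , u∈) , linked) with w , w∈ , w≢u , i , j , l , l′ , p ← linked u∈ with <-cmp w u
      ...   | tri< lt _ _ = ⊥-elim (not-linked D⊆ u∈ w∈ (w≢u ∘ sym) lt l l′ (star-sym E-sym p))
      ...   | tri≈ _ eq _ = contradiction eq w≢u
      ...   | tri> _ _ gt = ⊥-elim (not-linked D⊆ w∈ u∈ w≢u gt l′ l p)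

      impossible : ⊥
      impossible = separated (col merge) c′ (col-proper merge) c′-proper (col-kernel merge)

    triple : ∀ c′ → Respects c′ → Triple c′
    triple c′ respects with any? (λ i → any? λ j → any? λ k → ¬? (lab i ≟ lab j) ×-dec ¬? (lab i ≟ lab k) ×-dec
      ¬? (lab j ≟ lab k) ×-dec (c′ (σ i) ≟ c′ (σ j)) ×-dec (c′ (σ i) ≟ c′ (σ k)))
    ... | yes t = t
    ... | no ¬t = ⊥-elim (impossible c′ respects ¬t)

-- Kempe changes and finest colourings

-- By `only`, the set `X` contains a single colour of the separator. So `β` is absent from the
-- separator, and the change on `T` can only divide the class of `i₀`.
module Split
  {n s q : ℕ} {E : Rel (Fin n) 0ℓ} (E? : Decidable E) (E-sym : Symmetric E) (σ : Fin s → Fin n)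
  {c : Fin n → Fin q} (c-proper : Proper E c)
  {X : Fin q → Set} (X? : U.Decidable X) (i₀ : Fin s) (Xi₀ : X (c (σ i₀)))
  {β : Fin q} (Xβ : X β) (β≢ : β ≢ c (σ i₀))
  (only : ∀ k → X (c (σ k)) → c (σ k) ≡ c (σ i₀))
  where

  T : Fin n → Set
  T x = Star (Within E (X ∘ c)) (σ i₀) x

  T? : U.Decidable T
  T? x = star? (within? E? (X? ∘ c)) (σ i₀) x

  T-X : ∀ {x} → T x → X (c x)
  T-X p = star-end p Xi₀

  T-step : ∀ {x z} → T x → E x z → X (c z) → T z
  T-step t e Xz = star-last t Xi₀ Xz e

  opaque

    split : Fin n → Fin q
    split x with T? x
    ... | yes _ = transpose (c (σ i₀)) β (c x)
    ... | no _  = c x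

    split-in : ∀ {x} → T x → split x ≡ transpose (c (σ i₀)) β (c x)
    split-in {x} t with T? x
    ... | yes _ = refl
    ... | no ¬t = contradiction t ¬t

    split-out : ∀ {x} → ¬ T x → split x ≡ c x
    split-out {x} ¬t with T? x
    ... | yes t = contradiction t ¬t
    ... | no _  = refl

  split-X : ∀ {x} → T x → X (split x)
  split-X t = subst X (sym (split-in t)) (transpose-closed (c (σ i₀)) β {X} Xi₀ Xβ (T-X t))

  split-β : ∀ {k} → T (σ k) → split (σ k) ≡ β
  split-β {k} t = trans (split-in t) (trans (cong (transpose _ _) (only k (T-X t))) (transpose-fst (c (σ i₀)) β))

  split-proper : Proper E split
  split-proper {x} {z} e with T? x | T? z
  ... | yes t | yes t′ = λ eq → c-proper e (transpose-injective (c (σ i₀)) β (trans (sym (split-in t)) (trans eq (split-in t′))))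
  ... | yes t | no ¬t  = λ eq → ¬t (T-step t e (subst X (trans eq (split-out ¬t)) (split-X t)))
  ... | no ¬t | yes t  = λ eq → ¬t (T-step t (E-sym e) (subst X (trans (sym eq) (split-out ¬t)) (split-X t)))
  ... | no ¬t | no ¬t′ = λ eq → c-proper e (trans (sym (split-out ¬t)) (trans eq (split-out ¬t′)))

  separates : ∀ {i j} → T (σ i) → ¬ T (σ j) → split (σ i) ≢ split (σ j)
  separates {i} {j} t ¬t eq = β≢ (trans β≡ (only j (subst X β≡ Xβ)))
    where
    β≡ : β ≡ c (σ j)
    β≡ = trans (sym (split-β t)) (trans eq (split-out ¬t))

  refines : ∀ {i j} → split (σ i) ≡ split (σ j) → c (σ i) ≡ c (σ j)
  refines {i} {j} eq with T? (σ i) | T? (σ j)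
  ... | yes t | yes t′ = trans (only i (T-X t)) (sym (only j (T-X t′)))
  ... | yes t | no ¬t  = contradiction eq (separates t ¬t)
  ... | no ¬t | yes t  = contradiction (sym eq) (separates t ¬t)
  ... | no ¬t | no ¬t′ = trans (sym (split-out ¬t)) (trans eq (split-out ¬t′))

  keeps : ∀ {i j} → ¬ T (σ i) → ¬ T (σ j) → c (σ i) ≡ c (σ j) → split (σ i) ≡ split (σ j)
  keeps ¬t ¬t′ eq = trans (split-out ¬t) (trans eq (sym (split-out ¬t′)))

module _ {n s q : ℕ} (σ : Fin s → Fin n) where

  Refines : Rel (Fin n → Fin q) 0ℓ
  Refines c′ c = ∀ i j → c′ (σ i) ≡ c′ (σ j) → c (σ i) ≡ c (σ j)

  Finest : ((Fin n → Fin q) → Set) → (Fin n → Fin q) → Set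
  Finest 𝒞 c = ∀ c′ → 𝒞 c′ → Refines c′ c → Refines c c′

  -- Descent on the number of monochromatic pairs. Whether `𝒞` has a strictly finer member is not
  -- decided, so the finest colouring is handed to a continuation into `⊥`; this is enough, as each
  -- use is part of a refutation.
  finest : (𝒞 : (Fin n → Fin q) → Set) → ∀ {c₀} → 𝒞 c₀ → (∀ c → 𝒞 c → Finest 𝒞 c → ⊥) → ⊥
  finest 𝒞 {c₀} c₀∈ k = go c₀ c₀∈ (<-wellFounded _)
    where
    same? : ∀ c → U.Decidable (λ ((i , j) : Fin s × Fin s) → c (σ i) ≡ c (σ j))
    same? c (i , j) = c (σ i) ≟ c (σ j)
    measure : (Fin n → Fin q) → ℕ
    measure c = length (filter (same? c) (cartesianProduct (allFin s) (allFin s)))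
    go : ∀ c → 𝒞 c → Acc _<_ (measure c) → ⊥
    go c c∈ (acc rec) = k c c∈ is-finest
      where
      is-finest : Finest 𝒞 c
      is-finest c′ c′∈ c′⊑c i j eq with c′ (σ i) ≟ c′ (σ j)
      ... | yes eq′ = eq′
      ... | no ne   = ⊥-elim (go c′ c′∈ (rec (length-filter-< (same? c′) (same? c) (c′⊑c _ _)
                        (∈-cartesianProduct⁺ (∈-allFin i) (∈-allFin j)) ne eq)))

  finest-rename : ∀ {𝒞 : (Fin n → Fin q) → Set} {c} {π : Fin q → Fin q} → (∀ {x y} → π x ≡ π y → x ≡ y) →
                  Finest 𝒞 c → Finest 𝒞 (π ∘ c)
  finest-rename {π = π} π-inj fin c′ c′∈ ref i j eq = fin c′ c′∈ (λ i j eq → π-inj (ref i j eq)) i j (π-inj eq)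

  recolour : ∀ {N} (c : Fin n → Fin q) (lab : Fin s → Fin N) (γ : Fin N → Fin q) → SameKernel lab (c ∘ σ) →
             (∀ {u w} → γ u ≡ γ w → u ≡ w) →
             Σ[ π ∈ (Fin q → Fin q) ] (∀ {x y} → π x ≡ π y → x ≡ y) × (∀ i → π (c (σ i)) ≡ γ (lab i))
  recolour c lab γ ker γ-inj
    with π , π-inj , ok ← align (c ∘ σ) (γ ∘ lab) (allFin s)
           (λ {i} {j} _ _ eq → cong γ (proj₂ (ker i j) eq)) (λ {i} {j} _ _ eq → proj₁ (ker i j) (γ-inj eq))
    = π , π-inj , λ i → ok (∈-allFin i)

fit : ∀ {s K q} (h : Fin s → Fin q) (is : List (Fin s)) → (∀ i → Any (λ k → h k ≡ h i) is) → length is ≤ K →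
      Σ[ lab ∈ (Fin s → Fin K) ] SameKernel lab h
fit {s} {K} h is cover len = lab , λ i j → sound i j , complete i j
  where
  at : ∀ α → Dec (Any (λ k → h k ≡ α) is)
  at α = Any.any? (λ k → h k ≟ α) is
  -- The index is the one found by `at α` and not the one in the given proof, so it depends on the
  -- class alone.
  num : ∀ α → Any (λ k → h k ≡ α) is → Fin (length is)
  num α p with at α
  ... | yes p′ = Any.index p′
  ... | no ¬p  = contradiction p ¬p
  lab : Fin s → Fin K
  lab i = inject≤ (num (h i) (cover i)) len
  num-value : ∀ α p → h (lookup is (num α p)) ≡ α
  num-value α p with at α
  ... | yes p′ = lookup-index p′
  ... | no ¬p  = contradiction p ¬p
  num-cong : ∀ {α β} p p′ → α ≡ β → num α p ≡ num β p′
  num-cong {α} p p′ refl with at α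
  ... | yes _ = refl
  ... | no ¬p = contradiction p ¬p
  sound : ∀ i j → lab i ≡ lab j → h i ≡ h j
  sound i j eq = trans (sym (num-value (h i) (cover i)))
    (trans (cong (h ∘ lookup is) (inject≤-injective len len _ _ eq)) (num-value (h j) (cover j)))
  complete : ∀ i j → h i ≡ h j → lab i ≡ lab j
  complete i j eq = cong (λ k → inject≤ k len) (num-cong (cover i) (cover j) eq)

-- Allocation of colours

_≟²_ : ∀ {K} → DecidableEquality (Fin K × Fin K)
_≟²_ = ≡-dec _≟_ _≟_

infix 4 _∈²?_

_∈²?_ : ∀ {K} (p : Fin K × Fin K) (ps : List (Fin K × Fin K)) → Dec (p ∈ ps)
p ∈²? ps = Any.any? (p ≟²_) ps

offDiagonal : ∀ K → List (Fin K × Fin K)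
offDiagonal K = filter (λ (u , v) → ¬? (u ≟ v)) (cartesianProduct (allFin K) (allFin K))

-- One colour for each ordered pair of parts; an excluded pair saves both of its orders.
demands : ∀ {K} → List (Fin K × Fin K) → List (Fin K × Fin K)
demands {K} []               = offDiagonal K
demands     ((p , r) ∷ excl) = remove _≟²_ (p , r) (remove _≟²_ (r , p) (demands excl))

∈-offDiagonal : ∀ {K} {u v : Fin K} → u ≢ v → (u , v) ∈ offDiagonal K
∈-offDiagonal {u = u} {v} = ∈-filter⁺ _ (∈-cartesianProduct⁺ (∈-allFin u) (∈-allFin v))

∈-demands : ∀ {K} {u v : Fin K} excl → u ≢ v → (u , v) ∉ excl → (v , u) ∉ excl → (u , v) ∈ demands excl
∈-demands [] u≢v _ _ = ∈-offDiagonal u≢v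
∈-demands (_ ∷ excl) u≢v uv∉ vu∉ =
  ∈-remove _≟²_ (∈-remove _≟²_ (∈-demands excl u≢v (uv∉ ∘ there) (vu∉ ∘ there))
    (λ { refl → vu∉ (here refl) })) (λ { refl → uv∉ (here refl) })

-- The last two conditions of `two` make the pairs distinct as unordered pairs, so that four ordered
-- pairs are saved.
data Exclusions {K : ℕ} : ℕ → List (Fin K × Fin K) → Set where
  ∅ₑ  : Exclusions 0 []
  two : ∀ {p p′ r r′} → p ≢ p′ → r ≢ r′ → (p , p′) ≢ (r , r′) → (p , p′) ≢ (r′ , r) →
         Exclusions 2 ((p , p′) ∷ (r , r′) ∷ [])

length-demands : ∀ {K e} {excl : List (Fin K × Fin K)} → Exclusions e excl →
                 e + (e + length (demands excl)) ≤ length (offDiagonal K)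
length-demands ∅ₑ = ≤-refl
length-demands {K} (two {p} {p′} {r} {r′} p≢ r≢ ne ne′) =
  ≤-trans (s≤s (s≤s (s≤s (length-remove _≟²_ {p , p′} l₁ (∈-remove _≟²_ (∈-remove _≟²_ (∈-remove _≟²_ (∈-offDiagonal p≢) ne′) ne) swap≢)))))
  (≤-trans (s≤s (s≤s (length-remove _≟²_ l₂ (∈-remove _≟²_ (∈-remove _≟²_ (∈-offDiagonal (p≢ ∘ sym)) swap-ne) swap-ne′))))
  (≤-trans (s≤s (length-remove _≟²_ l₃ (∈-remove _≟²_ (∈-offDiagonal r≢) (λ eq → r≢ (cong proj₁ eq)))))
           (length-remove _≟²_ (offDiagonal K) (∈-offDiagonal (r≢ ∘ sym)))))
  where
  l₃ = remove _≟²_ (r′ , r) (offDiagonal K)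
  l₂ = remove _≟²_ (r , r′) l₃
  l₁ = remove _≟²_ (p′ , p) l₂
  swap≢ : (p , p′) ≢ (p′ , p)
  swap≢ eq = p≢ (cong proj₁ eq)
  swap-ne : (p′ , p) ≢ (r′ , r)
  swap-ne eq = ne (cong₂ _,_ (cong proj₂ eq) (cong proj₁ eq))
  swap-ne′ : (p′ , p) ≢ (r , r′)
  swap-ne′ eq = ne′ (cong₂ _,_ (cong proj₂ eq) (cong proj₁ eq))

length-exclusions : ∀ {K e} {excl : List (Fin K × Fin K)} → Exclusions e excl → length excl ≡ e
length-exclusions ∅ₑ            = refl
length-exclusions (two _ _ _ _) = refl

exclusions-suc : ∀ {K e} {excl : List (Fin K × Fin K)} → Exclusions e excl →
                 Exclusions e (map (λ (u , v) → suc u , suc v) excl)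
exclusions-suc ∅ₑ = ∅ₑ
exclusions-suc (two p≢ r≢ ne ne′) = two (p≢ ∘ suc-injective) (r≢ ∘ suc-injective)
  (λ eq → ne (cong₂ _,_ (suc-injective (cong proj₁ eq)) (suc-injective (cong proj₂ eq))))
  (λ eq → ne′ (cong₂ _,_ (suc-injective (cong proj₁ eq)) (suc-injective (cong proj₂ eq))))

-- Each excluded pair rules out at most one partner of u.
partner : ∀ {K} (u : Fin K) (vs : List (Fin K)) (excl : List (Fin K × Fin K)) → suc (length vs) + length excl < K →
          Σ[ v ∈ Fin K ] v ≢ u × v ∉ vs × (u , v) ∉ excl × (v , u) ∉ excl
partner {K} u vs excl len =
  v , (λ eq → v∉ (here eq)) , (λ v∈ → v∉ (there (∈-++⁺ˡ v∈))) ,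
    (λ uv∈ → v∉ (there (∈-++⁺ʳ vs (subst (_∈ map other excl) fst (∈-map⁺ other uv∈))))) ,
    (λ vu∈ → v∉ (there (∈-++⁺ʳ vs (subst (_∈ map other excl) snd (∈-map⁺ other vu∈)))))
  where
  other : Fin K × Fin K → Fin K
  other (p , r) with p ≟ u
  ... | yes _ = r
  ... | no _  = p
  len′ : length (u ∷ vs ++ map other excl) < K
  len′ = subst (λ k → suc k < K) (sym (trans (length-++ vs) (cong (length vs +_) (length-map other excl)))) len
  found = avoid (u ∷ vs ++ map other excl) len′
  v = proj₁ found
  v∉ = proj₂ found
  fst : other (u , v) ≡ v
  fst with u ≟ u
  ... | yes _ = refl
  ... | no ne = contradiction refl ne
  snd : other (v , u) ≡ v
  snd with v ≟ u
  ... | yes eq = contradiction (here eq) v∉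
  ... | no _   = refl

module Slots {K q : ℕ} (L : List (Fin K × Fin K)) (L≤q : length L ≤ q) where

  open Coding L L≤q public using (decode)
  open Coding L L≤q using (code; decode-∈)

  slot : Fin q → Fin K × Fin K → Fin q
  slot default p with p ∈²? L
  ... | yes p∈ = code p∈
  ... | no _   = default

  decode-slot : ∀ {δ p} → p ∈ L → decode (slot δ p) ≡ just p
  decode-slot {δ} {p} p∈ with p ∈²? L
  ... | yes p∈′ = decode-∈ p∈′
  ... | no p∉   = contradiction p∈ p∉

  slot-injective : ∀ {δ δ′ p p′} → p ∈ L → p′ ∈ L → slot δ p ≡ slot δ′ p′ → p ≡ p′
  slot-injective p∈ p∈′ eq = just-injective (trans (sym (decode-slot p∈)) (trans (cong decode eq) (decode-slot p∈′)))

record ColourGroups (K q : ℕ) (Need : Rel (Fin K) 0ℓ) : Set where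
  field
    own     : Fin q → Maybe (Fin K)
    γ β     : Fin K → Fin q
    own-γ   : ∀ u → own (γ u) ≡ just u
    own-β   : ∀ u → own (β u) ≡ just u
    β≢γ     : ∀ u → β u ≢ γ u
    col     : Fin K → Fin K → Fin q
    col-own : ∀ {u v} → Need u v → own (col u v) ≡ just u
    col-inj : ∀ {u v v′} → Need u v → Need u v′ → col u v ≡ col u v′ → v ≡ v′

  γ-injective : ∀ {u w} → γ u ≡ γ w → u ≡ w
  γ-injective {u} {w} eq = just-injective (trans (sym (own-γ u)) (trans (cong own eq) (own-γ w)))

-- `γ u` and `β u` cost nothing extra: they are the entries of `u` for two of its partners, and
-- `2 + e < K` leaves two partners after the exclusions. The second colour `β u` makes a Kempe
-- change possible that shows part `u` to be connected in its group.
colour-groups : ∀ {K q e} {excl : List (Fin K × Fin K)} {Need : Rel (Fin K) 0ℓ} → Fin q →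
                Exclusions e excl → 2 + e < K → length (demands excl) ≤ q →
                (∀ {u v} → Need u v → u ≢ v × (u , v) ∉ excl × (v , u) ∉ excl) → ColourGroups K q Need
colour-groups {K} {q} {e} {excl} {Need} α₀ ex e<K len need = record
  { own     = own
  ; γ       = λ u → slot α₀ (u , v₁ u)
  ; β       = λ u → slot α₀ (u , v₂ u)
  ; own-γ   = λ u → own-slot (v₁∈ u)
  ; own-β   = λ u → own-slot (v₂∈ u)
  ; β≢γ     = λ u eq → proj₁ (proj₂ (second u)) (here (cong proj₂ (slot-injective (v₂∈ u) (v₁∈ u) eq)))
  ; col     = λ u v → slot α₀ (u , v)
  ; col-own = λ nd → own-slot (dem nd)
  ; col-inj = λ nd nd′ eq → cong proj₂ (slot-injective (dem nd) (dem nd′) eq)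
  }
  where
  open Slots (demands excl) len
  own : Fin q → Maybe (Fin K)
  own α = Maybe.map proj₁ (decode α)
  own-slot : ∀ {δ p} → p ∈ demands excl → own (slot δ p) ≡ just (proj₁ p)
  own-slot p∈ = cong (Maybe.map proj₁) (decode-slot p∈)
  others : ∀ vs → length vs ≤ 1 → ∀ u → Σ[ v ∈ Fin K ] v ∉ vs × (u , v) ∈ demands excl
  others vs vs≤1 u
    with v , v≢u , v∉ , uv∉ , vu∉ ← partner u vs excl
           (≤-trans (s≤s (s≤s (+-mono-≤ vs≤1 (≤-reflexive (length-exclusions ex))))) e<K)
    = v , v∉ , ∈-demands excl (v≢u ∘ sym) uv∉ vu∉
  v₁ : Fin K → Fin K
  v₁ u = proj₁ (others [] z≤n u)
  v₁∈ : ∀ u → (u , v₁ u) ∈ demands excl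
  v₁∈ u = proj₂ (proj₂ (others [] z≤n u))
  second : ∀ u → Σ[ v ∈ Fin K ] v ∉ v₁ u ∷ [] × (u , v) ∈ demands excl
  second u = others (v₁ u ∷ []) ≤-refl u
  v₂ : Fin K → Fin K
  v₂ u = proj₁ (second u)
  v₂∈ : ∀ u → (u , v₂ u) ∈ demands excl
  v₂∈ u = proj₂ (proj₂ (second u))
  dem : ∀ {u v} → Need u v → (u , v) ∈ demands excl
  dem nd with u≢v , uv∉ , vu∉ ← need nd = ∈-demands excl u≢v uv∉ vu∉

-- The two sides of a separator

record Sides {n s : ℕ} (q : ℕ) (σ : Fin s → Fin n) (E E′ : Rel (Fin n) 0ℓ) : Set₁ where
  field
    E?        : Decidable E
    E-sym     : Symmetric E
    E′?       : Decidable E′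
    E′-sym    : Symmetric E′
    transfer  : Transfer q E E′ σ
    transfer′ : Transfer q E′ E σ
    separated : Separated q E E′ σ
    agree     : ∀ {i j} → E (σ i) (σ j) → E′ (σ i) (σ j)
    agree′    : ∀ {i j} → E′ (σ i) (σ j) → E (σ i) (σ j)

flip-kernel : ∀ {I A B : Set} {f : I → A} {g : I → B} → SameKernel f g → SameKernel g f
flip-kernel ker i j = proj₂ (ker i j) , proj₁ (ker i j)

flip-sides : ∀ {n s q} {σ : Fin s → Fin n} {E E′} → Sides q σ E E′ → Sides q σ E′ E
flip-sides S = record
  { E? = E′? ; E-sym = E′-sym ; E′? = E? ; E′-sym = E-sym ; transfer = transfer′ ; transfer′ = transfer
  ; separated = λ c c′ p p′ ker → separated c′ c p′ p (flip-kernel ker) ; agree = agree′ ; agree′ = agree }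
  where open Sides S

-- Pairs of parts that need no dedicated colours.
Excludable : ∀ {n s K} → Rel (Fin n) 0ℓ → (Fin s → Fin n) → (Fin s → Fin K) → List (Fin K × Fin K) → Set
Excludable E σ lab excl = ∀ {p r} → (p , r) ∈ excl → Hit lab p → Hit lab r → AdjParts E σ lab p r

-- An entry `(u , v)` below the diagonal is the colour of `u` for merging with `v`; the diagonal
-- entry of `v` is its receiving colour. Only the part of `a` and `b` has two vertices, so only
-- there is a second colour wanted for connecting it.
record StarDemands {n s} (q r : ℕ) (E : Rel (Fin n) 0ℓ) (σ : Fin s → Fin n) (a b : Fin s) : Set where
  field
    lab    : Fin s → Fin r
    lab-ab : lab a ≡ lab b
    kernel : ∀ {i j} → lab i ≡ lab j → i ≡ j ⊎ ((i ≡ a ⊎ i ≡ b) × (j ≡ a ⊎ j ≡ b))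
    dem    : List (Fin r × Fin r)
    dem≤q  : length dem ≤ q
    pair   : ∀ {u v} → v <ᶠ u → Needed E σ lab u v → (u , v) ∈ dem × (v , v) ∈ dem
    base   : ∀ u → Σ[ v ∈ Fin r ] (u , v) ∈ dem
    second : Σ[ v ∈ Fin r ] v ≢ proj₁ (base (lab a)) × (lab a , v) ∈ dem

adjParts-sym : ∀ {n s K} {E : Rel (Fin n) 0ℓ} {σ : Fin s → Fin n} {lab : Fin s → Fin K} →
               Symmetric E → Symmetric (AdjParts E σ lab)
adjParts-sym E-sym (i , j , l , l′ , e) = j , i , l′ , l , E-sym e

needed-≢ : ∀ {n s K} {E : Rel (Fin n) 0ℓ} {σ : Fin s → Fin n} {lab : Fin s → Fin K} {excl} →
           Symmetric E → Excludable E σ lab excl → ∀ {u v} → Needed E σ lab u v → (u , v) ∉ excl × (v , u) ∉ excl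
needed-≢ {E = E} {σ} {lab} E-sym exc (_ , hu , hv , ¬adj) =
  (λ uv∈ → ¬adj (exc uv∈ hu hv)) , (λ vu∈ → ¬adj (adjParts-sym {E = E} {σ} {lab} (λ {x} {y} → E-sym {x} {y}) (exc vu∈ hv hu)))

module _
  {n s q m e : ℕ} (s≤ : s ≤ 3 + m) (e<m : suc e < m)
  (demands≤ : length (offDiagonal (suc m)) ≤ e + (e + q))
  (σ : Fin s → Fin n)
  where

  length-demands-≤ : ∀ {excl} → Exclusions e excl → length (demands {suc m} excl) ≤ q
  length-demands-≤ ex = +-cancelˡ-≤ e _ _ (+-cancelˡ-≤ e _ _ (≤-trans (length-demands ex) demands≤))

  -- Two numbers of parts occur, `m + 1` for a finest colouring of a side and `m` before a class is
  -- split; the bound on `s` covers both.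
  Excluding : Rel (Fin n) 0ℓ → Set
  Excluding E = ∀ {K} (lab : Fin s → Fin K) → s ≤ 3 + K → (∀ i j → lab i ≡ lab j → ¬ E (σ i) (σ j)) →
    Σ[ excl ∈ List (Fin K × Fin K) ] Exclusions e excl × Excludable E σ lab excl

  Rigid : Rel (Fin n) 0ℓ → (Fin n → Fin q) → Set₁
  Rigid E c = ∀ {X : Fin q → Set} (X? : U.Decidable X) {i j β} → X (c (σ i)) → X β → β ≢ c (σ i) →
    (∀ k → X (c (σ k)) → c (σ k) ≡ c (σ i)) → c (σ i) ≡ c (σ j) → Star (Within E (X ∘ c)) (σ i) (σ j)

  finest⇒rigid : ∀ {E} → Decidable E → Symmetric E → ∀ {c} → Proper E c → Finest σ (Proper E) c → Rigid E c
  finest⇒rigid E? E-sym {c} c-proper fin X? {i} {j} Xi Xβ β≢ only eq = go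
    where
    open Split E? E-sym σ c-proper X? i Xi Xβ β≢ only
    go : T (σ j)
    go with T? (σ j)
    ... | yes t = t
    ... | no ¬t = contradiction (fin split split-proper (λ _ _ → refines) i j eq) (separates ε ¬t)

  module OneSide {E E′ : Rel (Fin n) 0ℓ} (S : Sides q σ E E′) (excluding : Excluding E) where

    open Sides S

    -- Renaming colours preserves finest colourings, so rigidity can be used after the colours have
    -- been distributed and yields the connectedness that `Full` requires.
    rigid-resolved : ∀ {K c₀} → Proper E c₀ → Finest σ (Proper E) c₀ → (lab : Fin s → Fin K) →
                     SameKernel lab (c₀ ∘ σ) → ColourGroups K q (Needed E σ lab) → ⊥
    rigid-resolved {K} {c₀} c₀-proper fin₀ lab ker G
      with π , π-inj , c-σ ← recolour σ c₀ lab (ColourGroups.γ G) ker (ColourGroups.γ-injective G)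
      = Full.resolved E? E-sym σ transfer separated lab own c-proper γ own-γ c-σ conn col col-own col-inj
      where
      open ColourGroups G
      c = π ∘ c₀
      c-proper : Proper E c
      c-proper e eq = c₀-proper e (π-inj eq)
      conn : ∀ i j → lab i ≡ lab j → Star (Within E (λ x → own (c x) ≡ just (lab i))) (σ i) (σ j)
      conn i j eq = finest⇒rigid E? E-sym c-proper (finest-rename σ {Proper E} {c₀} π-inj fin₀)
        (λ α → ≡-decᴹ _≟_ (own α) (just (lab i))) {β = β (lab i)}
        (trans (cong own (c-σ i)) (own-γ (lab i))) (own-β (lab i))
        (λ eq′ → β≢γ (lab i) (trans eq′ (c-σ i)))
        (λ k own-k → trans (c-σ k) (trans (cong γ (just-injective (trans (sym (own-γ (lab k))) (trans (cong own (sym (c-σ k))) own-k)))) (sym (c-σ i))))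
        (trans (c-σ i) (trans (cong γ eq) (sym (c-σ j))))

    no-coarse-finest : ∀ {c₀} → Proper E c₀ → Finest σ (Proper E) c₀ → (is : List (Fin s)) →
                       (∀ i → Any (λ k → c₀ (σ k) ≡ c₀ (σ i)) is) → length is ≤ suc m → ¬ Fin s
    no-coarse-finest {c₀} c₀-proper fin₀ is cover len i₀
      with lab , ker ← fit (c₀ ∘ σ) is cover len
      with excl , ex , exc ← excluding lab (≤-trans s≤ (s≤s (s≤s (s≤s (n≤1+n _)))))
             (λ i j eq e → c₀-proper e (proj₁ (ker i j) eq))
      = rigid-resolved c₀-proper fin₀ lab ker
          (colour-groups (c₀ (σ i₀)) ex (s≤s e<m) (length-demands-≤ ex) (λ nd → proj₁ nd , needed-≢ {E = E} {σ} {lab} E-sym exc nd))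

    SinglePair : (Fin n → Fin q) → Fin s → Fin s → Set
    SinglePair c a b = a ≢ b × c (σ a) ≡ c (σ b) ×
      (∀ {i j} → i ≢ j → c (σ i) ≡ c (σ j) → (i ≡ a ⊎ i ≡ b) × (j ≡ a ⊎ j ≡ b))

    finest-cases : ∀ {c} → Proper E c → Finest σ (Proper E) c →
                   (∀ {i j} → c (σ i) ≡ c (σ j) → i ≡ j) ⊎ (∃₂ (SinglePair c))
    finest-cases {c} c-proper fin with any? (λ a → any? λ b → ¬? (a ≟ b) ×-dec (c (σ a) ≟ c (σ b)))
    ... | no none = inj₁ λ {i} {j} eq → case i ≟ j of λ where
            (yes p) → p
            (no ne) → contradiction (i , j , ne , eq) none
    ... | yes (a , b , a≢b , ab) = inj₂ (a , b , a≢b , ab , λ i≢j eq → member i≢j eq , member (i≢j ∘ sym) (sym eq))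
      where
      -- Without `b` and `i` every class still has a vertex in the list, which is then too short for
      -- a finest colouring.
      third : ∀ {i j} → i ≢ a → i ≢ b → i ≢ j → c (σ i) ≡ c (σ j) → ⊥
      third {i} {j} i≢a i≢b i≢j eq = no-coarse-finest c-proper fin (remove _≟_ b is) cover
          (s≤s⁻¹ (≤-trans (length-remove _≟_ is (∈-remove _≟_ (∈-allFin b) (i≢b ∘ sym)))
            (s≤s⁻¹ (≤-trans (length-remove _≟_ (allFin s) (∈-allFin i)) (≤-trans (≤-reflexive (length-tabulate (λ k → k))) s≤))))) a
        where
        is = remove _≟_ i (allFin s)
        keep : ∀ {k l} → k ≢ i → k ≢ b → c (σ k) ≡ c (σ l) → Any (λ k → c (σ k) ≡ c (σ l)) (remove _≟_ b is)
        keep k≢i k≢b eq = lose (∈-remove _≟_ (∈-remove _≟_ (∈-allFin _) k≢i) k≢b) eq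
        cover : ∀ k → Any (λ l → c (σ l) ≡ c (σ k)) (remove _≟_ b is)
        cover k with k ≟ b | k ≟ i
        ... | yes refl | _ = keep (i≢a ∘ sym) a≢b ab
        ... | no k≢b | no k≢i = keep k≢i k≢b refl
        ... | no k≢b | yes refl with j ≟ b
        ...   | no j≢b = keep (i≢j ∘ sym) j≢b (sym eq)
        ...   | yes refl = keep (i≢a ∘ sym) a≢b (trans ab (sym eq))
      member : ∀ {i j} → i ≢ j → c (σ i) ≡ c (σ j) → i ≡ a ⊎ i ≡ b
      member {i} i≢j eq with i ≟ a | i ≟ b
      ... | yes p | _     = inj₁ p
      ... | no _  | yes p = inj₂ p
      ... | no p  | no p′ = ⊥-elim (third p p′ i≢j eq)

-- Splitting the class of the identified pair

-- Row `suc i` of the table `L` belongs to part `i`, whose colour is the entry in column `zero`. Row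
-- `zero` is a reserve for the piece that may split off the class of `a` and `b`.
module Second
  {n s q m : ℕ} {σ : Fin s → Fin n} {E E′ : Rel (Fin n) 0ℓ} (S : Sides q σ E E′) {a b : Fin s}
  (𝒞 : (Fin n → Fin q) → Set) (𝒞-proper : ∀ {c} → 𝒞 c → Proper E c) (𝒞-ab : ∀ {c} → 𝒞 c → c (σ a) ≡ c (σ b))
  (𝒞-closed : ∀ {c c′} → 𝒞 c → Proper E c′ → Refines σ c′ c → c′ (σ a) ≡ c′ (σ b) → 𝒞 c′)
  (c : Fin n → Fin q) (c∈ : 𝒞 c) (fin : Finest σ 𝒞 c) (lab : Fin s → Fin m)
  (L : List (Fin (suc m) × Fin (suc m))) (L≤q : length L ≤ q) (α₀ : Fin q)
  (up    : ∀ i → (suc i , zero) ∈ L)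
  (down  : ∀ i → (zero , suc i) ∈ L)
  (cross : ∀ {i j} → i ≢ j → (suc i , suc j) ∈ L ⊎ (Hit lab i → Hit lab j → AdjParts E σ lab i j))
  (other : ∀ i → Σ[ j ∈ Fin m ] j ≢ i × (suc i , suc j) ∈ L)
  (c-σ   : ∀ i → c (σ i) ≡ Slots.slot L L≤q α₀ (suc (lab i) , zero))
  where

  open Sides S
  open Slots L L≤q

  slot₀ : Fin (suc m) × Fin (suc m) → Fin q
  slot₀ = slot α₀

  γ : Fin m → Fin q
  γ i = slot₀ (suc i , zero)

  c₀ : Fin m
  c₀ = lab a

  c-proper : Proper E c
  c-proper = 𝒞-proper c∈

  γ-injective : ∀ {i j} → γ i ≡ γ j → i ≡ j
  γ-injective eq = suc-injective (cong proj₁ (slot-injective (up _) (up _) eq))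

  ab : c (σ a) ≡ c (σ b)
  ab = 𝒞-ab c∈

  lab-ab : lab b ≡ c₀
  lab-ab = γ-injective (trans (sym (c-σ b)) (trans (sym ab) (c-σ a)))

  module _ {X : Fin q → Set} (X? : U.Decidable X) {i β} (Xi : X (c (σ i))) (Xβ : X β) (β≢ : β ≢ c (σ i))
    (only : ∀ k → X (c (σ k)) → c (σ k) ≡ c (σ i)) where

    open Split E? E-sym σ c-proper X? i Xi Xβ β≢ only

    -- `c` is finest only within `𝒞`, where `a` and `b` share a colour. A piece containing neither
    -- of them could be split off without leaving `𝒞`.
    connected-to-ab : c (σ i) ≡ c (σ a) → T (σ a) ⊎ T (σ b)
    connected-to-ab ia with T? (σ a) | T? (σ b)
    ... | yes t | _     = inj₁ t
    ... | no _  | yes t = inj₂ t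
    ... | no ¬t | no ¬t′ = contradiction
      (fin split (𝒞-closed c∈ split-proper (λ _ _ → refines) (keeps ¬t ¬t′ ab)) (λ _ _ → refines) i a ia)
      (separates ε ¬t)

    connected : c (σ i) ≢ c (σ a) → ∀ {j} → c (σ i) ≡ c (σ j) → T (σ j)
    connected i≢a {j} ij with T? (σ j)
    ... | yes t = t
    ... | no ¬t = contradiction
      (fin split (𝒞-closed c∈ split-proper (λ _ _ → refines) (keeps (apart refl) (apart (sym ab)) ab)) (λ _ _ → refines) i j ij)
      (separates ε ¬t)
      where
      apart : ∀ {k} → c (σ k) ≡ c (σ a) → ¬ T (σ k)
      apart ka t = i≢a (trans (sym (only _ (T-X t))) ka)

  -- Until the split, the reserve row `zero` belongs to the class of `a` and `b`.
  class : Fin (suc m) → Fin m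
  class zero    = c₀
  class (suc i) = i

  own₁ : Fin q → Maybe (Fin m)
  own₁ α = Maybe.map (class ∘ proj₁) (decode α)

  own₁-slot : ∀ {p} → p ∈ L → own₁ (slot₀ p) ≡ just (class (proj₁ p))
  own₁-slot p∈ = cong (Maybe.map (class ∘ proj₁)) (decode-slot p∈)

  X₀ : Fin q → Set
  X₀ α = own₁ α ≡ just c₀

  X₀? : U.Decidable X₀
  X₀? α = ≡-decᴹ _≟_ (own₁ α) (just c₀)

  only₁ : ∀ i k → own₁ (c (σ k)) ≡ just (lab i) → c (σ k) ≡ c (σ i)
  only₁ i k eq = trans (c-σ k) (trans (cong γ (just-injective (trans (sym (own₁-slot (up (lab k)))) (trans (cong own₁ (sym (c-σ k))) eq)))) (sym (c-σ i)))

  own₁-σ : ∀ i → own₁ (c (σ i)) ≡ just (lab i)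
  own₁-σ i = trans (cong own₁ (c-σ i)) (own₁-slot (up (lab i)))

  β₁ : Fin m → Fin q
  β₁ i = slot₀ (suc i , suc (proj₁ (other i)))

  β₁-own : ∀ i → own₁ (β₁ i) ≡ just i
  β₁-own i = own₁-slot (proj₂ (proj₂ (other i)))

  β₁≢ : ∀ i j → β₁ i ≢ γ j
  β₁≢ i j eq with () ← cong proj₂ (slot-injective (proj₂ (proj₂ (other i))) (up j) eq)

  module Unsplit (a~b : Star (Within E (X₀ ∘ c)) (σ a) (σ b)) where

    to-a : ∀ k → lab k ≡ c₀ → Star (Within E (X₀ ∘ c)) (σ k) (σ a)
    to-a k k₀ = [ (λ t → t) , (λ t → t ◅◅ star-sym E-sym a~b) ]′
      (connected-to-ab X₀? (trans (own₁-σ k) (cong just k₀)) (β₁-own c₀)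
        (λ eq → β₁≢ c₀ (lab k) (trans eq (c-σ k))) (λ l eq → only₁ k l (trans eq (cong just (sym k₀))))
        (trans (c-σ k) (trans (cong γ k₀) (sym (c-σ a)))))

    conn : ∀ i j → lab i ≡ lab j → Star (Within E (λ x → own₁ (c x) ≡ just (lab i))) (σ i) (σ j)
    conn i j eq with lab i ≟ c₀
    ... | no ne = connected (λ α → ≡-decᴹ _≟_ (own₁ α) (just (lab i))) (own₁-σ i) (β₁-own (lab i))
            (λ eq′ → β₁≢ (lab i) (lab i) (trans eq′ (c-σ i))) (only₁ i)
            (λ eq′ → ne (γ-injective (trans (sym (c-σ i)) (trans eq′ (c-σ a)))))
            (trans (c-σ i) (trans (cong γ eq) (sym (c-σ j))))
    ... | yes i₀ = subst (λ u → Star (Within E (λ x → own₁ (c x) ≡ just u)) (σ i) (σ j)) (sym i₀)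
                     (to-a i i₀ ◅◅ star-sym E-sym (to-a j (trans (sym eq) i₀)))

    dem : ∀ {i j} → Needed E σ lab i j → (suc i , suc j) ∈ L
    dem (i≢j , hi , hj , ¬adj) with cross i≢j
    ... | inj₁ ∈L  = ∈L
    ... | inj₂ adj = contradiction (adj hi hj) ¬adj

    impossible : ⊥
    impossible = Full.resolved E? E-sym σ transfer separated lab own₁ c-proper γ (λ i → own₁-slot (up i)) c-σ conn
      (λ i j → slot₀ (suc i , suc j)) (λ nd → own₁-slot (dem nd))
      (λ nd nd′ eq → suc-injective (cong proj₂ (slot-injective (dem nd) (dem nd′) eq)))

  -- The class of a and b falls into the part T connected to b, which becomes part zero,
  -- and the rest, connected to a.  A class j excluded against this class is adjacent to
  -- one of the two parts, so the colour of (zero , suc j) is given to the other one.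
  module SplitClass (a≁b : ¬ Star (Within E (X₀ ∘ c)) (σ a) (σ b)) where

    γᵇ : Fin q
    γᵇ = slot₀ (zero , suc c₀)

    X₀-γᵇ : X₀ γᵇ
    X₀-γᵇ = own₁-slot (down c₀)

    γᵇ≢γ : ∀ j → γᵇ ≢ γ j
    γᵇ≢γ j eq with () ← cong proj₁ (slot-injective (down c₀) (up j) eq)

    c-b : c (σ b) ≡ γ c₀
    c-b = trans (sym ab) (c-σ a)

    open Split E? E-sym σ c-proper X₀? b (trans (own₁-σ b) (cong just lab-ab)) X₀-γᵇ
      (λ eq → γᵇ≢γ c₀ (trans eq c-b)) (λ k eq → only₁ b k (trans eq (cong just (sym lab-ab))))

    τ : Fin q → Fin q
    τ = transpose (c (σ b)) γᵇ

    T-lab : ∀ {k} → T (σ k) → lab k ≡ c₀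
    T-lab t = just-injective (trans (sym (own₁-σ _)) (T-X t))

    ¬T-a : ¬ T (σ a)
    ¬T-a t = a≁b (star-sym E-sym t)

    opaque

      lab₃ : Fin s → Fin (suc m)
      lab₃ k with T? (σ k)
      ... | yes _ = zero
      ... | no _  = suc (lab k)

      lab₃-in : ∀ {k} → T (σ k) → lab₃ k ≡ zero
      lab₃-in {k} t with T? (σ k)
      ... | yes _ = refl
      ... | no ¬t = contradiction t ¬t

      lab₃-out : ∀ {k} → ¬ T (σ k) → lab₃ k ≡ suc (lab k)
      lab₃-out {k} ¬t with T? (σ k)
      ... | yes t = contradiction t ¬t
      ... | no _  = refl

    lab₃-suc : ∀ {k i} → lab₃ k ≡ suc i → lab k ≡ i
    lab₃-suc {k} eq with T? (σ k)
    ... | yes t with () ← trans (sym (lab₃-in t)) eq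
    ... | no ¬t = suc-injective (trans (sym (lab₃-out ¬t)) eq)

    Shared : Fin m → Set
    Shared j = j ≢ c₀ × (suc c₀ , suc j) ∉ L × AdjParts E σ lab₃ zero (suc j)

    shared? : U.Decidable Shared
    shared? j = ¬? (j ≟ c₀) ×-dec ¬? ((suc c₀ , suc j) ∈²? L) ×-dec
      any? λ k → any? λ l → (lab₃ k ≟ zero) ×-dec (lab₃ l ≟ suc j) ×-dec E? (σ k) (σ l)

    opaque

      owner : Fin (suc m) × Fin (suc m) → Fin (suc m)
      owner (zero , zero)  = zero
      owner (zero , suc j) with shared? j
      ... | yes _ = suc c₀
      ... | no _  = zero
      owner (suc i , v)    = suc i

      owner-suc : ∀ i v → owner (suc i , v) ≡ suc i
      owner-suc i v = refl

      owner-shared : ∀ {j} → Shared j → owner (zero , suc j) ≡ suc c₀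
      owner-shared {j} sh with shared? j
      ... | yes _  = refl
      ... | no ¬sh = contradiction sh ¬sh

      owner-zero : ∀ {j} → ¬ Shared j → owner (zero , suc j) ≡ zero
      owner-zero {j} ¬sh with shared? j
      ... | yes sh = contradiction sh ¬sh
      ... | no _   = refl

      class-owner : ∀ p → class (owner p) ≡ class (proj₁ p)
      class-owner (zero , zero)  = refl
      class-owner (zero , suc j) with shared? j
      ... | yes _ = refl
      ... | no _  = refl
      class-owner (suc i , v)    = refl

    own₂ : Fin q → Maybe (Fin (suc m))
    own₂ α = Maybe.map owner (decode α)

    own₂? : ∀ u → U.Decidable (λ α → own₂ α ≡ just u)
    own₂? u α = ≡-decᴹ _≟_ (own₂ α) (just u)

    own₂-slot : ∀ {p} → p ∈ L → own₂ (slot₀ p) ≡ just (owner p)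
    own₂-slot p∈ = cong (Maybe.map owner) (decode-slot p∈)

    own₂⇒own₁ : ∀ {α u} → own₂ α ≡ just u → own₁ α ≡ just (class u)
    own₂⇒own₁ {α} eq with decode α
    own₂⇒own₁ {α} refl | just p = cong just (sym (class-owner p))

    own₂-γ : ∀ i → own₂ (γ i) ≡ just (suc i)
    own₂-γ i = trans (own₂-slot (up i)) (cong just (owner-suc i zero))

    own₂-γᵇ : own₂ γᵇ ≡ just zero
    own₂-γᵇ = trans (own₂-slot (down c₀)) (cong just (owner-zero λ (c₀≢ , _) → c₀≢ refl))

    own₂-β₁ : ∀ i → own₂ (β₁ i) ≡ just (suc i)
    own₂-β₁ i = trans (own₂-slot (proj₂ (proj₂ (other i)))) (cong just (owner-suc i _))

    -- The partner is chosen so that its pair with `c₀` is listed; hence this entry is not ceded and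
    -- remains with part `zero`.
    βᵇ : Fin q
    βᵇ = slot₀ (zero , suc (proj₁ (other c₀)))

    own₂-βᵇ : own₂ βᵇ ≡ just zero
    own₂-βᵇ = trans (own₂-slot (down _)) (cong just (owner-zero λ (_ , ∉L , _) → ∉L (proj₂ (proj₂ (other c₀)))))

    βᵇ≢γᵇ : βᵇ ≢ γᵇ
    βᵇ≢γᵇ eq = proj₁ (proj₂ (other c₀)) (suc-injective (cong proj₂ (slot-injective (down _) (down c₀) eq)))

    βᵇ≢γ : ∀ j → βᵇ ≢ γ j
    βᵇ≢γ j eq with () ← cong proj₁ (slot-injective (down _) (up j) eq)

    γ₃ : Fin (suc m) → Fin q
    γ₃ zero    = γᵇ
    γ₃ (suc i) = γ i

    own₂-γ₃ : ∀ u → own₂ (γ₃ u) ≡ just u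
    own₂-γ₃ zero    = own₂-γᵇ
    own₂-γ₃ (suc i) = own₂-γ i

    split-σ : ∀ k → split (σ k) ≡ γ₃ (lab₃ k)
    split-σ k with T? (σ k)
    ... | yes t = trans (split-β t) (cong γ₃ (sym (lab₃-in t)))
    ... | no ¬t = trans (split-out ¬t) (trans (c-σ k) (cong γ₃ (sym (lab₃-out ¬t))))

    X₀-τ : ∀ {α} → X₀ (τ α) → X₀ α
    X₀-τ {α} p with X₀? α
    ... | yes p′ = p′
    ... | no ¬p  = contradiction (subst X₀ (transpose-else (c (σ b)) γᵇ
                     (λ eq → ¬p (subst X₀ (sym eq) (T-X ε))) (λ eq → ¬p (subst X₀ (sym eq) X₀-γᵇ))) p) ¬p

    private
      γ-b : ∀ {j} → γ j ≡ c (σ b) → j ≡ c₀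
      γ-b eq = γ-injective (trans eq c-b)

      τ-c₀ : ∀ k → lab k ≡ c₀ → τ (c (σ k)) ≡ γᵇ
      τ-c₀ k k₀ = trans (cong τ (trans (c-σ k) (trans (cong γ k₀) (sym c-b)))) (transpose-fst (c (σ b)) γᵇ)

    -- Connectedness is known for `c`, and inside `T` the change applies `τ`. The walk therefore
    -- uses the colours that `τ` sends to part `zero`; if it led to `a`, then `a` would lie in `T`.
    to-b : ∀ k → T (σ k) → Star (Within E (λ x → own₂ (split x) ≡ just zero)) (σ k) (σ b)
    to-b k t = [ (λ p → contradiction (t ◅◅ star-mono (λ eq → X₀-τ (own₂⇒own₁ eq)) p) ¬T-a) , back ]′
      (connected-to-ab {X = X′} (λ α → own₂? zero (τ α)) {k} {βᵇ}
        (trans (cong own₂ (τ-c₀ k (T-lab t))) own₂-γᵇ)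
        (trans (cong own₂ (transpose-else (c (σ b)) γᵇ (λ eq → βᵇ≢γ c₀ (trans eq c-b)) βᵇ≢γᵇ)) own₂-βᵇ)
        (λ eq → βᵇ≢γ (lab k) (trans eq (c-σ k)))
        only-c₀
        (trans (c-σ k) (trans (cong γ (T-lab t)) (sym (c-σ a)))))
      where
      X′ : Fin q → Set
      X′ α = own₂ (τ α) ≡ just zero
      only-c₀ : ∀ l → own₂ (τ (c (σ l))) ≡ just zero → c (σ l) ≡ c (σ k)
      only-c₀ l eq with lab l ≟ c₀
      ... | yes l₀ = trans (c-σ l) (trans (cong γ (trans l₀ (sym (T-lab t)))) (sym (c-σ k)))
      ... | no l≢  with () ← trans (sym eq) (trans (cong own₂ (trans (cong τ (c-σ l))
                     (transpose-else (c (σ b)) γᵇ (l≢ ∘ γ-b) (λ eq′ → γᵇ≢γ (lab l) (sym eq′))))) (own₂-γ (lab l)))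
      back : Star (Within E (X′ ∘ c)) (σ k) (σ b) → Star (Within E (λ x → own₂ (split x) ≡ just zero)) (σ k) (σ b)
      back p = star-mono (λ (eq , tx) → trans (cong own₂ (split-in tx)) eq)
                 (star-upgrade (λ tx (_ , pz , e) → T-step tx e (X₀-τ (own₂⇒own₁ pz))) t p)

    -- Off `T` nothing has changed, and a walk to `b` would put `k` into `T`.
    to-a : ∀ k → ¬ T (σ k) → lab k ≡ c₀ → Star (Within E (λ x → own₂ (split x) ≡ just (suc c₀))) (σ k) (σ a)
    to-a k ¬t k₀ = [ back , (λ p → contradiction (star-sym E-sym (star-mono own₂⇒own₁ p)) ¬t) ]′
      (connected-to-ab (own₂? (suc c₀)) {k} {β₁ c₀}
        (trans (cong own₂ (trans (c-σ k) (cong γ k₀))) (own₂-γ c₀)) (own₂-β₁ c₀)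
        (λ eq → β₁≢ c₀ (lab k) (trans eq (c-σ k)))
        (λ l eq → only₁ k l (trans (own₂⇒own₁ eq) (cong just (sym k₀))))
        (trans (c-σ k) (trans (cong γ k₀) (sym (c-σ a)))))
      where
      back : Star (Within E (λ x → own₂ (c x) ≡ just (suc c₀))) (σ k) (σ a) →
             Star (Within E (λ x → own₂ (split x) ≡ just (suc c₀))) (σ k) (σ a)
      back p = star-mono (λ (eq , ¬tx) → trans (cong own₂ (split-out ¬tx)) eq)
                 (star-upgrade (λ ¬tx (px , _ , e) tz → ¬tx (T-step tz (E-sym e) (own₂⇒own₁ px))) ¬t p)

    far : ∀ i j → lab i ≡ lab j → lab i ≢ c₀ → Star (Within E (λ x → own₂ (split x) ≡ just (suc (lab i)))) (σ i) (σ j)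
    far i j eq i≢ = star-mono (λ (own≡ , ¬tx) → trans (cong own₂ (split-out ¬tx)) own≡)
      (star-upgrade (λ _ (_ , pz , _) tz → i≢ (just-injective (trans (sym (own₂⇒own₁ pz)) (T-X tz)))) (i≢ ∘ T-lab)
        (connected (own₂? (suc (lab i))) {i} {β₁ (lab i)}
          (trans (cong own₂ (c-σ i)) (own₂-γ (lab i))) (own₂-β₁ (lab i))
          (λ eq′ → β₁≢ (lab i) (lab i) (trans eq′ (c-σ i)))
          (λ l own≡ → only₁ i l (own₂⇒own₁ own≡))
          (λ eq′ → i≢ (γ-injective (trans (sym (c-σ i)) (trans eq′ (c-σ a)))))
          (trans (c-σ i) (trans (cong γ eq) (sym (c-σ j))))))

    Conn : Fin (suc m) → Fin s → Fin s → Set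
    Conn u i j = Star (Within E (λ x → own₂ (split x) ≡ just u)) (σ i) (σ j)

    conn : ∀ i j → lab₃ i ≡ lab₃ j → Conn (lab₃ i) i j
    conn i j eq = by-side (T? (σ i)) (T? (σ j))
      where
      by-class : Dec (lab i ≡ c₀) → lab i ≡ lab j → ¬ T (σ i) → ¬ T (σ j) → Conn (suc (lab i)) i j
      by-class (no i≢)  ij ¬t ¬t′ = far i j ij i≢
      by-class (yes i₀) ij ¬t ¬t′ = subst (λ u → Conn (suc u) i j) (sym i₀)
        (to-a i ¬t i₀ ◅◅ star-sym E-sym (to-a j ¬t′ (trans (sym ij) i₀)))
      by-side : Dec (T (σ i)) → Dec (T (σ j)) → Conn (lab₃ i) i j
      by-side (yes t) (yes t′) = subst (λ u → Conn u i j) (sym (lab₃-in t)) (to-b i t ◅◅ star-sym E-sym (to-b j t′))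
      by-side (yes t) (no ¬t)  = contradiction (trans (sym (lab₃-in t)) (trans eq (lab₃-out ¬t))) λ ()
      by-side (no ¬t) (yes t)  = contradiction (trans (sym (lab₃-in t)) (trans (sym eq) (lab₃-out ¬t))) λ ()
      by-side (no ¬t) (no ¬t′) = subst (λ u → Conn u i j) (sym (lab₃-out ¬t))
        (by-class (lab i ≟ c₀) (suc-injective (trans (sym (lab₃-out ¬t)) (trans eq (lab₃-out ¬t′)))) ¬t ¬t′)

    -- `give` uses the entry ceded by part `zero`. By `take`, a part adjacent to `zero` spends its
    -- entry for `zero` on the other piece, as it never has to merge with `zero`.
    data Demand : (u v : Fin (suc m)) → Fin (suc m) × Fin (suc m) → Set where
      direct : ∀ {u v} → Demand u v (u , v)
      give   : ∀ {j} → Demand (suc c₀) (suc j) (zero , suc j)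
      take   : ∀ {i} → AdjParts E σ lab₃ (suc i) zero → Demand (suc i) (suc c₀) (suc i , zero)

    demand : ∀ {u v} → Needed E σ lab₃ u v → Σ[ p ∈ Fin (suc m) × Fin (suc m) ] p ∈ L × owner p ≡ u × Demand u v p
    demand {zero}  {zero}  (u≢v , _) = contradiction refl u≢v
    demand {zero}  {suc j} (_ , _ , _ , ¬adj) = _ , down j , owner-zero (λ (_ , _ , adj) → ¬adj adj) , direct
    demand {suc i} {zero}  _ = _ , up i , owner-suc i zero , direct
    demand {suc i} {suc j} (u≢v , (k , k≡) , (l , l≡) , ¬adj) = listed ((suc i , suc j) ∈²? L)
      where
      Goal : Set
      Goal = Σ[ p ∈ Fin (suc m) × Fin (suc m) ] p ∈ L × owner p ≡ suc i × Demand (suc i) (suc j) p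
      by-side : (suc i , suc j) ∉ L → ∀ {x z} → lab x ≡ i → lab z ≡ j → E (σ x) (σ z) → Dec (T (σ x)) → Dec (T (σ z)) → Goal
      by-side ∉L {x} {z} x≡ z≡ e (no ¬t) (no ¬t′) =
        contradiction (x , z , trans (lab₃-out ¬t) (cong suc x≡) , trans (lab₃-out ¬t′) (cong suc z≡) , e) ¬adj
      by-side ∉L x≡ z≡ e (yes t) (yes t′) =
        contradiction (cong suc (trans (sym x≡) (trans (T-lab t) (trans (sym (T-lab t′)) z≡)))) u≢v
      by-side ∉L {x} {z} x≡ z≡ e (yes t) (no ¬t′) with refl ← trans (sym x≡) (T-lab t) =
        _ , down j , owner-shared ((λ j≡ → u≢v (cong suc (sym j≡))) , ∉L , x , z , lab₃-in t , trans (lab₃-out ¬t′) (cong suc z≡) , e) , give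
      by-side ∉L {x} {z} x≡ z≡ e (no ¬t) (yes t′) with refl ← trans (sym z≡) (T-lab t′) =
        _ , up i , owner-suc i zero , take (x , z , trans (lab₃-out ¬t) (cong suc x≡) , lab₃-in t′ , e)
      listed : Dec ((suc i , suc j) ∈ L) → Goal
      listed (yes ∈L) = _ , ∈L , owner-suc i (suc j) , direct
      listed (no ∉L)  = excluded (cross {i} {j} (u≢v ∘ cong suc))
        where
        excluded : (suc i , suc j) ∈ L ⊎ (Hit lab i → Hit lab j → AdjParts E σ lab i j) → Goal
        excluded (inj₁ ∈L)  = contradiction ∈L ∉L
        excluded (inj₂ adj) = let x , z , x≡ , z≡ , e = adj (k , lab₃-suc k≡) (l , lab₃-suc l≡) in
          by-side ∉L x≡ z≡ e (T? (σ x)) (T? (σ z))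

    needed? : Decidable (Needed E σ lab₃)
    needed? u v = ¬? (u ≟ v) ×-dec hit? lab₃ u ×-dec hit? lab₃ v ×-dec
      ¬? (any? λ i → any? λ j → (lab₃ i ≟ u) ×-dec (lab₃ j ≟ v) ×-dec E? (σ i) (σ j))

    -- The only conceivable clash is between a direct demand towards `zero` and `take`; the former
    -- requires nonadjacency to `zero`, the latter adjacency.
    demand-injective : ∀ {u v v′ p} → Needed E σ lab₃ u v → Needed E σ lab₃ u v′ → Demand u v p → Demand u v′ p → v ≡ v′
    demand-injective _ _ direct direct = refl
    demand-injective _ _ give give = refl
    demand-injective _ _ (take _) (take _) = refl
    demand-injective (_ , _ , _ , ¬adj) _ direct (take adj) = contradiction adj ¬adj
    demand-injective _ (_ , _ , _ , ¬adj) (take adj) direct = contradiction adj ¬adj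

    opaque

      col : Fin (suc m) → Fin (suc m) → Fin q
      col u v with needed? u v
      ... | yes nd = slot₀ (proj₁ (demand nd))
      ... | no _   = α₀

      col-demand : ∀ {u v} → Needed E σ lab₃ u v →
                   Σ[ p ∈ Fin (suc m) × Fin (suc m) ] p ∈ L × owner p ≡ u × Demand u v p × col u v ≡ slot₀ p
      col-demand {u} {v} nd with needed? u v
      ... | yes nd′ = let p , p∈ , p≡ , d = demand nd′ in p , p∈ , p≡ , d , refl
      ... | no ¬nd  = contradiction nd ¬nd

    col-own : ∀ {u v} → Needed E σ lab₃ u v → own₂ (col u v) ≡ just u
    col-own nd = let p , p∈ , p≡ , _ , eq = col-demand nd in
      trans (cong own₂ eq) (trans (own₂-slot p∈) (cong just p≡))

    col-inj : ∀ {u v v′} → Needed E σ lab₃ u v → Needed E σ lab₃ u v′ → col u v ≡ col u v′ → v ≡ v′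
    col-inj nd nd′ eq with p , p∈ , _ , d , ≡p ← col-demand nd | p′ , p∈′ , _ , d′ , ≡p′ ← col-demand nd′
      with refl ← slot-injective p∈ p∈′ (trans (sym ≡p) (trans eq ≡p′)) = demand-injective nd nd′ d d′

    impossible : ⊥
    impossible = Full.resolved E? E-sym σ transfer separated lab₃ own₂ split-proper γ₃ own₂-γ₃ split-σ conn col col-own col-inj

  impossible : ⊥
  impossible with star? (within? E? (X₀? ∘ c)) (σ a) (σ b)
  ... | yes a~b = Unsplit.impossible a~b
  ... | no a≁b  = SplitClass.impossible a≁b

module _
  {n s q m e : ℕ} (s≤ : s ≤ 3 + m) (e<m : suc e < m)
  (demands≤ : length (offDiagonal (suc m)) ≤ e + (e + q))
  {σ : Fin s → Fin n}
  where

  -- Omitting `b`, `j` and `k` keeps a vertex of every class, so at most `m` classes remain. The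
  -- table has `suc m` rows, and the exclusions are shifted past its reserve row.
  module Coarse {E E′ : Rel (Fin n) 0ℓ} (S : Sides q σ E E′) (excluding : Excluding s≤ e<m demands≤ σ E) {a b : Fin s} (a≢b : a ≢ b)
    (𝒞 : (Fin n → Fin q) → Set) (𝒞-proper : ∀ {c} → 𝒞 c → Proper E c) (𝒞-ab : ∀ {c} → 𝒞 c → c (σ a) ≡ c (σ b))
    (𝒞-closed : ∀ {c c′} → 𝒞 c → Proper E c′ → Refines σ c′ c → c′ (σ a) ≡ c′ (σ b) → 𝒞 c′)
    (c : Fin n → Fin q) (c∈ : 𝒞 c) (fin : Finest σ 𝒞 c)
    {i j k : Fin s} (i≢b : i ≢ b) (j≢b : j ≢ b) (k≢b : k ≢ b) (i≢j : i ≢ j) (i≢k : i ≢ k) (j≢k : j ≢ k)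
    (ij : c (σ i) ≡ c (σ j)) (ik : c (σ i) ≡ c (σ k))
    where

    open Sides S

    is₁ is₂ is₃ : List (Fin s)
    is₁ = remove _≟_ b (allFin s)
    is₂ = remove _≟_ j is₁
    is₃ = remove _≟_ k is₂

    length-is : length is₃ ≤ m
    length-is = s≤s⁻¹ (≤-trans (length-remove _≟_ is₂ (∈-remove _≟_ (∈-remove _≟_ (∈-allFin k) k≢b) (j≢k ∘ sym)))
      (s≤s⁻¹ (≤-trans (length-remove _≟_ is₁ (∈-remove _≟_ (∈-allFin j) j≢b))
        (s≤s⁻¹ (≤-trans (length-remove _≟_ (allFin s) (∈-allFin b)) (≤-trans (≤-reflexive (length-tabulate (λ x → x))) s≤))))))

    Covered : Fin s → Set
    Covered l = Any (λ x → c (σ x) ≡ c (σ l)) is₃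

    keep : ∀ {x l} → x ≢ b → x ≢ j → x ≢ k → c (σ x) ≡ c (σ l) → Covered l
    keep x≢b x≢j x≢k eq = lose (∈-remove _≟_ (∈-remove _≟_ (∈-remove _≟_ (∈-allFin _) x≢b) x≢j) x≢k) eq

    by-i : ∀ {l} → c (σ i) ≡ c (σ l) → Covered l
    by-i = keep i≢b i≢j i≢k

    cover-other : ∀ l {l′} → c (σ l) ≡ c (σ l′) → l ≢ b → Covered l′
    cover-other l eq l≢b with l ≟ j | l ≟ k
    ... | yes refl | _        = by-i (trans ij eq)
    ... | no _     | yes refl = by-i (trans ik eq)
    ... | no l≢j   | no l≢k   = keep l≢b l≢j l≢k eq

    cover : ∀ l → Covered l
    cover l with l ≟ b
    ... | yes refl = cover-other a (𝒞-ab c∈) a≢b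
    ... | no l≢b   = cover-other l refl l≢b

    impossible : ⊥
    impossible
      with lab , ker ← fit (c ∘ σ) is₃ cover length-is
      with excl , ex , exc ← excluding lab s≤ (λ i j eq e → 𝒞-proper c∈ e (proj₁ (ker i j) eq))
      = classes lab ker excl ex exc
      where
      classes : (lab : Fin s → Fin m) → SameKernel lab (c ∘ σ) → (excl : List (Fin m × Fin m)) →
                Exclusions e excl → Excludable E σ lab excl → ⊥
      classes lab ker excl ex exc =
        let π , π-inj , c-σ = recolour σ c lab (λ i → slot α₀ (suc i , zero)) ker
              (λ eq → suc-injective (cong proj₁ (slot-injective (up _) (up _) eq)))
        in Second.impossible S 𝒞 𝒞-proper 𝒞-ab 𝒞-closed (π ∘ c)
             (𝒞-closed c∈ (λ e eq → 𝒞-proper c∈ e (π-inj eq)) (λ _ _ → π-inj) (cong π (𝒞-ab c∈)))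
             (finest-rename σ {𝒞} {c} π-inj fin) lab L L≤q α₀ up down cross other c-σ
        where
        α₀ = c (σ a)
        excl⁺ = map (λ (u , v) → suc u , suc v) excl
        L = demands excl⁺
        L≤q : length L ≤ q
        L≤q = length-demands-≤ s≤ e<m demands≤ σ (exclusions-suc ex)
        open Slots L L≤q
        from-map : ∀ {i j} → (suc i , suc j) ∈ excl⁺ → (i , j) ∈ excl
        from-map p with _ , p∈ , refl ← ∈-map⁻ _ p = p∈
        no-zeroˡ : ∀ {v} → (zero , v) ∉ excl⁺
        no-zeroˡ p with ∈-map⁻ _ p
        ... | _ , _ , ()
        no-zeroʳ : ∀ {v} → (v , zero) ∉ excl⁺
        no-zeroʳ p with ∈-map⁻ _ p
        ... | _ , _ , ()
        up : ∀ i → (suc i , zero) ∈ L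
        up i = ∈-demands excl⁺ (λ ()) no-zeroʳ no-zeroˡ
        down : ∀ i → (zero , suc i) ∈ L
        down i = ∈-demands excl⁺ (λ ()) no-zeroˡ no-zeroʳ
        listed : ∀ {i j} → i ≢ j → (i , j) ∉ excl → (j , i) ∉ excl → (suc i , suc j) ∈ L
        listed i≢j ij∉ ji∉ = ∈-demands excl⁺ (i≢j ∘ suc-injective) (ij∉ ∘ from-map) (ji∉ ∘ from-map)
        cross : ∀ {i j} → i ≢ j → (suc i , suc j) ∈ L ⊎ (Hit lab i → Hit lab j → AdjParts E σ lab i j)
        cross {i} {j} i≢j with (i , j) ∈²? excl | (j , i) ∈²? excl
        ... | yes ij∈ | _       = inj₂ (exc ij∈)
        ... | no _    | yes ji∈ = inj₂ λ hi hj → adjParts-sym {E = E} {σ} {lab} E-sym (exc ji∈ hj hi)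
        ... | no ij∉  | no ji∉  = inj₁ (listed i≢j ij∉ ji∉)
        other : ∀ i → Σ[ j ∈ Fin m ] j ≢ i × (suc i , suc j) ∈ L
        other i with j , j≢i , _ , ij∉ , ji∉ ← partner i [] excl
                       (subst (λ k → suc k < m) (sym (length-exclusions ex)) e<m)
          = j , j≢i , listed (j≢i ∘ sym) ij∉ ji∉

  module Pair {E E′ : Rel (Fin n) 0ℓ} (S : Sides q σ E E′)
    (excluding′ : Excluding s≤ e<m demands≤ σ E′) {c₀ : Fin n → Fin q} {r : ℕ} {a b : Fin s}
    (c₀-proper : Proper E c₀) (fin₀ : Finest σ (Proper E) c₀) (a≢b : a ≢ b) (ab : c₀ (σ a) ≡ c₀ (σ b))
    (only-ab : ∀ {i j} → i ≢ j → c₀ (σ i) ≡ c₀ (σ j) → (i ≡ a ⊎ i ≡ b) × (j ≡ a ⊎ j ≡ b))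
    (D : StarDemands q r E σ a b) where

    open Sides S
    open StarDemands D
    open Slots dem dem≤q

    α₀ : Fin q
    α₀ = c₀ (σ a)

    own : Fin q → Maybe (Fin r)
    own α = Maybe.map proj₁ (decode α)

    own-slot : ∀ {p} → p ∈ dem → own (slot α₀ p) ≡ just (proj₁ p)
    own-slot p∈ = cong (Maybe.map proj₁) (decode-slot p∈)

    γ : Fin r → Fin q
    γ u = slot α₀ (u , proj₁ (base u))

    own-γ : ∀ u → own (γ u) ≡ just u
    own-γ u = own-slot (proj₂ (base u))

    γ-injective : ∀ {u w} → γ u ≡ γ w → u ≡ w
    γ-injective {u} {w} eq = just-injective (trans (sym (own-γ u)) (trans (cong own eq) (own-γ w)))

    same : ∀ {i} → i ≡ a ⊎ i ≡ b → c₀ (σ i) ≡ c₀ (σ a) × lab i ≡ lab a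
    same (inj₁ refl) = refl , refl
    same (inj₂ refl) = sym ab , sym lab-ab

    kernel-c₀ : SameKernel lab (c₀ ∘ σ)
    kernel-c₀ i j = (λ eq → forth (kernel eq)) , back
      where
      forth : i ≡ j ⊎ ((i ≡ a ⊎ i ≡ b) × (j ≡ a ⊎ j ≡ b)) → c₀ (σ i) ≡ c₀ (σ j)
      forth (inj₁ refl)      = refl
      forth (inj₂ (pi , pj)) = trans (proj₁ (same pi)) (sym (proj₁ (same pj)))
      back : c₀ (σ i) ≡ c₀ (σ j) → lab i ≡ lab j
      back eq with i ≟ j
      ... | yes refl = refl
      ... | no i≢j   = trans (proj₂ (same (proj₁ (only-ab i≢j eq)))) (sym (proj₂ (same (proj₂ (only-ab i≢j eq)))))

    renamed : Σ[ π ∈ (Fin q → Fin q) ] (∀ {x y} → π x ≡ π y → x ≡ y) × (∀ i → π (c₀ (σ i)) ≡ γ (lab i))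
    renamed = recolour σ c₀ lab γ kernel-c₀ γ-injective

    π = proj₁ renamed
    π-inj = proj₁ (proj₂ renamed)

    c : Fin n → Fin q
    c = π ∘ c₀

    c-σ : ∀ i → c (σ i) ≡ γ (lab i)
    c-σ = proj₂ (proj₂ renamed)

    c-proper : Proper E c
    c-proper e eq = c₀-proper e (π-inj eq)

    conn : ∀ i j → lab i ≡ lab j → Star (Within E (λ x → own (c x) ≡ just (lab i))) (σ i) (σ j)
    conn i j eq = go (kernel eq)
      where
      go : i ≡ j ⊎ ((i ≡ a ⊎ i ≡ b) × (j ≡ a ⊎ j ≡ b)) → Star (Within E (λ x → own (c x) ≡ just (lab i))) (σ i) (σ j)
      go (inj₁ refl) = ε
      go (inj₂ (pi , pj)) = subst (λ u → Star (Within E (λ x → own (c x) ≡ just u)) (σ i) (σ j)) (sym (proj₂ (same pi)))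
        (finest⇒rigid s≤ e<m demands≤ σ E? E-sym c-proper (finest-rename σ {Proper E} {c₀} π-inj fin₀)
          (λ α → ≡-decᴹ _≟_ (own α) (just (lab a))) {β = slot α₀ (lab a , proj₁ second)}
          (trans (cong own (c-σ i)) (trans (own-γ (lab i)) (cong just (proj₂ (same pi)))))
          (own-slot (proj₂ (proj₂ second)))
          (λ eq′ → proj₁ (proj₂ second) (cong proj₂ (slot-injective (proj₂ (proj₂ second)) (proj₂ (base (lab a)))
            (trans eq′ (trans (c-σ i) (cong γ (proj₂ (same pi))))))))
          (λ k own-k → trans (c-σ k) (trans (cong γ (trans (just-injective (trans (sym (own-γ (lab k))) (trans (cong own (sym (c-σ k))) own-k))) (sym (proj₂ (same pi))))) (sym (c-σ i))))
          (trans (c-σ i) (trans (cong γ eq) (sym (c-σ j)))))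

    module St = Stars E? E-sym σ transfer separated lab own c-proper γ own-γ c-σ conn

    d : Fin r → Fin r → Fin q
    d u v = slot α₀ (u , v)

    x : Fin r → Fin q
    x v = slot α₀ (v , v)

    d-own : ∀ {u v} → St.Pair u v → own (d u v) ≡ just u
    d-own (lt , nd) = own-slot (proj₁ (pair lt nd))

    x-own : ∀ {u v} → St.Pair u v → own (x v) ≡ just v
    x-own (lt , nd) = own-slot (proj₂ (pair lt nd))

    d-inj : ∀ {u v v′} → St.Pair u v → St.Pair u v′ → d u v ≡ d u v′ → v ≡ v′
    d-inj (lt , nd) (lt′ , nd′) eq = cong proj₂ (slot-injective (proj₁ (pair lt nd)) (proj₁ (pair lt′ nd′)) eq)

    d≢x : ∀ {u v w} → St.Pair u v → St.Pair w u → d u v ≢ x u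
    d≢x (lt , nd) (lt′ , nd′) eq = proj₁ nd (sym (cong proj₂ (slot-injective (proj₁ (pair lt nd)) (proj₂ (pair lt′ nd′)) eq)))

    -- The triple is guaranteed only for colourings that respect the bags. These are closed under
    -- refinements keeping `a` and `b` together, because all other parts are single vertices.
    𝒞 : (Fin n → Fin q) → Set
    𝒞 = St.Respects d x d-own x-own d-inj d≢x

    𝒞-ab : ∀ {c′} → 𝒞 c′ → c′ (σ a) ≡ c′ (σ b)
    𝒞-ab c′∈ = proj₁ (proj₂ c′∈) lab-ab

    𝒞-closed : ∀ {c′ c″} → 𝒞 c′ → Proper E′ c″ → Refines σ c″ c′ → c″ (σ a) ≡ c″ (σ b) → 𝒞 c″
    𝒞-closed {c′} {c″} (_ , _ , adj) c″-proper ref ab″ =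
      (λ {x} {y} → c″-proper {x} {y}) , (λ eq → constant (kernel eq)) , (λ e fi fj ne eq → adj e fi fj ne (ref _ _ eq))
      where
      on-ab : ∀ {i} → i ≡ a ⊎ i ≡ b → c″ (σ i) ≡ c″ (σ a)
      on-ab (inj₁ refl) = refl
      on-ab (inj₂ refl) = sym ab″
      constant : ∀ {i j} → i ≡ j ⊎ ((i ≡ a ⊎ i ≡ b) × (j ≡ a ⊎ j ≡ b)) → c″ (σ i) ≡ c″ (σ j)
      constant (inj₁ refl)      = refl
      constant (inj₂ (pi , pj)) = trans (on-ab pi) (sym (on-ab pj))

    impossible : ⊥
    impossible = finest σ 𝒞 (proj₂ (St.respecting d x d-own x-own d-inj d≢x)) λ c′ c′∈ fin →
      let i , j , k , i≢j , i≢k , j≢k , ij , ik = St.triple d x d-own x-own d-inj d≢x c′ c′∈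
      in Coarse.impossible (flip-sides S) excluding′ a≢b 𝒞 (λ { (p , _) {x} {y} → p {x} {y} }) 𝒞-ab 𝒞-closed c′ c′∈ fin
           (norm-≢b i) (norm-≢b j) (norm-≢b k)
           (λ eq → i≢j (trans (sym (norm-lab i)) (trans (cong lab eq) (norm-lab j))))
           (λ eq → i≢k (trans (sym (norm-lab i)) (trans (cong lab eq) (norm-lab k))))
           (λ eq → j≢k (trans (sym (norm-lab j)) (trans (cong lab eq) (norm-lab k))))
           (trans (norm-c c′∈ i) (trans ij (sym (norm-c c′∈ j))))
           (trans (norm-c c′∈ i) (trans ik (sym (norm-c c′∈ k))))
      where
      -- Replacing `b` by `a`, which lies in the same part, makes the three vertices avoid `b`.
      norm : Fin s → Fin s
      norm l with l ≟ b
      ... | yes _ = a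
      ... | no _  = l
      norm-≢b : ∀ l → norm l ≢ b
      norm-≢b l with l ≟ b
      ... | yes _  = a≢b
      ... | no l≢b = l≢b
      norm-lab : ∀ l → lab (norm l) ≡ lab l
      norm-lab l with l ≟ b
      ... | yes refl = lab-ab
      ... | no _     = refl
      norm-c : ∀ {c′} → 𝒞 c′ → ∀ l → c′ (σ (norm l)) ≡ c′ (σ l)
      norm-c c′∈ l = proj₁ (proj₂ c′∈) (norm-lab l)

module _
  {n s q m e : ℕ} (s≤ : s ≤ 3 + m) (e<m : suc e < m)
  (demands≤ : length (offDiagonal (suc m)) ≤ e + (e + q))
  {σ : Fin s → Fin n}
  where

  Starrable : Rel (Fin n) 0ℓ → Set
  Starrable E = ∀ {a b} → a ≢ b → ¬ E (σ a) (σ b) → Σ[ r ∈ ℕ ] StarDemands q r E σ a b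

  sides-impossible : ∀ {E E′ : Rel (Fin n) 0ℓ} → Sides q σ E E′ →
    Excluding s≤ e<m demands≤ σ E → Excluding s≤ e<m demands≤ σ E′ → Starrable E → Starrable E′ →
    Σ[ c ∈ (Fin n → Fin q) ] Proper E c → Σ[ c ∈ (Fin n → Fin q) ] Proper E′ c → ⊥
  sides-impossible {E} {E′} S exc exc′ star star′ (_ , p) (_ , p′) =
    finest σ (Proper E) p λ c c-proper fin → finest σ (Proper E′) p′ λ c′ c′-proper fin′ →
      compare c-proper fin c′-proper fin′
        (OneSide.finest-cases s≤ e<m demands≤ σ S exc c-proper fin)
        (OneSide.finest-cases s≤ e<m demands≤ σ (flip-sides S) exc′ c′-proper fin′)
    where
    open Sides S
    compare : ∀ {c c′} → Proper E c → Finest σ (Proper E) c → Proper E′ c′ → Finest σ (Proper E′) c′ →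
              (∀ {i j} → c (σ i) ≡ c (σ j) → i ≡ j) ⊎ ∃₂ (OneSide.SinglePair s≤ e<m demands≤ σ S exc c) →
              (∀ {i j} → c′ (σ i) ≡ c′ (σ j) → i ≡ j) ⊎ ∃₂ (OneSide.SinglePair s≤ e<m demands≤ σ (flip-sides S) exc′ c′) → ⊥
    compare {c} {c′} cp fin cp′ fin′ (inj₁ inj) (inj₁ inj′) =
      separated c c′ cp cp′ λ i j → (λ eq → cong (c′ ∘ σ) (inj eq)) , (λ eq → cong (c ∘ σ) (inj′ eq))
    compare cp fin cp′ fin′ (inj₂ (a , b , a≢b , ab , only)) _ =
      Pair.impossible s≤ e<m demands≤ S exc′ cp fin a≢b ab only (proj₂ (star a≢b (λ e → cp e ab)))
    compare cp fin cp′ fin′ _ (inj₂ (a , b , a≢b , ab , only)) =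
      Pair.impossible s≤ e<m demands≤ (flip-sides S) exc cp′ fin′ a≢b ab only (proj₂ (star′ a≢b (λ e → cp′ e ab)))

-- Excluded pairs and tables of receiving colours

no-exclusions : ∀ {n s q m} (s≤ : s ≤ 3 + m) (e<m : 1 < m) (demands≤ : length (offDiagonal (suc m)) ≤ q)
                {σ : Fin s → Fin n} {E : Rel (Fin n) 0ℓ} → Excluding {q = q} {e = 0} s≤ e<m demands≤ σ E
no-exclusions _ _ _ lab _ _ = [] , ∅ₑ , λ ()

EdgeAvoiding : ∀ {n s} → Rel (Fin n) 0ℓ → (Fin s → Fin n) → Set
EdgeAvoiding {s = s} E σ = ∀ (a b : Fin s) → Σ[ i ∈ Fin s ] Σ[ j ∈ Fin s ] i ≢ a × i ≢ b × j ≢ a × j ≢ b × E (σ i) (σ j)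

module _ {n s : ℕ} {E : Rel (Fin n) 0ℓ} {σ : Fin s → Fin n} (E-sym : Symmetric E) (avoiding : EdgeAvoiding E σ)
  {K : ℕ} (lab : Fin s → Fin K) (indep : ∀ i j → lab i ≡ lab j → ¬ E (σ i) (σ j)) where

  private
    Result : Set
    Result = Σ[ excl ∈ List (Fin K × Fin K) ] Exclusions 2 excl × Excludable E σ lab excl

  -- `Excludable` speaks of parts that are hit, so a missed part may be excluded against any other.
  from-missed : 4 ≤ K → ∀ u → ¬ Hit lab u → Result
  from-missed 4≤K u miss =
    let v , v∉ = avoid (u ∷ []) (≤-trans (s≤s (s≤s z≤n)) 4≤K)
        w , w∉ = avoid (u ∷ v ∷ []) (≤-trans (s≤s (s≤s (s≤s z≤n))) 4≤K)
    in (u , v) ∷ (u , w) ∷ [] ,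
       two (λ eq → v∉ (here (sym eq))) (λ eq → w∉ (here (sym eq)))
           (λ eq → w∉ (there (here (sym (cong proj₂ eq))))) (λ eq → w∉ (here (sym (cong proj₁ eq)))) ,
       λ { (here refl) hu _ → contradiction hu miss ; (there (here refl)) hu _ → contradiction hu miss }

  -- The part of `i` lies in `i`, `i′`. An edge avoiding these two vertices avoids the whole part
  -- and so joins a different pair of parts.
  from-small : ∀ {i j} → E (σ i) (σ j) → ∀ i′ → (∀ l → lab l ≡ lab i → l ≡ i ⊎ l ≡ i′) → Result
  from-small {i} {j} e i′ small =
    let k , l , k≢i , k≢i′ , l≢i , l≢i′ , e′ = avoiding i i′
        off : ∀ k → k ≢ i → k ≢ i′ → lab k ≢ lab i
        off k k≢i k≢i′ eq = case small k eq of λ { (inj₁ p) → k≢i p ; (inj₂ p) → k≢i′ p }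
    in (lab i , lab j) ∷ (lab k , lab l) ∷ [] ,
       two (λ eq → indep i j eq e) (λ eq → indep k l eq e′)
           (λ eq → off k k≢i k≢i′ (sym (cong proj₁ eq))) (λ eq → off l l≢i l≢i′ (sym (cong proj₁ eq))) ,
       λ { (here refl) _ _ → i , j , refl , refl , e ; (there (here refl)) _ _ → k , l , refl , refl , e′ }

  Small Large : Fin s → Set
  Small i = Σ[ i′ ∈ Fin s ] (∀ l → lab l ≡ lab i → l ≡ i ⊎ l ≡ i′)
  Large i = Σ[ k ∈ Fin s ] Σ[ l ∈ Fin s ] k ≢ i × l ≢ i × k ≢ l × lab k ≡ lab i × lab l ≡ lab i

  small? : ∀ i → Small i ⊎ Large i
  small? i with any? (λ k → ¬? (k ≟ i) ×-dec (lab k ≟ lab i))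
  ... | no none = inj₁ (i , λ l l≡ → case l ≟ i of λ { (yes p) → inj₁ p ; (no p) → contradiction (l , p , l≡) none })
  ... | yes (k , k≢i , k≡) with any? (λ l → ¬? (l ≟ i) ×-dec ¬? (l ≟ k) ×-dec (lab l ≟ lab i))
  ...   | yes (l , l≢i , l≢k , l≡) = inj₂ (k , l , k≢i , l≢i , l≢k ∘ sym , k≡ , l≡)
  ...   | no none = inj₁ (k , λ l l≡ → case l ≟ i of λ where
            (yes p) → inj₁ p
            (no p)  → case l ≟ k of λ where
              (yes p′) → inj₂ p′
              (no p′)  → contradiction (l , p , p′ , l≡) none)

  -- Two parts with three vertices each leave too few vertices to hit all the others.
  both-large : s ≤ 3 + K → (∀ u → Hit lab u) → ∀ {i i₁ i₂ j j₁ j₂} → E (σ i) (σ j) →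
    i₁ ≢ i × i₂ ≢ i × i₁ ≢ i₂ × lab i₁ ≡ lab i × lab i₂ ≡ lab i →
    j₁ ≢ j × j₂ ≢ j × j₁ ≢ j₂ × lab j₁ ≡ lab j × lab j₂ ≡ lab j → ⊥
  both-large s≤ hit {i} {i₁} {i₂} {j} {j₁} {j₂} e (i₁≢i , i₂≢i , i₁≢i₂ , i₁≡ , i₂≡) (j₁≢j , j₂≢j , j₁≢j₂ , j₁≡ , j₂≡) =
    let u , u∉ = avoid (map lab is) len ; x , x≡ = hit u in u∉ (subst (_∈ map lab is) x≡ (covered x))
    where
    apart : ∀ {x y} → lab x ≡ lab i → lab y ≡ lab j → x ≢ y
    apart x≡ y≡ refl = indep i j (trans (sym x≡) y≡) e
    is₁ = remove _≟_ i₁ (allFin s)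
    is₂ = remove _≟_ i₂ is₁
    is₃ = remove _≟_ j₁ is₂
    is = remove _≟_ j₂ is₃
    ∈₁ : ∀ {x} → x ≢ i₁ → x ∈ is₁
    ∈₁ = ∈-remove _≟_ (∈-allFin _)
    ∈₂ : ∀ {x} → x ≢ i₁ → x ≢ i₂ → x ∈ is₂
    ∈₂ a = ∈-remove _≟_ (∈₁ a)
    ∈₃ : ∀ {x} → x ≢ i₁ → x ≢ i₂ → x ≢ j₁ → x ∈ is₃
    ∈₃ a b = ∈-remove _≟_ (∈₂ a b)
    len : length (map lab is) < K
    len = ≤-trans (≤-reflexive (cong suc (length-map lab is)))
      (s≤s⁻¹ (s≤s⁻¹ (s≤s⁻¹
        (≤-trans (s≤s (s≤s (s≤s (length-remove _≟_ is₃ (∈₃ (apart i₁≡ j₂≡ ∘ sym) (apart i₂≡ j₂≡ ∘ sym) (j₁≢j₂ ∘ sym))))))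
        (≤-trans (s≤s (s≤s (length-remove _≟_ is₂ (∈₂ (apart i₁≡ j₁≡ ∘ sym) (apart i₂≡ j₁≡ ∘ sym)))))
        (≤-trans (s≤s (length-remove _≟_ is₁ (∈₁ (i₁≢i₂ ∘ sym))))
        (≤-trans (length-remove _≟_ (allFin s) (∈-allFin i₁))
        (≤-trans (≤-reflexive (length-tabulate (λ x → x))) s≤))))))))
    here-i : lab i ∈ map lab is
    here-i = ∈-map⁺ lab (∈-remove _≟_ (∈₃ (i₁≢i ∘ sym) (i₂≢i ∘ sym) (apart refl j₁≡)) (apart refl j₂≡))
    here-j : lab j ∈ map lab is
    here-j = ∈-map⁺ lab (∈-remove _≟_ (∈₃ (apart i₁≡ refl ∘ sym) (apart i₂≡ refl ∘ sym) (j₁≢j ∘ sym)) (j₂≢j ∘ sym))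
    covered : ∀ x → lab x ∈ map lab is
    covered x with x ≟ i₁ | x ≟ i₂ | x ≟ j₁ | x ≟ j₂
    ... | no a | no b | no c | no d = ∈-map⁺ lab (∈-remove _≟_ (∈₃ a b c) d)
    ... | yes refl | _ | _ | _ = subst (_∈ map lab is) (sym i₁≡) here-i
    ... | no _ | yes refl | _ | _ = subst (_∈ map lab is) (sym i₂≡) here-i
    ... | no _ | no _ | yes refl | _ = subst (_∈ map lab is) (sym j₁≡) here-j
    ... | no _ | no _ | no _ | yes refl = subst (_∈ map lab is) (sym j₂≡) here-j

  exclusions : s ≤ 3 + K → 4 ≤ K → Fin s → Result
  exclusions s≤ 4≤K a with any? (λ u → ¬? (hit? lab u))
  ... | yes (u , miss) = from-missed 4≤K u miss
  ... | no all-hit = let i , j , _ , _ , _ , _ , e = avoiding a a in sized e (small? i) (small? j)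
    where
    hit : ∀ u → Hit lab u
    hit u with hit? lab u
    ... | yes h = h
    ... | no ¬h = contradiction (u , ¬h) all-hit
    sized : ∀ {i j} → E (σ i) (σ j) → Small i ⊎ Large i → Small j ⊎ Large j → Result
    sized e (inj₁ (i′ , small)) _ = from-small e i′ small
    sized e (inj₂ _) (inj₁ (j′ , small)) = from-small (E-sym e) j′ small
    sized e (inj₂ (_ , _ , large)) (inj₂ (_ , _ , large′)) = ⊥-elim (both-large s≤ hit e large large′)

opaque

  -- The full table for `StarDemands`, with r (r + 1) / 2 entries: dedicated colours below the
  -- diagonal, receiving colours on it.
  lower : ∀ r → List (Fin r × Fin r)
  lower r = filter (λ (u , v) → v ≤ᶠ? u) (cartesianProduct (allFin r) (allFin r))

  ∈-lower : ∀ {r} {u v : Fin r} → v ≤ᶠ u → (u , v) ∈ lower r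
  ∈-lower {u = u} {v} = ∈-filter⁺ (λ (u , v) → v ≤ᶠ? u) (∈-cartesianProduct⁺ (∈-allFin u) (∈-allFin v))

  length-lower₅ : length (lower 5) ≡ 15
  length-lower₅ = refl

  length-lower₆ : length (lower 6) ≡ 21
  length-lower₆ = refl

  length-lower₇ : length (lower 7) ≡ 28
  length-lower₇ = refl

  length-lower₈ : length (lower 8) ≡ 36
  length-lower₈ = refl

module _ {s r : ℕ} (s≤ : s ≤ suc r) {a b : Fin s} (a≢b : a ≢ b) where

  Both : Fin s → Fin s → Set
  Both i j = (i ≡ a ⊎ i ≡ b) × (j ≡ a ⊎ j ≡ b)

  -- The order of the labels decides which part of a pair receives, so some labels must be
  -- prescribed. `fit` identifies `b` with `a`, and `align` then moves the listed vertices to the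
  -- labels wanted.
  merged-labels : (is : List (Fin s)) → b ∉ is → (t : Fin s → Fin r) →
    (∀ {i j} → i ∈ is → j ∈ is → t i ≡ t j → i ≡ j) →
    Σ[ lab ∈ (Fin s → Fin r) ] lab a ≡ lab b × (∀ {i j} → lab i ≡ lab j → i ≡ j ⊎ Both i j) × (∀ {i} → i ∈ is → lab i ≡ t i)
  merged-labels is b∉ t t-inj =
    let lab , ker = fit h (remove _≟_ b (allFin s)) cover len
        π , π-inj , ok = align lab t is
          (λ {i} {j} i∈ j∈ eq → cong t (off-b i∈ j∈ (proj₁ (ker i j) eq)))
          (λ {i} {j} i∈ j∈ eq → cong lab (t-inj i∈ j∈ eq))
    in π ∘ lab , cong π (proj₂ (ker a b) (trans h-a (sym h-b))) ,
       (λ {i} {j} eq → h-kernel (proj₁ (ker i j) (π-inj eq))) , ok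
    where
    h : Fin s → Fin s
    h l with l ≟ b
    ... | yes _ = a
    ... | no _  = l
    h-b : h b ≡ a
    h-b with b ≟ b
    ... | yes _ = refl
    ... | no ne = contradiction refl ne
    h-id : ∀ {l} → l ≢ b → h l ≡ l
    h-id {l} l≢b with l ≟ b
    ... | yes eq = contradiction eq l≢b
    ... | no _   = refl
    h-a : h a ≡ a
    h-a = h-id a≢b
    h-kernel : ∀ {i j} → h i ≡ h j → i ≡ j ⊎ Both i j
    h-kernel {i} {j} eq with i ≟ b | j ≟ b
    ... | yes refl | yes refl = inj₁ refl
    ... | yes refl | no _     = inj₂ (inj₂ refl , inj₁ (sym eq))
    ... | no _     | yes refl = inj₂ (inj₁ eq , inj₂ refl)
    ... | no _     | no _     = inj₁ eq
    off-b : ∀ {i j} → i ∈ is → j ∈ is → h i ≡ h j → i ≡ j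
    off-b i∈ j∈ eq = trans (sym (h-id (λ { refl → b∉ i∈ }))) (trans eq (h-id (λ { refl → b∉ j∈ })))
    cover : ∀ i → Any (λ k → h k ≡ h i) (remove _≟_ b (allFin s))
    cover i with i ≟ b
    ... | yes refl = lose (∈-remove _≟_ (∈-allFin a) a≢b) h-a
    ... | no i≢b   = lose (∈-remove _≟_ (∈-allFin i) i≢b) (h-id i≢b)
    len : length (remove _≟_ b (allFin s)) ≤ r
    len = s≤s⁻¹ (≤-trans (length-remove _≟_ (allFin s) (∈-allFin b)) (≤-trans (≤-reflexive (length-tabulate (λ x → x))) s≤))

-- The part of `a` and `b` gets the last label: its row then has an entry off the diagonal, which
-- serves as the second colour.
starrable : ∀ {n s q r} (s≤ : s ≤ 3 + r) → length (lower (2 + r)) ≤ q → {σ : Fin s → Fin n} {E : Rel (Fin n) 0ℓ} →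
            ∀ {a b} → a ≢ b → ¬ E (σ a) (σ b) → Σ[ r ∈ ℕ ] StarDemands q r E σ a b
starrable {s = s} {r = r} s≤ lower≤ {σ} {E} {a} {b} a≢b _ =
  let lab , ab , ker , ok = merged-labels s≤ a≢b (a ∷ []) (λ { (here eq) → a≢b (sym eq) }) (λ _ → top)
                              (λ { (here refl) (here refl) _ → refl })
  in 2 + r , record
    { lab = lab ; lab-ab = ab ; kernel = ker ; dem = lower (2 + r) ; dem≤q = lower≤
    ; pair = λ v<u _ → ∈-lower (<⇒≤ v<u) , ∈-lower ≤-refl
    ; base = λ u → u , ∈-lower ≤-refl
    ; second = zero , (λ eq → case trans eq (ok (here refl)) of λ ()) , ∈-lower z≤n }
  where
  top : Fin (2 + r)
  top = fromℕ (suc r)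

-- Seven vertices leave six parts and 16 colours.  Two adjacent parts are numbered last, so
-- that they need no colour for receiving, and two further adjacent pairs are left out.
module Seven {n q : ℕ} (16≤q : 16 ≤ q) {σ : Fin 7 → Fin n} {E : Rel (Fin n) 0ℓ} {a b : Fin 7}
  (lab : Fin 7 → Fin 6) (lab-ab : lab a ≡ lab b)
  (kernel : ∀ {i j} → lab i ≡ lab j → i ≡ j ⊎ ((i ≡ a ⊎ i ≡ b) × (j ≡ a ⊎ j ≡ b)))
  (lab-a : lab a ≡ 3F) {h l h′ l′ : Fin 6} (l<h : l <ᶠ h) (l′<h′ : l′ <ᶠ h′) (h≢5 : h ≢ 5F) (h′≢5 : h′ ≢ 5F)
  (distinct : (h , l) ≢ (h′ , l′))
  (adj : AdjParts E σ lab h l) (adj′ : AdjParts E σ lab h′ l′) (adj₅₄ : AdjParts E σ lab 5F 4F)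
  where

  d₁ d₂ d₃ d₄ dem : List (Fin 6 × Fin 6)
  d₁ = remove _≟²_ (5F , 4F) (lower 6)
  d₂ = remove _≟²_ (5F , 5F) d₁
  d₃ = remove _≟²_ (4F , 4F) d₂
  d₄ = remove _≟²_ (h , l) d₃
  dem = remove _≟²_ (h′ , l′) d₄

  ∈₃ : ∀ {u v} → v ≤ᶠ u → (u , v) ≢ (5F , 4F) → (u , v) ≢ (5F , 5F) → (u , v) ≢ (4F , 4F) → (u , v) ∈ d₃
  ∈₃ v≤u ≢₁ ≢₂ ≢₃ = ∈-remove _≟²_ (∈-remove _≟²_ (∈-remove _≟²_ (∈-lower v≤u) ≢₁) ≢₂) ≢₃

  below : ∀ {u v : Fin 6} → v <ᶠ u → ∀ {w} → (u , v) ≢ (w , w)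
  below v<u refl = <-irrefl refl v<u

  ∈-dem : ∀ {u v} → v ≤ᶠ u → (u , v) ≢ (5F , 4F) → (u , v) ≢ (5F , 5F) → (u , v) ≢ (4F , 4F) →
          (u , v) ≢ (h , l) → (u , v) ≢ (h′ , l′) → (u , v) ∈ dem
  ∈-dem v≤u ≢₁ ≢₂ ≢₃ ≢₄ ≢₅ = ∈-remove _≟²_ (∈-remove _≟²_ (∈₃ v≤u ≢₁ ≢₂ ≢₃) ≢₄) ≢₅

  length-dem : 5 + length dem ≤ 21
  length-dem = subst (5 + length dem ≤_) length-lower₆
    (≤-trans (s≤s (s≤s (s≤s (s≤s (length-remove _≟²_ d₄ (∈-remove _≟²_ (∈₃ (<⇒≤ l′<h′) (h′≢5 ∘ cong proj₁) (h′≢5 ∘ cong proj₁) (below l′<h′)) (distinct ∘ sym)))))))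
    (≤-trans (s≤s (s≤s (s≤s (length-remove _≟²_ d₃ (∈₃ (<⇒≤ l<h) (h≢5 ∘ cong proj₁) (h≢5 ∘ cong proj₁) (below l<h))))))
    (≤-trans (s≤s (s≤s (length-remove _≟²_ d₂ (∈-remove _≟²_ (∈-remove _≟²_ (∈-lower ≤-refl) λ ()) λ ()))))
    (≤-trans (s≤s (length-remove _≟²_ d₁ (∈-remove _≟²_ (∈-lower ≤-refl) λ ())))
             (length-remove _≟²_ (lower 6) (∈-lower (s≤s (s≤s (s≤s (s≤s z≤n))))))))))

  dem≤q : length dem ≤ q
  dem≤q = ≤-trans (s≤s⁻¹ (s≤s⁻¹ (s≤s⁻¹ (s≤s⁻¹ (s≤s⁻¹ length-dem))))) 16≤q

  ∈-below : ∀ {u v} → v <ᶠ u → v ≢ 4F → v ≢ l → v ≢ l′ → (u , v) ∈ dem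
  ∈-below v<u v≢4 v≢l v≢l′ = ∈-dem (<⇒≤ v<u) (v≢4 ∘ cong proj₂) (below v<u) (below v<u) (v≢l ∘ cong proj₂) (v≢l′ ∘ cong proj₂)

  ∈-diagonal : ∀ {u} → u ≢ 4F → u ≢ 5F → (u , u) ∈ dem
  ∈-diagonal u≢4 u≢5 = ∈-dem ≤-refl (u≢5 ∘ cong proj₁) (u≢5 ∘ cong proj₁) (u≢4 ∘ cong proj₁)
    (λ eq → below l<h (sym eq)) (λ eq → below l′<h′ (sym eq))

  small : ∀ {v : Fin 6} → v ≢ 3F → v ≢ 4F → v ≢ 5F → toℕ v < 3
  small {0F} _ _ _ = s≤s z≤n
  small {1F} _ _ _ = s≤s (s≤s z≤n)
  small {2F} _ _ _ = s≤s (s≤s (s≤s z≤n))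
  small {3F} ≢3 _ _ = contradiction refl ≢3
  small {4F} _ ≢4 _ = contradiction refl ≢4
  small {5F} _ _ ≢5 = contradiction refl ≢5

  -- At most two of the columns 0, 1 and 2 are `l` or `l′`. Another one gives entries in the rows 3,
  -- 4 and 5 that no removal has touched; rows 4 and 5 have lost their diagonal entries.
  low : Σ[ v ∈ Fin 6 ] toℕ v < 3 × v ≢ 4F × v ≢ l × v ≢ l′
  low = let v , v∉ = avoid (3F ∷ 4F ∷ 5F ∷ l ∷ l′ ∷ []) ≤-refl in
    v , small (λ eq → v∉ (here eq)) (λ eq → v∉ (there (here eq))) (λ eq → v∉ (there (there (here eq)))) ,
    (λ eq → v∉ (there (here eq))) , (λ eq → v∉ (there (there (there (here eq))))) , (λ eq → v∉ (there (there (there (there (here eq))))))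

  ∈-low : ∀ {u} → 3 ≤ toℕ u → (u , proj₁ low) ∈ dem
  ∈-low 3≤u = let v , v<3 , v≢4 , v≢l , v≢l′ = low in ∈-below (≤-trans v<3 3≤u) v≢4 v≢l v≢l′

  pair : ∀ {u v} → v <ᶠ u → Needed E σ lab u v → (u , v) ∈ dem × (v , v) ∈ dem
  pair {u} {v} v<u (_ , _ , _ , ¬adj) =
    ∈-dem (<⇒≤ v<u) (off adj₅₄) (below v<u) (below v<u) (off adj) (off adj′) , ∈-diagonal v≢4 (v≢5 v v<u)
    where
    off : ∀ {u′ v′} → AdjParts E σ lab u′ v′ → (u , v) ≢ (u′ , v′)
    off adj refl = ¬adj adj
    v≢5 : ∀ v → v <ᶠ u → v ≢ 5F
    v≢5 v lt refl = <⇒≱ (toℕ<n u) lt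
    -- Only part 5 lies above part 4, and the two are adjacent, so part 4 never receives.
    v≢4 : v ≢ 4F
    v≢4 v≡4 = ¬adj (subst₂ (AdjParts E σ lab) (sym (above u (subst (_<ᶠ u) v≡4 v<u))) (sym v≡4) adj₅₄)
      where
      above : ∀ u → 4 < toℕ u → u ≡ 5F
      above 5F _ = refl
      above 0F ()
      above 1F (s≤s ())
      above 2F (s≤s (s≤s ()))
      above 3F (s≤s (s≤s (s≤s ())))
      above 4F (s≤s (s≤s (s≤s (s≤s ()))))

  base : ∀ u → Σ[ v ∈ Fin 6 ] (u , v) ∈ dem
  base 0F = 0F , ∈-diagonal (λ ()) (λ ())
  base 1F = 1F , ∈-diagonal (λ ()) (λ ())
  base 2F = 2F , ∈-diagonal (λ ()) (λ ())
  base 3F = 3F , ∈-diagonal (λ ()) (λ ())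
  base 4F = proj₁ low , ∈-low (s≤s (s≤s (s≤s z≤n)))
  base 5F = proj₁ low , ∈-low (s≤s (s≤s (s≤s z≤n)))

  star-demands : StarDemands q 6 E σ a b
  star-demands = record
    { lab = lab ; lab-ab = lab-ab ; kernel = kernel ; dem = dem ; dem≤q = dem≤q ; pair = pair ; base = base
    ; second = subst (λ u → Σ[ v ∈ Fin 6 ] v ≢ proj₁ (base u) × (u , v) ∈ dem) (sym lab-a)
        (proj₁ low , (λ eq → <-irrefl (cong toℕ eq) (proj₁ (proj₂ low))) , ∈-low ≤-refl) }

module _ {n q : ℕ} (16≤q : 16 ≤ q) {σ : Fin 7 → Fin n} {E : Rel (Fin n) 0ℓ} (E-sym : Symmetric E)
  (E-irrefl : ∀ {x} → ¬ E x x) (avoiding : EdgeAvoiding E σ) {a b : Fin 7} (a≢b : a ≢ b) (¬ab : ¬ E (σ a) (σ b)) where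

  private
    AB : Fin 7 → Set
    AB i = i ≡ a ⊎ i ≡ b

    ab-nonadjacent : ∀ {i j} → AB i → AB j → ¬ E (σ i) (σ j)
    ab-nonadjacent (inj₁ refl) (inj₁ refl) e = E-irrefl e
    ab-nonadjacent (inj₁ refl) (inj₂ refl) e = ¬ab e
    ab-nonadjacent (inj₂ refl) (inj₁ refl) e = ¬ab (E-sym e)
    ab-nonadjacent (inj₂ refl) (inj₂ refl) e = E-irrefl e

  module Choose {x y : Fin 7} (x∉ : ¬ AB x) (y∉ : ¬ AB y) (xy : E (σ x) (σ y)) where

    x≢y : x ≢ y
    x≢y refl = E-irrefl xy

    opaque

      t : Fin 7 → Fin 6
      t l with l ≟ x | l ≟ y
      ... | yes _ | _     = 5F
      ... | no _  | yes _ = 4F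
      ... | no _  | no _  = 3F

      t-x : t x ≡ 5F
      t-x with x ≟ x
      ... | yes _ = refl
      ... | no ne = contradiction refl ne

      t-y : t y ≡ 4F
      t-y with y ≟ x | y ≟ y
      ... | yes eq | _      = contradiction (sym eq) x≢y
      ... | no _   | yes _  = refl
      ... | no _   | no ne  = contradiction refl ne

      t-a : t a ≡ 3F
      t-a with a ≟ x | a ≟ y
      ... | yes eq | _      = contradiction (inj₁ (sym eq)) x∉
      ... | no _   | yes eq = contradiction (inj₁ (sym eq)) y∉
      ... | no _   | no _   = refl

    is : List (Fin 7)
    is = x ∷ y ∷ a ∷ []

    b∉ : b ∉ is
    b∉ (here eq)                 = x∉ (inj₂ (sym eq))
    b∉ (there (here eq))         = y∉ (inj₂ (sym eq))
    b∉ (there (there (here eq))) = a≢b (sym eq)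

    t-injective : ∀ {i j} → i ∈ is → j ∈ is → t i ≡ t j → i ≡ j
    t-injective (here refl) (here refl) _ = refl
    t-injective (here refl) (there (here refl)) eq = contradiction (trans (sym t-x) (trans eq t-y)) λ ()
    t-injective (here refl) (there (there (here refl))) eq = contradiction (trans (sym t-x) (trans eq t-a)) λ ()
    t-injective (there (here refl)) (here refl) eq = contradiction (trans (sym t-x) (trans (sym eq) t-y)) λ ()
    t-injective (there (here refl)) (there (here refl)) _ = refl
    t-injective (there (here refl)) (there (there (here refl))) eq = contradiction (trans (sym t-y) (trans eq t-a)) λ ()
    t-injective (there (there (here refl))) (here refl) eq = contradiction (trans (sym t-x) (trans (sym eq) t-a)) λ ()
    t-injective (there (there (here refl))) (there (here refl)) eq = contradiction (trans (sym t-y) (trans (sym eq) t-a)) λ ()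
    t-injective (there (there (here refl))) (there (there (here refl))) _ = refl

    opaque

      labels : Σ[ lab ∈ (Fin 7 → Fin 6) ] lab a ≡ lab b ×
        (∀ {i j} → lab i ≡ lab j → i ≡ j ⊎ (AB i × AB j)) × (∀ {i} → i ∈ is → lab i ≡ t i)
      labels = merged-labels ≤-refl a≢b is b∉ t t-injective

    lab = proj₁ labels
    lab-ab = proj₁ (proj₂ labels)
    kernel = proj₁ (proj₂ (proj₂ labels))
    prescribed = proj₂ (proj₂ (proj₂ labels))

    lab-x : lab x ≡ 5F
    lab-x = trans (prescribed (here refl)) t-x

    lab-y : lab y ≡ 4F
    lab-y = trans (prescribed (there (here refl))) t-y

    lab-a : lab a ≡ 3F
    lab-a = trans (prescribed (there (there (here refl)))) t-a

    singleton : ∀ {i j} → ¬ AB i → lab j ≡ lab i → j ≡ i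
    singleton i∉ eq = case kernel eq of λ { (inj₁ p) → p ; (inj₂ (_ , pi)) → contradiction pi i∉ }

    ≢5 : ∀ {j} → j ≢ x → lab j ≢ 5F
    ≢5 j≢x eq = j≢x (singleton x∉ (trans eq (sym lab-x)))

    lab-≢ : ∀ {i j} → E (σ i) (σ j) → lab i ≢ lab j
    lab-≢ e eq = case kernel eq of λ { (inj₁ refl) → E-irrefl e ; (inj₂ (pi , pj)) → ab-nonadjacent pi pj e }

    Ordered : Fin 7 → Fin 7 → Set
    Ordered i j = Σ[ h ∈ Fin 6 ] Σ[ l ∈ Fin 6 ] l <ᶠ h × AdjParts E σ lab h l × ((h ≡ lab i × l ≡ lab j) ⊎ (h ≡ lab j × l ≡ lab i))

    ordered : ∀ {i j} → E (σ i) (σ j) → Ordered i j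
    ordered {i} {j} e with <-cmp (lab i) (lab j)
    ... | tri< lt _ _ = lab j , lab i , lt , (j , i , refl , refl , E-sym e) , inj₂ (refl , refl)
    ... | tri≈ _ eq _ = contradiction eq (lab-≢ e)
    ... | tri> _ _ gt = lab i , lab j , gt , (i , j , refl , refl , e) , inj₁ (refl , refl)

    -- `p` is a part by itself, hence an edge avoiding `p` joins a different pair of parts. Avoiding
    -- `x` keeps both pairs away from part 5.
    demands-from : ∀ {p p′ k k′} → ¬ AB p → p ≢ x → p′ ≢ x → E (σ p) (σ p′) → k ≢ x → k′ ≢ x → k ≢ p → k′ ≢ p → E (σ k) (σ k′) →
                   StarDemands q 6 E σ a b
    demands-from {p} {p′} {k} {k′} p∉ p≢x p′≢x pp′ k≢x k′≢x k≢p k′≢p kk′ =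
      let h , l , l<h , adj , hl = ordered pp′
          h′ , l′ , l′<h′ , adj′ , hl′ = ordered kk′
      in Seven.star-demands 16≤q lab lab-ab kernel lab-a l<h l′<h′ (top≢5 p≢x p′≢x hl) (top≢5 k≢x k′≢x hl′)
           (different hl hl′) adj adj′ (x , y , lab-x , lab-y , xy)
      where
      top≢5 : ∀ {i j h l} → i ≢ x → j ≢ x → (h ≡ lab i × l ≡ lab j) ⊎ (h ≡ lab j × l ≡ lab i) → h ≢ 5F
      top≢5 i≢x j≢x (inj₁ (refl , _)) = ≢5 i≢x
      top≢5 i≢x j≢x (inj₂ (refl , _)) = ≢5 j≢x
      different : ∀ {h l h′ l′} → (h ≡ lab p × l ≡ lab p′) ⊎ (h ≡ lab p′ × l ≡ lab p) →
                  (h′ ≡ lab k × l′ ≡ lab k′) ⊎ (h′ ≡ lab k′ × l′ ≡ lab k) → (h , l) ≢ (h′ , l′)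
      different (inj₁ (refl , refl)) (inj₁ (refl , refl)) eq = k≢p (singleton p∉ (sym (cong proj₁ eq)))
      different (inj₁ (refl , refl)) (inj₂ (refl , refl)) eq = k′≢p (singleton p∉ (sym (cong proj₁ eq)))
      different (inj₂ (refl , refl)) (inj₁ (refl , refl)) eq = k′≢p (singleton p∉ (sym (cong proj₂ eq)))
      different (inj₂ (refl , refl)) (inj₂ (refl , refl)) eq = k≢p (singleton p∉ (sym (cong proj₂ eq)))

    star-demands : StarDemands q 6 E σ a b
    star-demands = let p , p′ , p≢x , _ , p′≢x , _ , pp′ = avoiding x x in
      orient p≢x p′≢x pp′ ((p ≟ a) ⊎-dec (p ≟ b)) ((p′ ≟ a) ⊎-dec (p′ ≟ b))
      where
      -- Since `a` and `b` are not adjacent, one end of the edge lies outside them and is a part by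
      -- itself.
      orient : ∀ {p p′} → p ≢ x → p′ ≢ x → E (σ p) (σ p′) → Dec (AB p) → Dec (AB p′) → StarDemands q 6 E σ a b
      orient {p} p≢x p′≢x pp′ (no p∉) _ =
        let k , k′ , k≢x , k≢p , k′≢x , k′≢p , kk′ = avoiding x p in demands-from p∉ p≢x p′≢x pp′ k≢x k′≢x k≢p k′≢p kk′
      orient {p} {p′} p≢x p′≢x pp′ (yes _) (no p′∉) =
        let k , k′ , k≢x , k≢p , k′≢x , k′≢p , kk′ = avoiding x p′ in demands-from p′∉ p′≢x p≢x (E-sym pp′) k≢x k′≢x k≢p k′≢p kk′
      orient p≢x p′≢x pp′ (yes pp) (yes pp″) = contradiction pp′ (ab-nonadjacent pp pp″)

  starrable₇ : Σ[ r ∈ ℕ ] StarDemands q r E σ a b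
  starrable₇ = let x , y , x≢a , x≢b , y≢a , y≢b , xy = avoiding a b in
    6 , Choose.star-demands (λ { (inj₁ p) → x≢a p ; (inj₂ p) → x≢b p }) (λ { (inj₁ p) → y≢a p ; (inj₂ p) → y≢b p }) xy

-- Separators covered by two vertices

-- A canonical witness: by `least-cong` it depends on the predicate alone, so it can name a
-- component or represent a part.
least : ∀ {k} {P : Fin k → Set} → U.Decidable P → ∃ P → Fin k
least {suc k} P? (i , p) with P? zero
... | yes _ = zero
least {suc k} P? (zero  , p) | no ¬p = contradiction p ¬p
least {suc k} P? (suc i , p) | no _  = suc (least (P? ∘ suc) (i , p))

least-holds : ∀ {k} {P : Fin k → Set} (P? : U.Decidable P) (w : ∃ P) → P (least P? w)
least-holds {suc k} P? (i , p) with P? zero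
... | yes p₀ = p₀
least-holds {suc k} P? (zero  , p) | no ¬p = contradiction p ¬p
least-holds {suc k} P? (suc i , p) | no _  = least-holds (P? ∘ suc) (i , p)

least-cong : ∀ {k} {P Q : Fin k → Set} (P? : U.Decidable P) (Q? : U.Decidable Q) → (∀ {i} → P i → Q i) → (∀ {i} → Q i → P i) →
             (w : ∃ P) (w′ : ∃ Q) → least P? w ≡ least Q? w′
least-cong {suc k} P? Q? f g (i , p) (j , r) with P? zero | Q? zero
... | yes _ | yes _  = refl
... | yes p₀ | no ¬q = contradiction (f p₀) ¬q
... | no ¬p | yes q₀ = contradiction (g q₀) ¬p
least-cong {suc k} P? Q? f g (zero , p) _ | no ¬p | no _ = contradiction p ¬p
least-cong {suc k} P? Q? f g (suc i , p) (zero , r) | no _ | no ¬q = contradiction r ¬q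
least-cong {suc k} P? Q? f g (suc i , p) (suc j , r) | no _ | no _ = cong suc (least-cong (P? ∘ suc) (Q? ∘ suc) f g (i , p) (j , r))

-- `attached` lets each component of the interior reach every separator vertex; minimality of the
-- separator provides this even for a side with several components.
record Interior {n s : ℕ} (E : Rel (Fin n) 0ℓ) (σ : Fin s → Fin n) : Set₁ where
  field
    In       : Fin n → Set
    In?      : U.Decidable In
    some     : ∃ In
    outside  : ∀ i → ¬ In (σ i)
    ends     : ∀ {x z} → E x z → In x ⊎ (Σ[ i ∈ Fin s ] x ≡ σ i)
    attached : ∀ {x} → In x → ∀ i → Σ[ z ∈ Fin n ] Star (Within E In) x z × In z × E z (σ i)

Off : ∀ {s} (a b i : Fin s) → Set
Off a b i = i ≢ a × i ≢ b

data Role {s : ℕ} (a b i : Fin s) : Set where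
  is-D  : Off a b i → Role a b i
  is-ab : i ≡ a ⊎ i ≡ b → Role a b i

role : ∀ {s} (a b i : Fin s) → Role a b i
role a b i with i ≟ a | i ≟ b
... | yes p | _     = is-ab (inj₁ p)
... | no _  | yes p = is-ab (inj₂ p)
... | no p  | no p′ = is-D (p , p′)

-- The pattern leaves open only whether `a` and `b` agree, so exact colourings of the two sides
-- either match or differ just there.
IsExact : ∀ {n s q} → (Fin s → Fin n) → (a b : Fin s) → Rel (Fin n) 0ℓ → (Fin n → Fin q) → Set
IsExact σ a b E c = Proper E c × (∀ {i j} → Off a b i → Off a b j → c (σ i) ≡ c (σ j)) ×
  (∀ {i} → Off a b i → c (σ i) ≢ c (σ a)) × (∀ {i} → Off a b i → c (σ i) ≢ c (σ b))

exact-kernel : ∀ {n s q} {σ : Fin s → Fin n} {a b} {E E′ : Rel (Fin n) 0ℓ} {c c′ : Fin n → Fin q} →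
               IsExact σ a b E c → IsExact σ a b E′ c′ → (c (σ a) ≡ c (σ b) → c′ (σ a) ≡ c′ (σ b)) →
               (c′ (σ a) ≡ c′ (σ b) → c (σ a) ≡ c (σ b)) → SameKernel (c ∘ σ) (c′ ∘ σ)
exact-kernel {a = a} {b} {c = c} {c′} (_ , cD , ca , cb) (_ , cD′ , ca′ , cb′) to from i j with role a b i | role a b j
... | is-D di | is-D dj = (λ _ → cD′ di dj) , (λ _ → cD di dj)
... | is-D di | is-ab (inj₁ refl) = (λ eq → contradiction eq (ca di)) , (λ eq → contradiction eq (ca′ di))
... | is-D di | is-ab (inj₂ refl) = (λ eq → contradiction eq (cb di)) , (λ eq → contradiction eq (cb′ di))
... | is-ab (inj₁ refl) | is-D dj = (λ eq → contradiction (sym eq) (ca dj)) , (λ eq → contradiction (sym eq) (ca′ dj))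
... | is-ab (inj₂ refl) | is-D dj = (λ eq → contradiction (sym eq) (cb dj)) , (λ eq → contradiction (sym eq) (cb′ dj))
... | is-ab (inj₁ refl) | is-ab (inj₁ refl) = (λ _ → refl) , (λ _ → refl)
... | is-ab (inj₁ refl) | is-ab (inj₂ refl) = to , from
... | is-ab (inj₂ refl) | is-ab (inj₁ refl) = (λ eq → sym (to (sym eq))) , (λ eq → sym (from (sym eq)))
... | is-ab (inj₂ refl) | is-ab (inj₂ refl) = (λ _ → refl) , (λ _ → refl)

module Exact {n s q : ℕ} {E E′ : Rel (Fin n) 0ℓ} {σ : Fin s → Fin n} (σ-inj : ∀ {i j} → σ i ≡ σ j → i ≡ j)
  (E-sym : Symmetric E) (E-irrefl : ∀ {x} → ¬ E x x) (transfer : Transfer q E E′ σ) (I : Interior E σ) (a b : Fin s) where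

  open Interior I

  private
    D = Off a b

  -- Contracting the interior together with D makes D a colour class.
  exact : (∀ {i j} → D i → D j → ¬ E (σ i) (σ j)) → ∀ {d₀} → D d₀ → Σ[ c ∈ (Fin n → Fin q) ] IsExact σ a b E′ c
  exact indep {d₀} d₀∈ =
    let c , c-proper , c-lab , c-adj = transfer lab f f-σ f-conn (λ i j eq → lab-conn i j eq) nonadjacent in
    c , (λ {x} {z} → c-proper {x} {z}) , (λ di dj → c-lab (trans (lab-D di) (sym (lab-D dj)))) ,
    (λ di → let z , _ , In-z , e = attached (proj₂ some) a in c-adj e (trans (f-In In-z) (cong just (sym (lab-D di)))) (f-σ a)
              (λ eq → case trans (sym (lab-D di)) (trans eq lab-a) of λ ())) ,
    (λ di → let z , _ , In-z , e = attached (proj₂ some) b in c-adj e (trans (f-In In-z) (cong just (sym (lab-D di)))) (f-σ b)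
              (λ eq → lab-b (trans (sym eq) (lab-D di))))
    where
    lab : Fin s → Fin 3
    lab i with i ≟ a | i ≟ b
    ... | yes _ | _     = suc zero
    ... | no _  | yes _ = suc (suc zero)
    ... | no _  | no _  = zero
    lab-a : lab a ≡ suc zero
    lab-a with a ≟ a
    ... | yes _ = refl
    ... | no ne = contradiction refl ne
    -- A fixed label for `b` cannot be claimed, since `a` and `b` may coincide.
    lab-b : lab b ≢ zero
    lab-b eq with b ≟ a | b ≟ b
    lab-b () | yes _ | _
    lab-b () | no _ | yes _
    ... | no _ | no ne = ne refl
    lab-D : ∀ {i} → D i → lab i ≡ zero
    lab-D {i} (i≢a , i≢b) with i ≟ a | i ≟ b
    ... | yes p | _     = contradiction p i≢a
    ... | no _  | yes p = contradiction p i≢b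
    ... | no _  | no _  = refl
    lab-cases : ∀ i j → lab i ≡ lab j → i ≡ j ⊎ (D i × D j)
    lab-cases i j eq with i ≟ a | i ≟ b | j ≟ a | j ≟ b
    ... | yes p | _ | yes p′ | _ = inj₁ (trans p (sym p′))
    ... | no p | no p′ | no r | no r′ = inj₂ ((p , p′) , (r , r′))
    ... | no _ | yes p | no _ | yes p′ = inj₁ (trans p (sym p′))
    lab-cases i j () | yes _ | _ | no _ | yes _
    lab-cases i j () | yes _ | _ | no _ | no _
    lab-cases i j () | no _ | yes _ | yes _ | _
    lab-cases i j () | no _ | yes _ | no _ | no _
    lab-cases i j () | no _ | no _ | yes _ | _
    lab-cases i j () | no _ | no _ | no _ | yes _
    f : Fin n → Maybe (Fin 3)
    f x with any? (λ i → x ≟ σ i) | In? x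
    ... | yes (i , _) | _     = just (lab i)
    ... | no _        | yes _ = just zero
    ... | no _        | no _  = nothing
    f-σ : ∀ i → f (σ i) ≡ just (lab i)
    f-σ i with any? (λ j → σ i ≟ σ j)
    ... | yes (j , eq) = cong (just ∘ lab) (sym (σ-inj eq))
    ... | no none      = contradiction (i , refl) none
    f-In : ∀ {x} → In x → f x ≡ just zero
    f-In {x} p with any? (λ i → x ≟ σ i) | In? x
    ... | yes (i , refl) | _   = contradiction p (outside i)
    ... | no _ | yes _ = refl
    ... | no _ | no ¬p = contradiction p ¬p
    Bag : Fin 3 → Fin n → Set
    Bag u z = f z ≡ just u
    to-σ : ∀ {x i} → In x → D i → Star (Within E (Bag zero)) x (σ i)
    to-σ {i = i} p di = let z , path , In-z , e = attached p i in
      star-last {P = Bag zero} (star-mono f-In path) (f-In p) (trans (f-σ i) (cong just (lab-D di))) e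
    f-conn : ∀ {x u} → f x ≡ just u → Σ[ i ∈ Fin s ] lab i ≡ u × Star (Within E (Bag u)) (σ i) x
    f-conn {x} eq with any? (λ i → x ≟ σ i) | In? x
    f-conn {x} refl | yes (i , refl) | _ = i , refl , ε
    f-conn {x} refl | no _ | yes p = d₀ , lab-D d₀∈ , star-sym {P = Bag zero} E-sym (to-σ p d₀∈)
    lab-conn : ∀ i j → lab i ≡ lab j → Star (Within E (Bag (lab i))) (σ i) (σ j)
    lab-conn i j eq with lab-cases i j eq
    ... | inj₁ refl = ε
    ... | inj₂ (di , dj) = subst (λ u → Star (Within E (Bag u)) (σ i) (σ j)) (sym (lab-D di))
            (star-sym {P = Bag zero} E-sym (to-σ (proj₂ some) di) ◅◅ to-σ (proj₂ some) dj)
    nonadjacent : ∀ i j → lab i ≡ lab j → ¬ E (σ i) (σ j)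
    nonadjacent i j eq with lab-cases i j eq
    ... | inj₁ refl = E-irrefl
    ... | inj₂ (di , dj) = indep di dj

-- `a` and `b` turn out to be linked in two colours. This link is one bag; the components of the
-- remainder that meet `D` are the others. The resulting `c″` may give `D` several colours, but `c`
-- can follow it by Kempe changes in the remaining colours, whose chains from `D` stay inside the
-- bags.
module Clash {n s q : ℕ} {E E′ : Rel (Fin n) 0ℓ} {σ : Fin s → Fin n} (S : Sides q σ E E′)
  (σ-inj : ∀ {i j} → σ i ≡ σ j → i ≡ j) (E-irrefl : ∀ {x} → ¬ E x x) (I : Interior E σ) (room : 2 + s < q) (a b : Fin s)
  (indep : ∀ {i j} → Off a b i → Off a b j → ¬ E (σ i) (σ j)) {d₀ : Fin s} (d₀∈ : Off a b d₀)
  {c c′ : Fin n → Fin q} (c-exact : IsExact σ a b E c) (c′-exact : IsExact σ a b E′ c′)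
  (c-ab : c (σ a) ≡ c (σ b)) (c′-ab : c′ (σ a) ≢ c′ (σ b))
  where

  open Sides S
  open Interior I

  D : Fin s → Set
  D = Off a b

  c-proper = proj₁ c-exact
  c-D  = proj₁ (proj₂ c-exact)
  c-Da = proj₁ (proj₂ (proj₂ c-exact))

  D? : U.Decidable D
  D? i = ¬? (i ≟ a) ×-dec ¬? (i ≟ b)

  ζ δ η : Fin q
  ζ = c (σ a)
  δ = c (σ d₀)
  η = proj₁ (avoid (ζ ∷ δ ∷ []) (≤-trans (s≤s (s≤s (s≤s z≤n))) room))

  η≢ζ : η ≢ ζ
  η≢ζ eq = proj₂ (avoid (ζ ∷ δ ∷ []) _) (here eq)

  η≢δ : η ≢ δ
  η≢δ eq = proj₂ (avoid (ζ ∷ δ ∷ []) _) (there (here eq))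

  δ≢ζ : δ ≢ ζ
  δ≢ζ = c-Da d₀∈

  c-at-D : ∀ {i} → D i → c (σ i) ≡ δ
  c-at-D di = c-D di d₀∈

  c-at-ab : ∀ {i} → i ≡ a ⊎ i ≡ b → c (σ i) ≡ ζ
  c-at-ab (inj₁ refl) = refl
  c-at-ab (inj₂ refl) = sym c-ab

  X : Fin q → Set
  X α = α ≡ ζ ⊎ α ≡ η

  X? : U.Decidable X
  X? α = (α ≟ ζ) ⊎-dec (α ≟ η)

  δ∉X : ¬ X δ
  δ∉X (inj₁ p) = δ≢ζ p
  δ∉X (inj₂ p) = η≢δ (sym p)

  X-only : ∀ k → X (c (σ k)) → c (σ k) ≡ ζ
  X-only k Xk with role a b k
  ... | is-D dk  = contradiction (subst X (c-at-D dk) Xk) δ∉X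
  ... | is-ab pk = c-at-ab pk

  module Sp = Split E? E-sym σ c-proper X? a (inj₁ refl) (inj₂ refl) η≢ζ X-only
  open Sp using (T; T?; T-X; T-step)

  D∉T : ∀ {i} → D i → ¬ T (σ i)
  D∉T di t = δ∉X (subst X (c-at-D di) (T-X t))

  -- Otherwise a Kempe change separates a from b and produces the pattern of c′.
  b∈T : T (σ b)
  b∈T with T? (σ b)
  ... | yes t = t
  ... | no ¬t = ⊥-elim (separated Sp.split c′ Sp.split-proper (proj₁ c′-exact) (exact-kernel split-exact c′-exact
            (λ eq → contradiction eq (Sp.separates ε ¬t)) (λ eq → contradiction eq c′-ab)))
    where
    split-exact : IsExact σ a b E Sp.split
    split-exact = (λ {x} {z} → Sp.split-proper {x} {z}) , (λ di dj → Sp.keeps (D∉T di) (D∉T dj) (c-D di dj)) ,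
      (λ di eq → c-Da di (Sp.refines eq)) , (λ di eq → c-Da di (trans (Sp.refines eq) (sym c-ab)))

  W : Fin n → Set
  W x = (In x ⊎ (Σ[ d ∈ Fin s ] D d × x ≡ σ d)) × ¬ T x

  opaque
    W? : U.Decidable W
    W? x = (In? x ⊎-dec any? λ d → D? d ×-dec (x ≟ σ d)) ×-dec ¬? (T? x)

  Near : Fin n → Fin s → Set
  Near x d = D d × W x × Star (Within E W) x (σ d)

  opaque
    near? : ∀ x → U.Decidable (Near x)
    near? x d = D? d ×-dec W? x ×-dec star? (within? E? W?) x (σ d)

  W-σ : ∀ {d} → D d → W (σ d)
  W-σ {d} dd = inj₂ (d , dd , refl) , D∉T dd

  near-σ : ∀ {d} → D d → Near (σ d) d
  near-σ dd = dd , W-σ dd , ε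

  near-along : ∀ {x z d} → Star (Within E W) x z → W x → Near z d → Near x d
  near-along p wx (dd , _ , q) = dd , wx , p ◅◅ q

  near-eq : ∀ {x z} (w : ∃ (Near x)) (w′ : ∃ (Near z)) → Star (Within E W) x z → least (near? x) w ≡ least (near? z) w′
  near-eq {x} {z} w w′ p = least-cong (near? x) (near? z)
    (near-along (star-sym {P = W} E-sym p) (proj₁ (proj₂ (proj₂ w′)))) (near-along p (proj₁ (proj₂ (proj₂ w)))) w w′

  lab : Fin s → Fin (suc s)
  lab i with D? i
  ... | yes di = suc (least (near? (σ i)) (i , near-σ di))
  ... | no _   = zero

  lab-D : ∀ {i} → D i → Σ[ w ∈ ∃ (Near (σ i)) ] lab i ≡ suc (least (near? (σ i)) w)
  lab-D {i} di with D? i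
  ... | yes di′ = (i , near-σ di′) , refl
  ... | no ¬di  = contradiction di ¬di

  lab-ab : ∀ {i} → i ≡ a ⊎ i ≡ b → lab i ≡ zero
  lab-ab {i} pi with D? i
  ... | no _ = refl
  lab-ab (inj₁ refl) | yes (≢a , _) = contradiction refl ≢a
  lab-ab (inj₂ refl) | yes (_ , ≢b) = contradiction refl ≢b

  opaque

    f : Fin n → Maybe (Fin (suc s))
    f x with T? x
    ... | yes _ = just zero
    ... | no _ with any? (near? x)
    ...   | yes w = just (suc (least (near? x) w))
    ...   | no _  = nothing

    f-T : ∀ {x} → T x → f x ≡ just zero
    f-T {x} t with T? x
    ... | yes _ = refl
    ... | no ¬t = contradiction t ¬t

    f-near : ∀ {x} (w : ∃ (Near x)) → f x ≡ just (suc (least (near? x) w))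
    f-near {x} w@(_ , _ , wx , _) with T? x
    ... | yes t = contradiction t (proj₂ wx)
    ... | no _ with any? (near? x)
    ...   | yes w′  = cong (just ∘ suc) (near-eq w′ w ε)
    ...   | no none = contradiction w none

    f-cases : ∀ {x u} → f x ≡ just u → (u ≡ zero × T x) ⊎ (Σ[ w ∈ ∃ (Near x) ] u ≡ suc (least (near? x) w))
    f-cases {x} eq with T? x
    f-cases {x} refl | yes t = inj₁ (refl , t)
    ... | no _ with any? (near? x)
    f-cases {x} refl | no _ | yes w = inj₂ (w , refl)

  f-σ : ∀ i → f (σ i) ≡ just (lab i)
  f-σ i with role a b i
  ... | is-D di = trans (f-near (proj₁ (lab-D di))) (cong just (sym (proj₂ (lab-D di))))
  ... | is-ab (inj₁ refl) = trans (f-T ε) (cong just (sym (lab-ab (inj₁ refl))))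
  ... | is-ab (inj₂ refl) = trans (f-T b∈T) (cong just (sym (lab-ab (inj₂ refl))))

  Bag : Fin (suc s) → Fin n → Set
  Bag u z = f z ≡ just u

  T-path : ∀ {x} → T x → Star (Within E (Bag zero)) (σ a) x
  T-path t = star-mono (λ (_ , t) → f-T t) (star-upgrade (λ t (_ , Xz , e) → T-step t e Xz) ε t)

  W-path : ∀ {x z} (w : ∃ (Near x)) → Star (Within E W) x z → Star (Within E (Bag (suc (least (near? x) w)))) x z
  W-path {x} w p = star-mono bag (star-upgrade {Q = Star (Within E W) x} (λ q r → q ◅◅ (r ◅ ε)) ε p)
    where
    bag : ∀ {y} → W y × Star (Within E W) x y → Bag (suc (least (near? x) w)) y
    bag {y} (wy , q) = trans (f-near w′) (cong (just ∘ suc) (sym (near-eq w w′ q)))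
      where
      w′ : ∃ (Near y)
      w′ = proj₁ w , near-along (star-sym {P = W} E-sym q) wy (proj₂ w)

  f-conn : ∀ {x u} → f x ≡ just u → Σ[ i ∈ Fin s ] lab i ≡ u × Star (Within E (Bag u)) (σ i) x
  f-conn {x} eq with f-cases eq
  ... | inj₁ (refl , t) = a , lab-ab (inj₁ refl) , T-path t
  ... | inj₂ (w , refl) with dd , wx , p ← least-holds (near? x) w =
    least (near? x) w ,
    trans (proj₂ (lab-D dd)) (cong suc (near-eq (proj₁ (lab-D dd)) w (star-sym {P = W} E-sym p))) ,
    star-sym {P = Bag _} E-sym (W-path w p)

  lab-D≢ : ∀ {i} → D i → lab i ≢ zero
  lab-D≢ di eq = case trans (sym (proj₂ (lab-D di))) eq of λ ()

  lab-conn : ∀ i j → lab i ≡ lab j → Star (Within E (Bag (lab i))) (σ i) (σ j)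
  lab-conn i j eq = go (role a b i) (role a b j)
    where
    from-a : ∀ {k} → k ≡ a ⊎ k ≡ b → Star (Within E (Bag zero)) (σ a) (σ k)
    from-a (inj₁ refl) = ε
    from-a (inj₂ refl) = T-path b∈T
    go : Role a b i → Role a b j → Star (Within E (Bag (lab i))) (σ i) (σ j)
    go (is-ab pi) (is-ab pj) = subst (λ u → Star (Within E (Bag u)) (σ i) (σ j)) (sym (lab-ab pi))
      (star-sym {P = Bag zero} E-sym (from-a pi) ◅◅ from-a pj)
    go (is-ab pi) (is-D dj)  = contradiction (trans (sym eq) (lab-ab pi)) (lab-D≢ dj)
    go (is-D di)  (is-ab pj) = contradiction (trans eq (lab-ab pj)) (lab-D≢ di)
    go (is-D di)  (is-D dj)  =
      let wi , li = lab-D di ; wj , lj = lab-D dj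
          _ , _ , p = least-holds (near? (σ i)) wi
          _ , _ , p′ = least-holds (near? (σ j)) wj
          p″ = subst (λ d → Star (Within E W) (σ j) (σ d)) (suc-injective (trans (sym lj) (trans (sym eq) li))) p′
      in subst (λ u → Star (Within E (Bag u)) (σ i) (σ j)) (sym li) (W-path wi (p ◅◅ star-sym {P = W} E-sym p″))

  lab-colour : ∀ i j → lab i ≡ lab j → c (σ i) ≡ c (σ j)
  lab-colour i j eq with role a b i | role a b j
  ... | is-D di  | is-D dj  = c-D di dj
  ... | is-ab pi | is-ab pj = trans (c-at-ab pi) (sym (c-at-ab pj))
  ... | is-ab pi | is-D dj  = contradiction (trans (sym eq) (lab-ab pi)) (lab-D≢ dj)
  ... | is-D di  | is-ab pj = contradiction (trans eq (lab-ab pj)) (lab-D≢ di)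

  coloured : Σ[ c″ ∈ (Fin n → Fin q) ] Proper E′ c″ × (∀ {i j} → lab i ≡ lab j → c″ (σ i) ≡ c″ (σ j)) ×
    (∀ {x z i j} → E x z → f x ≡ just (lab i) → f z ≡ just (lab j) → lab i ≢ lab j → c″ (σ i) ≢ c″ (σ j))
  coloured = transfer lab f f-σ f-conn lab-conn (λ i j eq e → c-proper e (lab-colour i j eq))

  c″ = proj₁ coloured
  c″-lab = proj₁ (proj₂ (proj₂ coloured))
  c″-adj = proj₂ (proj₂ (proj₂ coloured))

  -- Every bag of D is adjacent to the bag of a, because the interior is connected.
  touch : ∀ {x d} → Near x d → Star (Within E (λ z → In z ⊎ z ≡ σ d ⊎ z ≡ σ a)) x (σ a) →
          ∃₂ λ x z → E x z × f x ≡ just (lab d) × f z ≡ just zero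
  touch {d = d} (dd , wx , p) ε = contradiction ε (proj₂ wx)
  touch {x} {d} near@(dd , wx , p) (_◅_ {j = z} (_ , pz , e) rs) = go (T? z) pz
    where
    go : Dec (T z) → In z ⊎ z ≡ σ d ⊎ z ≡ σ a → ∃₂ λ x z → E x z × f x ≡ just (lab d) × f z ≡ just zero
    go (yes t) _ = x , z , e ,
      trans (f-near (d , near)) (cong just (trans (cong suc (near-eq (d , near) (proj₁ (lab-D dd)) p)) (sym (proj₂ (lab-D dd))))) , f-T t
    go (no ¬t) (inj₁ In-z) = touch (dd , (inj₁ In-z , ¬t) , ((inj₁ In-z , ¬t) , wx , E-sym e) ◅ p) rs
    go (no ¬t) (inj₂ (inj₁ refl)) = touch (near-σ dd) rs
    go (no ¬t) (inj₂ (inj₂ refl)) = contradiction ε ¬t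

  c″-Da : ∀ {d} → D d → c″ (σ d) ≢ c″ (σ a)
  c″-Da {d} dd =
    let z , p , In-z , e = attached (proj₂ some) d
        z′ , p′ , In-z′ , e′ = attached In-z a
        _ , _ , xz , fx , fz = touch (near-σ dd)
          ((inj₂ (inj₁ refl) , inj₁ In-z , E-sym e) ◅ star-last (star-mono inj₁ p′) (inj₁ In-z) (inj₂ (inj₂ refl)) e′)
    in c″-adj xz fx (trans fz (cong just (sym (lab-ab (inj₁ refl))))) (λ eq → lab-D≢ dd (trans eq (lab-ab (inj₁ refl))))

  c″-ab : ∀ {i} → i ≡ a ⊎ i ≡ b → c″ (σ i) ≡ c″ (σ a)
  c″-ab pi = c″-lab (trans (lab-ab pi) (sym (lab-ab (inj₁ refl))))

  π₁ : Fin q → Fin q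
  π₁ = transpose (c″ (σ a)) ζ

  -- The Kempe changes below are confined to colours other than `ζ` and `η`, so `D` must not receive
  -- `η`; exchanging it with `ω` ensures this. Avoiding two colours and `s` values accounts for
  -- `room`.
  unused : Σ[ ω ∈ Fin q ] ω ∉ ζ ∷ η ∷ map (π₁ ∘ c″ ∘ σ) (allFin s)
  unused = avoid _ (subst (λ k → suc (suc k) < q) (sym (trans (length-map (π₁ ∘ c″ ∘ σ) (allFin s)) (length-tabulate (λ x → x)))) room)

  ω = proj₁ unused

  π : Fin q → Fin q
  π = transpose η ω ∘ π₁

  π-inj : ∀ {x y} → π x ≡ π y → x ≡ y
  π-inj eq = transpose-injective (c″ (σ a)) ζ (transpose-injective η ω eq)

  t : Fin s → Fin q
  t i = π (c″ (σ i))

  t-a : t a ≡ ζ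
  t-a = trans (cong (transpose η ω) (transpose-fst (c″ (σ a)) ζ))
    (transpose-else η ω (η≢ζ ∘ sym) (λ eq → proj₂ unused (here (sym eq))))

  X₁ : Fin q → Set
  X₁ α = ¬ X α

  t-X₁ : ∀ {d} → D d → X₁ (t d)
  t-X₁ dd (inj₁ eq) = c″-Da dd (π-inj (trans eq (sym t-a)))
  t-X₁ {d} dd (inj₂ eq) = proj₂ unused (there (there (subst (_∈ map (π₁ ∘ c″ ∘ σ) (allFin s)) π₁≡ω (∈-map⁺ (π₁ ∘ c″ ∘ σ) (∈-allFin d)))))
    where
    π₁≡ω : π₁ (c″ (σ d)) ≡ ω
    π₁≡ω = transpose-injective η ω (trans eq (sym (transpose-snd η ω)))

  Near₁ : Fin n → Fin s → Set
  Near₁ x d = D d × Star (Within E (X₁ ∘ c)) x (σ d)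

  near₁? : ∀ x → U.Decidable (Near₁ x)
  near₁? x d = D? d ×-dec star? (within? E? (λ z → ¬? (X? (c z)))) x (σ d)

  -- Vertices of `T` have colours in `X`, as do `a` and `b`. A chain outside `X` therefore stays in
  -- `W`, and the vertices of `D` on it lie in one bag and have one target colour.
  X₁⇒W : ∀ {x z} → Star (Within E (X₁ ∘ c)) x z → Star (Within E W) x z
  X₁⇒W ε = ε
  X₁⇒W ((px , pz , e) ◅ rs) = (inner px e , inner pz (E-sym e) , e) ◅ X₁⇒W rs
    where
    inner : ∀ {x z} → X₁ (c x) → E x z → W x
    inner {x} px e = position (ends e) , px ∘ T-X
      where
      position : In x ⊎ (Σ[ i ∈ Fin s ] x ≡ σ i) → In x ⊎ (Σ[ d ∈ Fin s ] D d × x ≡ σ d)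
      position (inj₁ p) = inj₁ p
      position (inj₂ (i , refl)) with role a b i
      ... | is-D di  = inj₂ (i , di , refl)
      ... | is-ab pi = contradiction (inj₁ (c-at-ab pi)) px

  near₁-t : ∀ {x z d d′} → Near₁ x d → Near₁ z d′ → Star (Within E (X₁ ∘ c)) x z → t d ≡ t d′
  near₁-t (dd , p) (dd′ , p′) r = cong π (c″-lab (trans (proj₂ (lab-D dd))
    (trans (cong suc (near-eq (proj₁ (lab-D dd)) (proj₁ (lab-D dd′)) (X₁⇒W (star-sym {P = X₁ ∘ c} E-sym p ◅◅ r ◅◅ p′))))
           (sym (proj₂ (lab-D dd′))))))

  opaque

    c‴ : Fin n → Fin q
    c‴ x with X? (c x)
    ... | yes _ = c x
    ... | no _ with any? (near₁? x)
    ...   | yes (d , _) = transpose δ (t d) (c x)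
    ...   | no _        = c x

    c‴-X : ∀ {x} → X (c x) → c‴ x ≡ c x
    c‴-X {x} p with X? (c x)
    ... | yes _ = refl
    ... | no ¬p = contradiction p ¬p

    c‴-near : ∀ {x d} → X₁ (c x) → Near₁ x d → c‴ x ≡ transpose δ (t d) (c x)
    c‴-near {x} {d} ¬p w with X? (c x)
    ... | yes p = contradiction p ¬p
    ... | no _ with any? (near₁? x)
    ...   | yes (d′ , w′) = cong (λ β → transpose δ β (c x)) (near₁-t w′ w ε)
    ...   | no none       = contradiction (d , w) none

    c‴-far : ∀ {x} → X₁ (c x) → ¬ ∃ (Near₁ x) → c‴ x ≡ c x
    c‴-far {x} ¬p ¬w with X? (c x)
    ... | yes _ = refl
    ... | no _ with any? (near₁? x)
    ...   | yes w = contradiction w ¬w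
    ...   | no _  = refl

  c‴-X₁ : ∀ {x} → X₁ (c x) → X₁ (c‴ x)
  c‴-X₁ {x} ¬p = go (any? (near₁? x))
    where
    go : Dec (∃ (Near₁ x)) → X₁ (c‴ x)
    go (yes (d , w)) = subst X₁ (sym (c‴-near ¬p w)) (transpose-closed δ (t d) {X₁} δ∉X (t-X₁ (proj₁ w)) ¬p)
    go (no ¬w)       = subst X₁ (sym (c‴-far ¬p ¬w)) ¬p

  c‴-proper : Proper E c‴
  c‴-proper {x} {z} e eq = go (X? (c x)) (X? (c z)) (any? (near₁? x)) (any? (near₁? z))
    where
    step : X₁ (c x) → X₁ (c z) → ∀ {d} → Near₁ z d → Near₁ x d
    step ¬x ¬z (dd , p) = dd , (¬x , ¬z , e) ◅ p
    step′ : X₁ (c x) → X₁ (c z) → ∀ {d} → Near₁ x d → Near₁ z d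
    step′ ¬x ¬z (dd , p) = dd , (¬z , ¬x , E-sym e) ◅ p
    go : Dec (X (c x)) → Dec (X (c z)) → Dec (∃ (Near₁ x)) → Dec (∃ (Near₁ z)) → ⊥
    go (yes p) (yes p′) _ _ = c-proper e (trans (sym (c‴-X p)) (trans eq (c‴-X p′)))
    go (yes p) (no ¬p) _ _ = c‴-X₁ ¬p (subst X (trans (sym (c‴-X p)) eq) p)
    go (no ¬p) (yes p) _ _ = c‴-X₁ ¬p (subst X (trans (sym (c‴-X p)) (sym eq)) p)
    go (no ¬x) (no ¬z) (yes (d , w)) _ = c-proper e (transpose-injective δ (t d)
      (trans (sym (c‴-near ¬x w)) (trans eq (c‴-near ¬z (step′ ¬x ¬z w)))))
    go (no ¬x) (no ¬z) (no ¬w) (yes (d , w)) = ¬w (d , step ¬x ¬z w)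
    go (no ¬x) (no ¬z) (no ¬w) (no ¬w′) = c-proper e (trans (sym (c‴-far ¬x ¬w)) (trans eq (c‴-far ¬z ¬w′)))

  c‴-σ : ∀ i → c‴ (σ i) ≡ t i
  c‴-σ i with role a b i
  ... | is-ab pi = trans (c‴-X (inj₁ (c-at-ab pi))) (trans (c-at-ab pi) (trans (sym t-a) (cong π (sym (c″-ab pi)))))
  ... | is-D di  = trans (c‴-near (δ∉X ∘ subst X (c-at-D di)) (di , ε))
                     (trans (cong (transpose δ (t i)) (c-at-D di)) (transpose-fst δ (t i)))

  impossible : ⊥
  impossible = separated c‴ c″ c‴-proper (proj₁ (proj₂ coloured)) λ i j →
    (λ eq → π-inj (trans (sym (c‴-σ i)) (trans eq (c‴-σ j)))) ,
    (λ eq → trans (c‴-σ i) (trans (cong π eq) (sym (c‴-σ j))))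

-- Otherwise the separator without `a` and `b` is independent and both sides have exact colourings.
-- These match unless just one of them identifies `a` and `b`, which is the case of `Clash`.
edge-avoiding : ∀ {n s q} {E E′ : Rel (Fin n) 0ℓ} {σ : Fin s → Fin n} → Sides q σ E E′ → (∀ {i j} → σ i ≡ σ j → i ≡ j) →
  (∀ {x} → ¬ E x x) → (∀ {x} → ¬ E′ x x) → Interior E σ → Interior E′ σ → 2 < s → 2 + s < q → EdgeAvoiding E σ
edge-avoiding {s = s} {q} {E} {E′} {σ} S σ-inj E-irrefl E′-irrefl I I′ 2<s room a b
  with any? (λ i → any? λ j → ¬? (i ≟ a) ×-dec ¬? (i ≟ b) ×-dec ¬? (j ≟ a) ×-dec ¬? (j ≟ b) ×-dec Sides.E? S (σ i) (σ j))
... | yes (i , j , found) = i , j , found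
... | no none = ⊥-elim (compare (proj₂ exact) (proj₂ exact′) (proj₁ exact (σ a) ≟ proj₁ exact (σ b)) (proj₁ exact′ (σ a) ≟ proj₁ exact′ (σ b)))
  where
  open Sides S
  d₀ = avoid (a ∷ b ∷ []) 2<s
  d₀∈ : proj₁ d₀ ≢ a × proj₁ d₀ ≢ b
  d₀∈ = (λ eq → proj₂ d₀ (here eq)) , (λ eq → proj₂ d₀ (there (here eq)))
  indep : ∀ {i j} → i ≢ a × i ≢ b → j ≢ a × j ≢ b → ¬ E (σ i) (σ j)
  indep {i} {j} (i≢a , i≢b) (j≢a , j≢b) e = none (i , j , i≢a , i≢b , j≢a , j≢b , e)
  indep′ : ∀ {i j} → i ≢ a × i ≢ b → j ≢ a × j ≢ b → ¬ E′ (σ i) (σ j)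
  indep′ di dj e = indep di dj (agree′ e)
  exact′ = Exact.exact σ-inj E-sym E-irrefl transfer I a b indep d₀∈
  exact = Exact.exact σ-inj E′-sym E′-irrefl transfer′ I′ a b indep′ d₀∈
  compare : ∀ {c c′} → IsExact σ a b E c → IsExact σ a b E′ c′ → Dec (c (σ a) ≡ c (σ b)) → Dec (c′ (σ a) ≡ c′ (σ b)) → ⊥
  compare ce ce′ (yes p) (no p′) = Clash.impossible S σ-inj E-irrefl I room a b indep d₀∈ ce ce′ p p′
  compare ce ce′ (no p) (yes p′) = Clash.impossible (flip-sides S) σ-inj E′-irrefl I′ room a b indep′ d₀∈ ce′ ce p′ p
  compare {c} {c′} ce ce′ (yes p) (yes p′) = separated c c′ (proj₁ ce) (proj₁ ce′) (exact-kernel ce ce′ (λ _ → p′) (λ _ → p))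
  compare {c} {c′} ce ce′ (no p) (no p′) = separated c c′ (proj₁ ce) (proj₁ ce′)
    (exact-kernel ce ce′ (λ eq → contradiction eq p) (λ eq → contradiction eq p′))

-- Contraction-critical graphs

module Merge {n : ℕ} {u v : Fin (suc n)} (v≢u : v ≢ u) where

  merge : Fin (suc n) → Fin n
  merge x with v ≟ x
  ... | yes _  = punchOut v≢u
  ... | no v≢x = punchOut v≢x

  merge-v : merge v ≡ punchOut v≢u
  merge-v with v ≟ v
  ... | yes _ = refl
  ... | no ne = contradiction refl ne

  merge-out : ∀ {x} (v≢x : v ≢ x) → merge x ≡ punchOut v≢x
  merge-out {x} v≢x with v ≟ x
  ... | yes eq = contradiction eq v≢x
  ... | no _   = punchOut-cong v refl

  merge-in : ∀ a → merge (punchIn v a) ≡ a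
  merge-in a = trans (merge-out (punchInᵢ≢i v a ∘ sym)) (punchOut-punchIn v)

  merge-uv : merge u ≡ merge v
  merge-uv = trans (merge-out v≢u) (sym merge-v)

  merge-kernel : ∀ {x y} → merge x ≡ merge y → x ≡ y ⊎ (x ≡ u × y ≡ v) ⊎ (x ≡ v × y ≡ u)
  merge-kernel {x} {y} eq with v ≟ x | v ≟ y
  ... | yes refl | yes refl = inj₁ refl
  ... | yes refl | no v≢y   = inj₂ (inj₂ (refl , sym (punchOut-injective v≢u v≢y eq)))
  ... | no v≢x   | yes refl = inj₂ (inj₁ (punchOut-injective v≢x v≢u eq , refl))
  ... | no v≢x   | no v≢y   = inj₁ (punchOut-injective v≢x v≢y eq)

contraction : ∀ (T : Graph) {u v} → Graph.Adj T u v →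
  Σ[ H ∈ Graph ] Σ[ step ∈ T ↘ H ] _↘_.u step ≡ u × _↘_.v step ≡ v × Graph.order H < Graph.order T
contraction record { order = suc n ; Adj = Adj ; adj? = adj? ; sym = Adj-sym ; irrefl = irrefl } {u} {v} e = H , step , refl , refl , ≤-refl
  where
  v≢u : v ≢ u
  v≢u refl = irrefl e
  open Merge v≢u
  H : Graph
  H = record
    { order  = n
    ; Adj    = λ a b → a ≢ b × (Σ[ x ∈ Fin (suc n) ] Σ[ y ∈ Fin (suc n) ] (merge x ≡ a × merge y ≡ b × Adj x y))
    ; adj?   = λ a b → ¬? (a ≟ b) ×-dec any? λ x → any? λ y → (merge x ≟ a) ×-dec (merge y ≟ b) ×-dec adj? x y
    ; sym    = λ { (a≢b , x , y , p , r , xy) → a≢b ∘ sym , y , x , r , p , Adj-sym xy }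
    ; irrefl = λ (a≢a , _) → a≢a refl
    }
  step : _ ↘ H
  step = record
    { edge       = e
    ; merge      = merge
    ; surjective = λ a → punchIn v a , merge-in a
    ; identifies = λ x y → mk⇔ merge-kernel λ where
        (inj₁ refl)                 → refl
        (inj₂ (inj₁ (refl , refl))) → merge-uv
        (inj₂ (inj₂ (refl , refl))) → sym merge-uv
    ; adjacency  = λ a b → mk⇔ id id
    }

module _ {n : ℕ} where

  open Graph using (Adj; Vertex)

  SameBag : (T : Graph) → (Vertex T → Fin n) → Rel (Vertex T) 0ℓ
  SameBag T f x y = Adj T x y × f x ≡ f y

  PartialBag : (T : Graph) → (Vertex T → Maybe (Fin n)) → Fin n → Rel (Vertex T) 0ℓ
  PartialBag T f l x y = f x ≡ just l × f y ≡ just l × Adj T x y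

  BagColouring : (q : ℕ) (T : Graph) → (Vertex T → Maybe (Fin n)) → Set
  BagColouring q T f = Σ[ h ∈ (Vertex T → Fin q) ] (∀ {x y l} → f x ≡ just l → f y ≡ just l → h x ≡ h y) ×
    (∀ {x y l l′} → Adj T x y → f x ≡ just l → f y ≡ just l′ → l ≢ l′ → h x ≢ h y)

module _ {n q : ℕ} where

  open Graph using (order; Adj; adj?; Vertex)

  Contractible : Graph → Set₁
  Contractible T = ∀ H → Star _↘_ T H → order H < n → Colorable q H

  -- Contracting the edges inside the bags one by one ends with a graph on fewer than n
  -- vertices, since b names no bag.
  colour-bags : ∀ T → Acc _<_ (order T) → Contractible T → (f : Vertex T → Fin n) (b : Fin n) → (∀ x → f x ≢ b) →
    (∀ x y → f x ≡ f y → Star (SameBag T f) x y) →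
    Σ[ h ∈ (Vertex T → Fin q) ] (∀ {x y} → f x ≡ f y → h x ≡ h y) × (∀ {x y} → Adj T x y → f x ≢ f y → h x ≢ h y)
  colour-bags T (acc rec) good f b f≢b bags
    with any? (λ u → any? λ v → adj? T u v ×-dec (f u ≟ f v))
  ... | no none = let c , proper = good T ε (injective⇒≤ {f = with-b} with-b-inj) in
      c , (λ {x} {y} eq → cong c (trivial (bags x y eq))) , λ e _ → proper e
    where
    trivial : ∀ {x y} → Star (SameBag T f) x y → x ≡ y
    trivial ε            = refl
    trivial (r ◅ _)      = contradiction (_ , _ , r) none
    with-b : Fin (suc (order T)) → Fin n
    with-b zero    = b
    with-b (suc x) = f x
    with-b-inj : ∀ {x y} → with-b x ≡ with-b y → x ≡ y
    with-b-inj {zero}  {zero}  _  = refl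
    with-b-inj {zero}  {suc y} eq = contradiction (sym eq) (f≢b y)
    with-b-inj {suc x} {zero}  eq = contradiction eq (f≢b x)
    with-b-inj {suc x} {suc y} eq = cong suc (trivial (bags x y eq))
  ... | yes (u , v , e , fuv) with H , step , refl , refl , H<T ← contraction T e
    = let h , h-bag , h-adj = colour-bags H (rec H<T) (λ H′ p → good H′ (step ◅ p)) g b (λ a → f≢b (sec a)) bags′ in
      (λ x → h (merge x)) , (λ eq → h-bag (trans (g-merge _) (trans eq (sym (g-merge _))))) ,
      (λ {x} {y} xy ne → h-adj (Equivalence.from (adjacency (merge x) (merge y))
          ((λ eq → ne (trans (sym (g-merge x)) (trans (cong g eq) (g-merge y)))) , x , y , refl , refl , xy))
        (λ eq → ne (trans (sym (g-merge x)) (trans eq (g-merge y)))))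
    where
    open _↘_ step renaming (u to u₀; v to v₀)
    sec : Vertex H → Vertex T
    sec a = proj₁ (surjective a)
    merge-sec : ∀ a → merge (sec a) ≡ a
    merge-sec a = proj₂ (surjective a)
    g : Vertex H → Fin n
    g a = f (sec a)
    g-merge : ∀ x → g (merge x) ≡ f x
    g-merge x with Equivalence.to (identifies (sec (merge x)) x) (merge-sec (merge x))
    ... | inj₁ eq                = cong f eq
    ... | inj₂ (inj₁ (p , refl)) = trans (cong f p) fuv
    ... | inj₂ (inj₂ (p , refl)) = trans (cong f p) (sym fuv)
    push : ∀ {x y} → Star (SameBag T f) x y → Star (SameBag H g) (merge x) (merge y)
    push ε = ε
    push {x} {y} (_◅_ {j = z} (xz , fxz) p) with merge x ≟ merge z
    ... | yes eq = subst (λ a → Star (SameBag H g) a (merge y)) (sym eq) (push p)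
    ... | no ne  = (Equivalence.from (adjacency (merge x) (merge z)) (ne , x , z , refl , refl , xz) ,
                    trans (g-merge x) (trans fxz (sym (g-merge z)))) ◅ push p
    bags′ : ∀ a b → g a ≡ g b → Star (SameBag H g) a b
    bags′ a b eq = subst₂ (Star (SameBag H g)) (merge-sec a) (merge-sec b) (push (bags (sec a) (sec b) eq))

⊑-trans : ∀ {F G H} → F ⊑ G → G ⊑ H → F ⊑ H
⊑-trans (f , f-inj , f-adj) (g , g-inj , g-adj) = g ∘ f , f-inj ∘ g-inj , g-adj ∘ f-adj

deletion : ∀ (T : Graph) (x : Graph.Vertex T) → Σ[ H ∈ Graph ] Σ[ (inc , _) ∈ H ⊑ T ]
  Graph.order H < Graph.order T × (∀ {a b} → Graph.Adj T (inc a) (inc b) → Graph.Adj H a b) ×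
  (∀ a → inc a ≢ x) × (∀ y → y ≢ x → Σ[ a ∈ Graph.Vertex H ] inc a ≡ y)
deletion record { order = suc n ; Adj = Adj ; adj? = adj? ; sym = Adj-sym ; irrefl = irrefl } x =
  record { order = n ; Adj = λ a b → Adj (punchIn x a) (punchIn x b) ; adj? = λ a b → adj? (punchIn x a) (punchIn x b)
         ; sym = Adj-sym ; irrefl = irrefl } ,
  (punchIn x , punchIn-injective x _ _ , id) , ≤-refl , id , punchInᵢ≢i x ,
  λ y y≢x → punchOut (y≢x ∘ sym) , punchIn-punchOut (y≢x ∘ sym)

module _ {q : ℕ} {G : Graph} (α₀ : Fin q)
  (minor : ∀ H → Minor H G → Graph.order H < Graph.order G → Colorable q H)
  (b : Graph.Vertex G) where

  open Graph using (order; Adj; adj?; Vertex)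

  -- A minor is a contraction of a subgraph, so vertices outside the bags are deleted before any
  -- edge is contracted. They receive the default `α₀`, on which the conclusion does not depend.
  delete-and-colour : ∀ T → Acc _<_ (order T) → T ⊑ G → (f : Vertex T → Maybe (Vertex G)) → (∀ x → f x ≢ just b) →
    (∀ x y l → f x ≡ just l → f y ≡ just l → Star (PartialBag T f l) x y) → BagColouring q T f
  delete-and-colour T (acc rec) T⊑G f f≢b bags with any? (λ x → ≡-decᴹ _≟_ (f x) nothing)
  ... | yes (x , fx) with H , H⊑T@(inc , inc-inj , _) , H<T , back , inc≢x , onto ← deletion T x
    = extend (delete-and-colour H (rec H<T) (⊑-trans {H} {T} {G} H⊑T T⊑G) (f ∘ inc) (f≢b ∘ inc) bags′)
    where
    pull : ∀ {l z w} → Star (PartialBag T f l) z w → ∀ a → inc a ≡ z →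
           Σ[ a′ ∈ Vertex H ] inc a′ ≡ w × Star (PartialBag H (f ∘ inc) l) a a′
    pull ε a eq = a , eq , ε
    pull (_◅_ {j = z} (fa , fz , e) p) a refl
      with a₁ , refl ← onto z (λ { refl → contradiction (trans (sym fx) fz) λ () })
      with a′ , eq′ , p′ ← pull p a₁ refl = a′ , eq′ , (fa , fz , back e) ◅ p′
    bags′ : ∀ a a′ l → f (inc a) ≡ just l → f (inc a′) ≡ just l → Star (PartialBag H (f ∘ inc) l) a a′
    bags′ a a′ l fa fa′ with a″ , eq , p ← pull (bags (inc a) (inc a′) l fa fa′) a refl with refl ← inc-inj eq = p
    extend : BagColouring q H (f ∘ inc) → BagColouring q T f
    extend (h , h-bag , h-adj) = h⁺ , same , differ
      where
      h⁺ : Vertex T → Fin q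
      h⁺ y with y ≟ x
      ... | yes _ = α₀
      ... | no ne = h (proj₁ (onto y ne))
      kept : ∀ {y l} → f y ≡ just l → Σ[ a ∈ Vertex H ] inc a ≡ y × h⁺ y ≡ h a
      kept {y} fy with y ≟ x
      ... | yes refl = contradiction (trans (sym fx) fy) λ ()
      ... | no ne    = proj₁ (onto y ne) , proj₂ (onto y ne) , refl
      same : ∀ {y z l} → f y ≡ just l → f z ≡ just l → h⁺ y ≡ h⁺ z
      same fy fz with a , refl , ha ← kept fy | a′ , refl , ha′ ← kept fz = trans ha (trans (h-bag fy fz) (sym ha′))
      differ : ∀ {y z l l′} → Adj T y z → f y ≡ just l → f z ≡ just l′ → l ≢ l′ → h⁺ y ≢ h⁺ z
      differ e fy fz ne eq with a , refl , ha ← kept fy | a′ , refl , ha′ ← kept fz =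
        h-adj (back e) fy fz ne (trans (sym ha) (trans eq ha′))
  ... | no all = let h , h-bag , h-adj = colour-bags T (<-wellFounded _) (λ H p lt → minor H (T , T⊑G , p) lt) g b
                                           (λ x eq → f≢b x (trans (f-g x) (cong just eq))) bags′ in
      h , (λ p r → h-bag (just-injective (trans (sym (f-g _)) (trans p (trans (sym r) (f-g _)))))) ,
      λ e p r ne → h-adj e (λ eq → ne (just-injective (trans (sym p) (trans (f-g _) (trans (cong just eq) (trans (sym (f-g _)) r))))))
    where
    total : ∀ x → Σ[ l ∈ Vertex G ] f x ≡ just l
    total x with f x in eq
    ... | just l  = l , refl
    ... | nothing = contradiction (x , eq) all
    g : Vertex T → Vertex G
    g x = proj₁ (total x)
    f-g : ∀ x → f x ≡ just (g x)
    f-g x = proj₂ (total x)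
    bags′ : ∀ x y → g x ≡ g y → Star (SameBag T g) x y
    bags′ x y eq = gmap id (λ (p , r , e) → e , just-injective (trans (sym (f-g _)) (trans p (trans (sym r) (f-g _)))))
      (bags x y (g x) (f-g x) (trans (f-g y) (cong just (sym eq))))

-- From a cut to two sides

-- A side is a relation on all vertices of `G` in which the removed ones are isolated; both sides
-- thus share the vertex type and the map `σ`.
Rest : (G : Graph) → (Vertex G → Set) → Rel (Vertex G) 0ℓ
Rest G B x y = Graph.Adj G x y × ¬ B x × ¬ B y

-- A smaller order excludes isomorphism, so criticality supplies this property.
Minors<-Colorable : ℕ → Graph → Set₁
Minors<-Colorable q G = ∀ H → Minor H G → order H < order G → Colorable q H

record Cut (G : Graph) {s : ℕ} (σ : Fin s → Vertex G) (A B : Vertex G → Set) : Set where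
  open Graph G using (Adj)
  field
    A?       : U.Decidable A
    B?       : U.Decidable B
    some-A   : ∃ A
    some-B   : ∃ B
    disjoint : ∀ {x} → A x → ¬ B x
    σ-inj    : ∀ {i j} → σ i ≡ σ j → i ≡ j
    σ∉A      : ∀ i → ¬ A (σ i)
    σ∉B      : ∀ i → ¬ B (σ i)
    cover    : ∀ x → A x ⊎ B x ⊎ (Σ[ i ∈ Fin s ] x ≡ σ i)
    no-edge  : ∀ {x y} → A x → B y → ¬ Adj x y

flip-cut : ∀ {G s} {σ : Fin s → Vertex G} {A B} → Cut G σ A B → Cut G σ B A
flip-cut {G} C = record
  { A? = B? ; B? = A? ; some-A = some-B ; some-B = some-A ; disjoint = λ b a → disjoint a b ; σ-inj = σ-inj
  ; σ∉A = σ∉B ; σ∉B = σ∉A ; cover = λ x → swap-cover (cover x) ; no-edge = λ b a e → no-edge a b (Graph.sym G e) }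
  where
  open Cut C
  swap-cover : ∀ {P Q R : Set} → P ⊎ Q ⊎ R → Q ⊎ P ⊎ R
  swap-cover (inj₁ p)        = inj₂ (inj₁ p)
  swap-cover (inj₂ (inj₁ p)) = inj₁ p
  swap-cover (inj₂ (inj₂ p)) = inj₂ (inj₂ p)

rest? : ∀ G {B} → U.Decidable B → Decidable (Rest G B)
rest? G B? x y = Graph.adj? G x y ×-dec ¬? (B? x) ×-dec ¬? (B? y)

rest-sym : ∀ G {B} → Symmetric (Rest G B)
rest-sym G (e , ¬x , ¬y) = Graph.sym G e , ¬y , ¬x

module _ {G : Graph} {s q : ℕ} {σ : Fin s → Vertex G} (α₀ : Fin q) (minors : Minors<-Colorable q G) where

  cut-transfer : ∀ {A B} → Cut G σ A B → Transfer q (Rest G B) (Rest G A) σ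
  cut-transfer {A} {B} C {N} lab f f-σ f-conn lab-conn nonadjacent =
    let h , h-bag , h-adj = delete-and-colour {q} {G} α₀ minors (proj₁ some-A) G (<-wellFounded _) (id , (λ eq → eq) , λ e → e) F F≢a bags in
    h , (λ {x} {y} e eq → proper h h-adj e eq) ,
    (λ {i} {j} eq → h-bag (F-σ i) (trans (F-σ j) (cong (just ∘ σ) (rep-cong (sym eq))))) ,
    (λ {x} {z} {i} {j} (e , ¬x , ¬z) fx fz ne eq → h-adj e (F-out ¬x fx) (F-out ¬z fz) (λ p → ne (rep-inj p))
      (trans (h-bag (F-out ¬x fx) (F-σ i)) (trans eq (sym (h-bag (F-out ¬z fz) (F-σ j))))))
    where
    open Cut C
    rep : (u : Fin N) → Hit lab u → Fin s
    rep u w = least (λ i → lab i ≟ u) w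
    lab-rep : ∀ u w → lab (rep u w) ≡ u
    lab-rep u w = least-holds (λ i → lab i ≟ u) w
    rep′ : Fin s → Fin s
    rep′ i = rep (lab i) (i , refl)
    rep-cong : ∀ {i j} → lab i ≡ lab j → rep′ i ≡ rep′ j
    rep-cong {i} {j} eq = least-cong (λ k → lab k ≟ lab i) (λ k → lab k ≟ lab j) (λ p → trans p eq) (λ p → trans p (sym eq)) (i , refl) (j , refl)
    rep-inj : ∀ {i j} → σ (rep′ i) ≡ σ (rep′ j) → lab i ≡ lab j
    rep-inj {i} {j} eq = trans (sym (lab-rep (lab i) (i , refl))) (trans (cong lab (σ-inj eq)) (lab-rep (lab j) (j , refl)))
    opaque
      F : Vertex G → Maybe (Vertex G)
      F x with B? x
      ... | yes _ = just x
      ... | no _ with any? (λ i → ≡-decᴹ _≟_ (f x) (just (lab i)))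
      ...   | yes (i , _) = just (σ (rep′ i))
      ...   | no _        = nothing
      F-B : ∀ {x} → B x → F x ≡ just x
      F-B {x} bx with B? x
      ... | yes _  = refl
      ... | no ¬bx = contradiction bx ¬bx
      F-out : ∀ {x i} → ¬ B x → f x ≡ just (lab i) → F x ≡ just (σ (rep′ i))
      F-out {x} {i} ¬bx fx with B? x
      ... | yes bx = contradiction bx ¬bx
      ... | no _ with any? (λ i → ≡-decᴹ _≟_ (f x) (just (lab i)))
      ...   | yes (j , fx′) = cong (just ∘ σ) (rep-cong (just-injective (trans (sym fx′) fx)))
      ...   | no none       = contradiction (i , fx) none
      F-cases : ∀ {x l} → F x ≡ just l → (B x × l ≡ x) ⊎ (¬ B x × (Σ[ i ∈ Fin s ] f x ≡ just (lab i) × l ≡ σ (rep′ i)))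
      F-cases {x} eq with B? x
      F-cases refl | yes bx = inj₁ (bx , refl)
      ... | no ¬bx with any? (λ i → ≡-decᴹ _≟_ (f x) (just (lab i)))
      F-cases refl | no ¬bx | yes (i , fx) = inj₂ (¬bx , i , fx , refl)
    F-σ : ∀ i → F (σ i) ≡ just (σ (rep′ i))
    F-σ i = F-out (σ∉B i) (f-σ i)
    F≢a : ∀ x → F x ≢ just (proj₁ some-A)
    F≢a x eq with F-cases eq
    ... | inj₁ (bx , refl)         = disjoint (proj₂ some-A) bx
    ... | inj₂ (_ , i , _ , a≡)    = σ∉A (rep′ i) (subst A a≡ (proj₂ some-A))
    to-G : ∀ {i x y} → Star (Within (Rest G B) (λ z → f z ≡ just (lab i))) x y → Star (PartialBag G F (σ (rep′ i))) x y
    to-G ε = ε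
    to-G ((fx , fz , e , ¬x , ¬z) ◅ p) = (F-out ¬x fx , F-out ¬z fz , e) ◅ to-G p
    from-σ : ∀ i {x} → f x ≡ just (lab i) → Star (Within (Rest G B) (λ z → f z ≡ just (lab i))) (σ i) x
    from-σ i fx = let j , j≡ , p = f-conn fx in lab-conn i j (sym j≡) ◅◅ p
    bags : ∀ x y l → F x ≡ just l → F y ≡ just l → Star (PartialBag G F l) x y
    bags x y l Fx Fy with F-cases Fx | F-cases Fy
    ... | inj₁ (bx , refl) | inj₁ (_ , refl) = ε
    ... | inj₁ (bx , refl) | inj₂ (_ , i , _ , x≡) = contradiction (subst B x≡ bx) (σ∉B _)
    ... | inj₂ (_ , i , _ , y≡) | inj₁ (by , refl) = contradiction (subst B y≡ by) (σ∉B _)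
    ... | inj₂ (_ , i , fx , refl) | inj₂ (_ , j , fy , eq) =
      to-G (star-sym {E = Rest G B} (rest-sym G) (from-σ i fx) ◅◅ from-σ i (trans fy (cong just (sym (rep-inj eq)))))
    proper : ∀ (h : Vertex G → Fin q) → (∀ {x y l l′} → Graph.Adj G x y → F x ≡ just l → F y ≡ just l′ → l ≢ l′ → h x ≢ h y) →
             Proper (Rest G A) h
    proper h h-adj {x} {y} (e , ¬x , ¬y) = go (cover x) (cover y)
      where
      go : A x ⊎ B x ⊎ (Σ[ i ∈ Fin s ] x ≡ σ i) → A y ⊎ B y ⊎ (Σ[ i ∈ Fin s ] y ≡ σ i) → h x ≢ h y
      go (inj₁ p) _ = contradiction p ¬x
      go _ (inj₁ p) = contradiction p ¬y
      go (inj₂ (inj₁ bx)) (inj₂ (inj₁ by)) = h-adj e (F-B bx) (F-B by) λ { refl → Graph.irrefl G e }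
      go (inj₂ (inj₁ bx)) (inj₂ (inj₂ (i , refl))) = h-adj e (F-B bx) (F-σ i) λ { refl → σ∉B _ bx }
      go (inj₂ (inj₂ (i , refl))) (inj₂ (inj₁ by)) = h-adj e (F-σ i) (F-B by) λ { refl → σ∉B _ by }
      go (inj₂ (inj₂ (i , refl))) (inj₂ (inj₂ (j , refl))) = h-adj e (F-σ i) (F-σ j)
        λ eq → nonadjacent i j (rep-inj eq) (e , σ∉B i , σ∉B j)

  cut-separated : ¬ Colorable q G → ∀ {A B} → Cut G σ A B → Separated q (Rest G B) (Rest G A) σ
  cut-separated uncolourable {A} {B} C c c′ c-proper c′-proper ker
    with π , π-inj , ok ← align (c′ ∘ σ) (c ∘ σ) (allFin s) (λ {i} {j} _ _ → proj₂ (ker i j)) (λ {i} {j} _ _ → proj₁ (ker i j))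
    = uncolourable (col , λ {x} {y} → col-proper {x} {y})
    where
    open Cut C
    col : Vertex G → Fin q
    col x with B? x
    ... | yes _ = π (c′ x)
    ... | no _  = c x
    across : ∀ {x y} → Graph.Adj G x y → B x → ¬ B y → π (c′ x) ≢ c y
    across {x} {y} e bx ¬by with cover y
    ... | inj₁ ay = contradiction (Graph.sym G e) (no-edge ay bx)
    ... | inj₂ (inj₁ by) = contradiction by ¬by
    ... | inj₂ (inj₂ (i , refl)) = λ eq → c′-proper (e , (λ ax → disjoint ax bx) , σ∉A i) (π-inj (trans eq (sym (ok (∈-allFin i)))))
    col-proper : Proper (Graph.Adj G) col
    col-proper {x} {y} e with B? x | B? y
    ... | yes bx | yes by = λ eq → c′-proper (e , (λ ax → disjoint ax bx) , (λ ay → disjoint ay by)) (π-inj eq)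
    ... | yes bx | no ¬by = across e bx ¬by
    ... | no ¬bx | yes by = λ eq → across (Graph.sym G e) by ¬bx (sym eq)
    ... | no ¬bx | no ¬by = c-proper (e , ¬bx , ¬by)

  cut-sides : ¬ Colorable q G → ∀ {A B} → Cut G σ A B → Sides q σ (Rest G B) (Rest G A)
  cut-sides uncolourable C = record
    { E? = rest? G B? ; E-sym = rest-sym G ; E′? = rest? G A? ; E′-sym = rest-sym G
    ; transfer = cut-transfer C ; transfer′ = cut-transfer (flip-cut C)
    ; separated = cut-separated uncolourable C
    ; agree = λ (e , _) → e , σ∉A _ , σ∉A _ ; agree′ = λ (e , _) → e , σ∉B _ , σ∉B _ }
    where open Cut C

  -- With each separator vertex as its own bag, the transfer merely deletes `A`.
  cut-colouring : ∀ {A B} → Cut G σ A B → Σ[ c ∈ (Vertex G → Fin q) ] Proper (Rest G A) c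
  cut-colouring {A} {B} C =
    let c , c-proper , _ = cut-transfer C {s} id f f-σ f-conn (λ { i j refl → ε }) (λ { i j refl (e , _) → Graph.irrefl G e })
    in c , (λ {x} {y} → c-proper {x} {y})
    where
    open Cut C
    f : Vertex G → Maybe (Fin s)
    f x with any? (λ i → σ i ≟ x)
    ... | yes (i , _) = just i
    ... | no _        = nothing
    f-σ : ∀ i → f (σ i) ≡ just i
    f-σ i with any? (λ j → σ j ≟ σ i)
    ... | yes (j , eq) = cong just (σ-inj eq)
    ... | no none      = contradiction (i , refl) none
    f-conn : ∀ {x u} → f x ≡ just u → Σ[ i ∈ Fin s ] i ≡ u × Star (Within (Rest G B) (λ z → f z ≡ just u)) (σ i) x
    f-conn {x} eq with any? (λ i → σ i ≟ x)
    f-conn refl | yes (i , refl) = i , refl , ε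

Attached : (G : Graph) {s : ℕ} → (Fin s → Vertex G) → (Vertex G → Set) → Set
Attached G {s} σ A = ∀ {x} → A x → ∀ (i : Fin s) → Σ[ z ∈ Vertex G ] Star (Within (Graph.Adj G) A) x z × A z × Graph.Adj G z (σ i)

cut-interior : ∀ {G s} {σ : Fin s → Vertex G} {A B} → Cut G σ A B → Attached G σ A → Interior (Rest G B) σ
cut-interior {G} {s} {σ} {A} {B} C att = record
  { In = A ; In? = A? ; some = some-A ; outside = σ∉A
  ; ends = λ {x} (_ , ¬bx , _) → case cover x of λ where
      (inj₁ ax)        → inj₁ ax
      (inj₂ (inj₁ bx)) → contradiction bx ¬bx
      (inj₂ (inj₂ p))  → inj₂ p
  ; attached = λ ax i → let z , p , az , e = att ax i in
      z , star-rest p , az , e , disjoint az , σ∉B i }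
  where
  open Cut C
  star-rest : ∀ {x z} → Star (Within (Graph.Adj G) A) x z → Star (Within (Rest G B) A) x z
  star-rest ε = ε
  star-rest ((ax , az , e) ◅ p) = (ax , az , e , disjoint ax , disjoint az) ◅ star-rest p

-- Separators of order at most nine

-- For s = m + 3 the resolution needs m (m + 1) colours, less 4 for two excluded pairs if
-- s ≥ 7, and the bags with receiving colours need (m + 2) (m + 3) / 2, less 5 if s = 7.
data Manageable : (s q : ℕ) → Set where
  six   : ∀ {s q} → s ≤ 6 → 16 ≤ q → Manageable s q
  seven : ∀ {q} → 16 ≤ q → Manageable 7 q
  eight : ∀ {q} → 28 ≤ q → Manageable 8 q
  nine  : ∀ {q} → 40 ≤ q → Manageable 9 q

module _ {G : Graph} {s q : ℕ} {σ : Fin s → Vertex G} (α₀ : Fin q) (uncolourable : ¬ Colorable q G)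
  (minors : Minors<-Colorable q G) {A B : Vertex G → Set} (C : Cut G σ A B) (att-A : Attached G σ A) (att-B : Attached G σ B) where

  private
    S = cut-sides α₀ minors uncolourable C
    c₁ = cut-colouring α₀ minors (flip-cut C)
    c₂ = cut-colouring α₀ minors C

    irrefl : ∀ {D : Vertex G → Set} {x} → ¬ Rest G D x x
    irrefl (e , _) = Graph.irrefl G e

    avoiding : 2 < s → 2 + s < q → EdgeAvoiding (Rest G B) σ × EdgeAvoiding (Rest G A) σ
    avoiding 2<s room =
      edge-avoiding S (Cut.σ-inj C) (irrefl {B}) (irrefl {A}) (cut-interior C att-A) (cut-interior (flip-cut C) att-B) 2<s room ,
      edge-avoiding (flip-sides S) (Cut.σ-inj C) (irrefl {A}) (irrefl {B}) (cut-interior (flip-cut C) att-B) (cut-interior C att-A) 2<s room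

    large : ∀ {m} (s≤ : s ≤ 3 + m) (e<m : 3 < m) (demands≤ : length (offDiagonal (suc m)) ≤ 4 + q) → 7 ≤ s → 2 + s < q →
      Starrable s≤ e<m demands≤ {σ} (Rest G B) → Starrable s≤ e<m demands≤ {σ} (Rest G A) → ⊥
    large s≤ e<m demands≤ 7≤s room starB starA =
      let avB , avA = avoiding (≤-trans (s≤s (s≤s (s≤s z≤n))) 7≤s) room in
      sides-impossible s≤ e<m demands≤ S
        (λ lab s≤K indep → exclusions {E = Rest G B} {σ} (rest-sym G) avB lab indep s≤K (four s≤K) i₀)
        (λ lab s≤K indep → exclusions {E = Rest G A} {σ} (rest-sym G) avA lab indep s≤K (four s≤K) i₀)
        starB starA c₁ c₂
      where
      i₀ : Fin s
      i₀ = fromℕ< (≤-trans (s≤s z≤n) 7≤s)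
      four : ∀ {K} → s ≤ 3 + K → 4 ≤ K
      four s≤K = s≤s⁻¹ (s≤s⁻¹ (s≤s⁻¹ (≤-trans 7≤s s≤K)))

  cut-impossible : Manageable s q → ⊥
  cut-impossible (six s≤6 16≤q) =
    -- Separators with fewer than six vertices are counted as having six: 12 colours for the
    -- resolution, 15 with receiving colours.
    sides-impossible {m = 3} {e = 0} s≤6 (s≤s (s≤s z≤n)) off
      S (no-exclusions s≤6 (s≤s (s≤s z≤n)) off {σ} {Rest G B}) (no-exclusions s≤6 (s≤s (s≤s z≤n)) off {σ} {Rest G A})
      (star {Rest G B}) (star {Rest G A}) c₁ c₂
    where
    off : length (offDiagonal 4) ≤ q
    off = ≤-trans (m≤m+n 12 4) 16≤q
    star : ∀ {E : Rel (Vertex G) 0ℓ} → Starrable s≤6 (s≤s (s≤s z≤n)) off {σ} E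
    star {E} = starrable s≤6 (≤-trans (≤-reflexive length-lower₅) (≤-trans (m≤m+n 15 1) 16≤q)) {σ} {E}
  cut-impossible (seven 16≤q) =
    let avB , avA = avoiding (s≤s (s≤s (s≤s z≤n))) (≤-trans (m≤m+n 10 6) 16≤q) in
    large {4} ≤-refl ≤-refl (+-monoʳ-≤ 4 16≤q) ≤-refl (≤-trans (m≤m+n 10 6) 16≤q)
      (starrable₇ 16≤q {σ} {Rest G B} (rest-sym G) (irrefl {B}) avB) (starrable₇ 16≤q {σ} {Rest G A} (rest-sym G) (irrefl {A}) avA)
  cut-impossible (eight 28≤q) =
    large {5} ≤-refl (s≤s (s≤s (s≤s (s≤s z≤n)))) (≤-trans (m≤m+n 30 2) (+-monoʳ-≤ 4 28≤q)) (m≤m+n 7 1) (≤-trans (m≤m+n 11 17) 28≤q)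
      (star {Rest G B}) (star {Rest G A})
    where
    star : ∀ {E : Rel (Vertex G) 0ℓ} {a b} → a ≢ b → ¬ E (σ a) (σ b) → Σ[ r ∈ ℕ ] StarDemands q r E σ a b
    star {E} = starrable ≤-refl (≤-trans (≤-reflexive length-lower₇) 28≤q) {σ} {E}
  cut-impossible (nine 40≤q) =
    large {6} ≤-refl (s≤s (s≤s (s≤s (s≤s z≤n)))) (≤-trans (m≤m+n 42 2) (+-monoʳ-≤ 4 40≤q)) (m≤m+n 7 2) (≤-trans (m≤m+n 12 28) 40≤q)
      (star {Rest G B}) (star {Rest G A})
    where
    star : ∀ {E : Rel (Vertex G) 0ℓ} {a b} → a ≢ b → ¬ E (σ a) (σ b) → Σ[ r ∈ ℕ ] StarDemands q r E σ a b
    star {E} = starrable ≤-refl (≤-trans (≤-reflexive length-lower₈) (≤-trans (m≤m+n 36 4) 40≤q)) {σ} {E}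

-- Minimal separators and connectivity

enum : ∀ {n} (p : Subset n) → Fin ∣ p ∣ → Fin n
enum (true ∷ p)  zero    = zero
enum (true ∷ p)  (suc i) = suc (enum p i)
enum (false ∷ p) i       = suc (enum p i)

enum-∈ : ∀ {n} (p : Subset n) i → enum p i ∈ˢ p
enum-∈ (true ∷ p)  zero    = here
enum-∈ (true ∷ p)  (suc i) = there (enum-∈ p i)
enum-∈ (false ∷ p) i       = there (enum-∈ p i)

enum-injective : ∀ {n} (p : Subset n) {i j} → enum p i ≡ enum p j → i ≡ j
enum-injective (true ∷ p) {zero}  {zero}  _  = refl
enum-injective (true ∷ p) {suc i} {suc j} eq = cong suc (enum-injective p (suc-injective eq))
enum-injective (false ∷ p) eq                = enum-injective p (suc-injective eq)

enum-onto : ∀ {n} {p : Subset n} {x} → x ∈ˢ p → Σ[ i ∈ Fin ∣ p ∣ ] x ≡ enum p i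
enum-onto {p = true ∷ p}  here       = zero , refl
enum-onto {p = true ∷ p}  (there x∈) = let i , eq = enum-onto x∈ in suc i , cong suc eq
enum-onto {p = false ∷ p} (there x∈) = let i , eq = enum-onto x∈ in i , cong suc eq

module _ {G : Graph} where

  open Graph G using (Adj)

  Reach : Subset (order G) → Rel (Vertex G) 0ℓ
  Reach S = Star (Within Adj (_∉ˢ S))

  reach? : ∀ S → Decidable (Reach S)
  reach? S = star? (within? (Graph.adj? G) (λ x → ¬? (x ∈ˢ? S)))

  -- Until the walk meets `t` it avoids `S`, so closure keeps it in `P`; as it ends outside `P`, it
  -- must meet `t`.
  leave : ∀ {S t} {P : Vertex G → Set} → (∀ {x y} → P x → Adj x y → y ∉ˢ S → P y) → ∀ {x y} → P x → ¬ P y →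
          Reach (S - t) x y → Σ[ z ∈ Vertex G ] Star (Within Adj P) x z × P z × Adj z t
  leave closed px ¬py ε = contradiction px ¬py
  leave {S} {t} closed {x} px ¬py (_◅_ {j = w} (_ , w∉ , e) p) with w ≟ t
  ... | yes refl = x , ε , px , e
  ... | no w≢t =
    let pw = closed px e (λ w∈ → w∉ (x∈p∧x≢y⇒x∈p-y w∈ w≢t))
        z , q , pz , e′ = leave closed pw ¬py p
    in z , (px , pw , e) ◅ q , pz , e′

  module Minimal (S : Subset (order G)) {x₀ y₀ : Vertex G} (x₀∉ : x₀ ∉ˢ S) (y₀∉ : y₀ ∉ˢ S) (apart : ¬ Reach S x₀ y₀)
    (minimal : ∀ {t} → t ∈ˢ S → ∀ {x y} → x ∉ˢ S - t → y ∉ˢ S - t → Reach (S - t) x y) where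

    A B : Vertex G → Set
    A x = x ∉ˢ S × Reach S x₀ x
    B x = x ∉ˢ S × ¬ Reach S x₀ x

    ∉-smaller : ∀ {t x} → x ∉ˢ S → x ∉ˢ S - t
    ∉-smaller x∉ x∈ = x∉ (p─q⊆p _ _ x∈)

    A-closed : ∀ {x y} → A x → Adj x y → y ∉ˢ S → A y
    A-closed (x∉ , r) e y∉ = y∉ , star-last r x₀∉ y∉ e

    B-closed : ∀ {x y} → B x → Adj x y → y ∉ˢ S → B y
    B-closed (x∉ , ¬r) e y∉ = y∉ , λ r → ¬r (star-last r x₀∉ x∉ (Graph.sym G e))

    attached-A : Attached G (enum S) A
    attached-A ax@(x∉ , _) i = leave A-closed ax (λ (_ , r) → apart r) (minimal (enum-∈ S i) (∉-smaller x∉) (∉-smaller y₀∉))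

    -- `B` may have several components. Each of them reaches `x₀` as soon as one separator vertex is
    -- restored, and only through that vertex.
    attached-B : Attached G (enum S) B
    attached-B bx@(x∉ , _) i = leave B-closed bx (λ (_ , ¬r) → ¬r ε) (minimal (enum-∈ S i) (∉-smaller x∉) (∉-smaller x₀∉))

    cut : Cut G (enum S) A B
    cut = record
      { A? = λ x → ¬? (x ∈ˢ? S) ×-dec reach? S x₀ x ; B? = λ x → ¬? (x ∈ˢ? S) ×-dec ¬? (reach? S x₀ x)
      ; some-A = x₀ , x₀∉ , ε ; some-B = y₀ , y₀∉ , apart ; disjoint = λ (_ , r) (_ , ¬r) → ¬r r
      ; σ-inj = enum-injective S ; σ∉A = λ i (i∉ , _) → i∉ (enum-∈ S i) ; σ∉B = λ i (i∉ , _) → i∉ (enum-∈ S i)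
      ; cover = cover ; no-edge = λ ax (y∉ , ¬r) e → ¬r (proj₂ (A-closed ax e y∉)) }
      where
      cover : ∀ x → A x ⊎ B x ⊎ (Σ[ i ∈ Fin ∣ S ∣ ] x ≡ enum S i)
      cover x with x ∈ˢ? S | reach? S x₀ x
      ... | yes x∈ | _     = inj₂ (inj₂ (enum-onto x∈))
      ... | no x∉  | yes r = inj₁ (x∉ , r)
      ... | no x∉  | no ¬r = inj₂ (inj₁ (x∉ , ¬r))

  module _ {q m : ℕ} (α₀ : Fin q) (uncolourable : ¬ Colorable q G) (minors : Minors<-Colorable q G)
    (manageable : ∀ {s} → s < m → Manageable s q) where

    -- Induction on the size of `S`: the sets with one vertex less do not separate, so a separating
    -- `S` would be a minimal cut, which `cut-impossible` excludes.
    unseparated : ∀ S → Acc _<_ ∣ S ∣ → ∣ S ∣ < m → ∀ {x y} → x ∉ˢ S → y ∉ˢ S → Reach S x y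
    unseparated S (acc rec) S<m {x} {y} x∉ y∉ with reach? S x y
    ... | yes r = r
    ... | no ¬r = ⊥-elim (cut-impossible α₀ uncolourable minors cut attached-A attached-B (manageable S<m))
      where
      minimal : ∀ {t} → t ∈ˢ S → ∀ {x y} → x ∉ˢ S - t → y ∉ˢ S - t → Reach (S - t) x y
      minimal t∈ = unseparated _ (rec (x∈p⇒∣p-x∣<∣p∣ t∈)) (≤-trans (x∈p⇒∣p-x∣<∣p∣ t∈) (<⇒≤ S<m))
      open Minimal S x∉ y∉ ¬r minimal

    to-deleted : ∀ {S x y} → Reach S x y → (x∈ : x ∈ˢ ∁ S) (y∈ : y ∈ˢ ∁ S) → Star (deleteAdj G S) (x , x∈) (y , y∈)
    to-deleted ε x∈ y∈ with refl ← []=-irrelevant x∈ y∈ = ε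
    to-deleted ((_ , w∉ , e) ◅ p) x∈ y∈ = e ◅ to-deleted p (x∉p⇒x∈∁p w∉) y∈

    connected : m < order G → m -Connected G
    connected m<n = m<n , λ S S<m (x , x∈) (y , y∈) →
      to-deleted (unseparated S (<-wellFounded _) S<m (x∈∁p⇒x∉p x∈) (x∈∁p⇒x∉p y∈)) x∈ y∈

critical-connected : ∀ {q m G} → ContractionCritical (suc q) G → 0 < q → m < suc q →
                     (∀ {s} → s < m → Manageable s q) → m -Connected G
critical-connected {q} {m} {G} ((_ , least-colours) , proper-minors) 0<q m≤q manageable =
  connected {G} (fromℕ< 0<q) (λ col → <-irrefl refl (least-colours q col))
    (λ H minor H<G → proper-minors H (minor , λ (φ , _) → <-irrefl (↔⇒≡ φ) H<G)) manageable
    -- Colouring all vertices differently shows that the order is at least the chromatic number.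
    (≤-trans m≤q (least-colours (order G) (id , λ e eq → Graph.irrefl G (subst (Graph.Adj G _) (sym eq) e))))

up-to-7 : ∀ {s q} → 16 ≤ q → s < 8 → Manageable s q
up-to-7 16≤q (s≤s s≤7) with m≤n⇒m<n∨m≡n s≤7
... | inj₁ (s≤s s≤6) = six s≤6 16≤q
... | inj₂ refl      = seven 16≤q

up-to-8 : ∀ {s q} → 28 ≤ q → s < 9 → Manageable s q
up-to-8 28≤q (s≤s s≤8) with m≤n⇒m<n∨m≡n s≤8
... | inj₁ s<8  = up-to-7 (≤-trans (m≤m+n 16 12) 28≤q) s<8
... | inj₂ refl = eight 28≤q

up-to-9 : ∀ {s q} → 40 ≤ q → s < 10 → Manageable s q
up-to-9 40≤q (s≤s s≤9) with m≤n⇒m<n∨m≡n s≤9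
... | inj₁ s<9  = up-to-8 (≤-trans (m≤m+n 28 12) 40≤q) s<9
... | inj₂ refl = nine 40≤q

eight-connected : ∀ {k} G → ContractionCritical k G → k ≥ 17 → 8 -Connected G
eight-connected G crit (s≤s 16≤q) =
  critical-connected {G = G} crit (≤-trans (s≤s z≤n) 16≤q) (s≤s (≤-trans (m≤m+n 8 8) 16≤q)) (up-to-7 16≤q)

nine-connected : ∀ {k} G → ContractionCritical k G → k ≥ 29 → 9 -Connected G
nine-connected G crit (s≤s 28≤q) =
  critical-connected {G = G} crit (≤-trans (s≤s z≤n) 28≤q) (s≤s (≤-trans (m≤m+n 9 19) 28≤q)) (up-to-8 28≤q)

ten-connected : ∀ {k} G → ContractionCritical k G → k ≥ 41 → 10 -Connected G
ten-connected G crit (s≤s 40≤q) =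
  critical-connected {G = G} crit (≤-trans (s≤s z≤n) 40≤q) (s≤s (≤-trans (m≤m+n 10 30) 40≤q)) (up-to-9 40≤q)

theorem1p3 : (∀ (k : ℕ) (G : Graph) → ContractionCritical k G →
    (k ≥ 17 → 8 -Connected G) ×
    (k ≥ 29 → 9 -Connected G) ×
    (k ≥ 41 → 10 -Connected G))
    ×
    (∀ (k : ℕ) →
    (k ≥ 17 → h[ k ]≥ 8) ×
    (k ≥ 29 → h[ k ]≥ 9) ×
    (k ≥ 41 → h[ k ]≥ 10))
theorem1p3 =
  (λ k G crit → eight-connected G crit , nine-connected G crit , ten-connected G crit) ,
  (λ k → (λ k≥ G crit _ → eight-connected G crit k≥) , (λ k≥ G crit _ → nine-connected G crit k≥) , (λ k≥ G crit _ → ten-connected G crit k≥))
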